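{- Let $\mathbb{K}$ be any field and let $\Delta$ be a zero-dimensional simplicial complex on $[n]=\{1,\dots,n\}$ with no loops (so $\Delta=\{\emptyset,\{1\},\dots,\{n\}\}$). Then for all $\mathbf{a}\in\mathbb{N}^n$ and $\mathbf{b}\in\{0,1\}^n$ with disjoint supports, $$\dim_{\mathbb{K}}T^2_{\mathbf{a}-\mathbf{b}}(\Delta)=\begin{cases}\max\{n-3,0\} & \text{if }\mathbf{a}=0\text{ and }\#\mathbf{b}=2,\\ 0 & \text{otherwise},\end{cases}$$ where $\#\mathbf{b}$ is the cardinality of the support of $\mathbf{b}$. In particular, $T^2(\Delta)=0$ if and only if $n\le 3$.
   Context: A simplicial complex on $[n]$ is a family of subsets of $[n]$ closed under taking subsets; no loops means $\{i\}\in\Delta$ for all $i\in[n]$. $\mathbb{N}$ includes $0$. $T^2(\Delta)$ is the second cotangent cohomology module of the Stanley-Reisner ring $S/I_\Delta$, where $S=\mathbb{K}[x_1,\dots,x_n]$ and $I=I_\Delta=\langle\prod_{i\in F}x_i : F\subseteq[n],\ F\notin\Delta\rangle$. Explicitly: let $m$ be the number of minimal monomial generators of $I$, let $d:S^m\to S$ be the $S$-linear map sending the canonical basis to these generators, $\operatorname{Syz}(I)=\ker d$, and $\operatorname{Kosz}(I)\subseteq\operatorname{Syz}(I)$ the submodule generated by all $d(f)g-d(g)f$ with $f,g\in S^m$. The quotient $\operatorname{Syz}(I)/\operatorname{Kosz}(I)$ is an $S/I$-module, and $T^2(\Delta)$ is the cokernel of the induced (restriction) map $\operatorname{Hom}_S(S^m,S/I)\to\operatorname{Hom}_{S/I}(\operatorname{Syz}(I)/\operatorname{Kosz}(I),S/I)$.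 Since $I$ is a monomial ideal, all these modules are $\mathbb{Z}^n$-graded ($\deg x_i=e_i$, with the basis elements of $S^m$ placed in degrees making $d$ homogeneous of degree $0$, and a homomorphism having degree $\mathbf{c}$ if it shifts degrees by $\mathbf{c}$). $T^2_{\mathbf{c}}(\Delta)$ denotes the component of degree $\mathbf{c}\in\mathbb{Z}^n$. -}

module Defs where

open import Algebra.Apartness.Bundles using (HeytingField; HeytingCommutativeRing)
open import Algebra.Bundles using (AbelianGroup; CommutativeRing)
import Algebra.Consequences.Setoid as Consequences
open import Algebra.Core using (Op₁; Op₂)
open import Algebra.Module.Bundles using (Module)
open import Algebra.Module.Construct.TensorUnit using (⟨module⟩)
open import Algebra.Module.Core using (Opₗ)
open import Algebra.Module.Morphism.Structures using (module ModuleMorphisms)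
open import Algebra.Module.Structures using (IsModule)
open import Algebra.Module.Structures.Biased using (IsModuleFromLeft)
open import Algebra.Morphism.Structures using (module RingMorphisms)
import Algebra.Properties.AbelianGroup as AbelianGroupProperties
import Algebra.Properties.CommutativeMonoid.Sum as Summation
import Algebra.Properties.CommutativeSemigroup as CommutativeSemigroupProperties
open import Algebra.Structures using (IsAbelianGroup; IsCommutativeRing)
open import Data.Bool.Base using (true; false; if_then_else_)
open import Data.Fin.Base using (Fin; zero; suc)
open import Data.Fin.Properties as Fin using ()
open import Data.Fin.Subset using (Subset; _⊆_; ⁅_⁆; ∣_∣)
open import Data.Integer.Base as ℤ using (ℤ; +_)
open import Data.List.Base as List using (List; []; _∷_; _++_; length; lookup; filter)
open import Data.List.Membership.Propositional using (_∈_; find)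
open import Data.List.Membership.Propositional.Properties
  using (∈-filter⁺; ∈-filter⁻; ∈-map⁺; ∈-map⁻; ∈-++⁺ˡ; ∈-++⁺ʳ; ∈-lookup)
open import Data.List.Relation.Unary.All as All using (All; all?)
open import Data.List.Relation.Unary.All.Properties using (¬All⇒Any¬)
open import Data.List.Relation.Unary.Any as Any using (here)
open import Data.List.Relation.Unary.Any.Properties using (lookup-index)
open import Data.Nat.Base as ℕ using (ℕ; zero; suc; _≤_; _<_)
import Data.Nat.Induction as ℕ
import Data.Nat.Properties as ℕ
open import Data.Product.Base using (Σ; ∃; ∃₂; _×_; _,_; proj₁; proj₂)
open import Data.Vec.Base as Vec using (Vec; []; _∷_)
open import Data.Vec.Properties using (≡-dec; ∷-injective)
open import Data.Vec.Relation.Binary.Pointwise.Inductive as Pointwise using (Pointwise; []; _∷_)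
open import Function.Base using (_∘_; id; flip)
open import Induction.WellFounded using (Acc; acc)
open import Level using (Level; _⊔_; 0ℓ) renaming (suc to lsuc)
open import Relation.Binary.Bundles using (Setoid)
open import Relation.Binary.Core using (Rel)
open import Relation.Binary.PropositionalEquality as ≡ using (_≡_; _≢_)
open import Relation.Binary.Structures using (IsEquivalence)
open import Relation.Nullary.Decidable using (Dec; yes; no; does; ¬?; _→-dec_)
open import Relation.Nullary.Negation using (¬_; contradiction)
open import Relation.Unary using (Pred; Decidable)

private
  variable
    r ℓr s ℓs m ℓm m′ ℓm′ m″ ℓm″ p p′ : Level

module _ (R : CommutativeRing r ℓr) where
  open CommutativeRing R using (Carrier; _≈_; _+_; _*_; 0#; 1#)

  record ModuleLaws {A : Set m} (_≈ᴹ_ : Rel A ℓm) (_+ᴹ_ : Op₂ A) (0ᴹ : A)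
                    (-ᴹ_ : Op₁ A) (_*ₗ_ : Opₗ Carrier A)
                    : Set (r ⊔ ℓr ⊔ m ⊔ ℓm) where
    field
      isEquivalence : IsEquivalence _≈ᴹ_
      +-cong      : ∀ {x x′ y y′} → x ≈ᴹ x′ → y ≈ᴹ y′ → (x +ᴹ y) ≈ᴹ (x′ +ᴹ y′)
      +-assoc     : ∀ x y z → ((x +ᴹ y) +ᴹ z) ≈ᴹ (x +ᴹ (y +ᴹ z))
      +-identityˡ : ∀ x → (0ᴹ +ᴹ x) ≈ᴹ x
      +-comm      : ∀ x y → (x +ᴹ y) ≈ᴹ (y +ᴹ x)
      -‿cong      : ∀ {x x′} → x ≈ᴹ x′ → (-ᴹ x) ≈ᴹ (-ᴹ x′)
      -‿inverseˡ  : ∀ x → ((-ᴹ x) +ᴹ x) ≈ᴹ 0ᴹ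
      *-cong      : ∀ {a a′ x x′} → a ≈ a′ → x ≈ᴹ x′ → (a *ₗ x) ≈ᴹ (a′ *ₗ x′)
      *-distribˡ  : ∀ a x y → (a *ₗ (x +ᴹ y)) ≈ᴹ ((a *ₗ x) +ᴹ (a *ₗ y))
      *-distribʳ  : ∀ x a b → ((a + b) *ₗ x) ≈ᴹ ((a *ₗ x) +ᴹ (b *ₗ x))
      *-assoc     : ∀ a b x → ((a * b) *ₗ x) ≈ᴹ (a *ₗ (b *ₗ x))
      *-identityˡ : ∀ x → (1# *ₗ x) ≈ᴹ x

    open IsEquivalence isEquivalence using (refl; sym; trans)

    setoid : Setoid m ℓm
    setoid = record { isEquivalence = isEquivalence }

    open Consequences setoid using (comm∧idˡ⇒id; comm∧invˡ⇒inv)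

    +-isAbelianGroup : IsAbelianGroup _≈ᴹ_ _+ᴹ_ 0ᴹ -ᴹ_
    +-isAbelianGroup = record
      { isGroup = record
        { isMonoid = record
          { isSemigroup = record
            { isMagma = record { isEquivalence = isEquivalence ; ∙-cong = +-cong }
            ; assoc = +-assoc }
          ; identity = comm∧idˡ⇒id +-comm +-identityˡ }
        ; inverse = comm∧invˡ⇒inv +-comm -‿inverseˡ
        ; ⁻¹-cong = -‿cong }
      ; comm = +-comm }

    open IsAbelianGroup +-isAbelianGroup using (isCommutativeMonoid; inverse)

    +-abelianGroup : AbelianGroup m ℓm
    +-abelianGroup = record { isAbelianGroup = +-isAbelianGroup }

    open AbelianGroupProperties +-abelianGroup using (identityʳ-unique)

    private
      zeroˡ : ∀ x → (0# *ₗ x) ≈ᴹ 0ᴹ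
      zeroˡ x = identityʳ-unique _ _
        (trans (sym (*-distribʳ x 0# 0#))
               (*-cong (CommutativeRing.+-identityˡ R 0#) refl))

      zeroʳ : ∀ a → (a *ₗ 0ᴹ) ≈ᴹ 0ᴹ
      zeroʳ a = identityʳ-unique _ _
        (trans (sym (*-distribˡ a 0ᴹ 0ᴹ))
               (*-cong (CommutativeRing.refl R) (+-identityˡ 0ᴹ)))

    -- Abstract, so that comparing modules does not unfold proofs.
    abstract
      isModule : IsModule R _≈ᴹ_ _+ᴹ_ 0ᴹ -ᴹ_ _*ₗ_ (flip _*ₗ_)
      isModule = IsModuleFromLeft.isModule {commutativeRing = R} (record
        { isLeftModule = record
          { isLeftSemimodule = record
            { +ᴹ-isCommutativeMonoid = isCommutativeMonoid
            ; isPreleftSemimodule = record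
              { *ₗ-cong = *-cong ; *ₗ-zeroˡ = zeroˡ ; *ₗ-distribʳ = *-distribʳ
              ; *ₗ-identityˡ = *-identityˡ ; *ₗ-assoc = *-assoc
              ; *ₗ-zeroʳ = zeroʳ ; *ₗ-distribˡ = *-distribˡ } }
          ; -ᴹ‿cong = -‿cong
          ; -ᴹ‿inverse = inverse } })

    module′ : Module R _ _
    module′ = record { isModule = isModule }

module _ {R : CommutativeRing r ℓr} where
  open CommutativeRing R using (Carrier; 0#; 1#; refl)

  module ModuleProperties (M : Module R m ℓm) where
    open Module M public
    open AbelianGroupProperties +ᴹ-abelianGroup public
    open CommutativeSemigroupProperties
      (AbelianGroup.commutativeSemigroup +ᴹ-abelianGroup) public using (interchange)
    open Summation +ᴹ-commutativeMonoid public using (sum)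

    -ᴹ≈-1*ₗ : ∀ x → (CommutativeRing.-_ R 1# *ₗ x) ≈ᴹ (-ᴹ x)
    -ᴹ≈-1*ₗ x = inverseˡ-unique _ _
      (≈ᴹ-trans (+ᴹ-cong ≈ᴹ-refl (≈ᴹ-sym (*ₗ-identityˡ x)))
      (≈ᴹ-trans (≈ᴹ-sym (*ₗ-distribʳ x _ _))
      (≈ᴹ-trans (*ₗ-cong (CommutativeRing.-‿inverseˡ R 1#) ≈ᴹ-refl) (*ₗ-zeroˡ x))))

    *ₗ-neg : ∀ a x → (a *ₗ (-ᴹ x)) ≈ᴹ (-ᴹ (a *ₗ x))
    *ₗ-neg a x = inverseˡ-unique _ _
      (≈ᴹ-trans (≈ᴹ-sym (*ₗ-distribˡ a _ _))
      (≈ᴹ-trans (*ₗ-cong refl (-ᴹ‿inverseˡ x)) (*ₗ-zeroʳ a)))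

    -- x - y = (x - z) + (z - y)
    diff-trans : ∀ x y z → ((x +ᴹ (-ᴹ z)) +ᴹ (z +ᴹ (-ᴹ y))) ≈ᴹ (x +ᴹ (-ᴹ y))
    diff-trans x y z =
      ≈ᴹ-trans (+ᴹ-assoc x _ _) (+ᴹ-cong ≈ᴹ-refl
      (≈ᴹ-trans (≈ᴹ-sym (+ᴹ-assoc _ z _))
      (≈ᴹ-trans (+ᴹ-cong (-ᴹ‿inverseˡ z) ≈ᴹ-refl) (+ᴹ-identityˡ _))))

    diff-sym : ∀ x y → (-ᴹ (x +ᴹ (-ᴹ y))) ≈ᴹ (y +ᴹ (-ᴹ x))
    diff-sym = ⁻¹-anti-homo‿-

    diff-+ : ∀ x x′ y y′ →
             ((x +ᴹ (-ᴹ x′)) +ᴹ (y +ᴹ (-ᴹ y′))) ≈ᴹ ((x +ᴹ y) +ᴹ (-ᴹ (x′ +ᴹ y′)))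
    diff-+ x x′ y y′ =
      ≈ᴹ-trans (interchange _ _ _ _) (+ᴹ-cong ≈ᴹ-refl (⁻¹-∙-comm x′ y′))

    diff-neg : ∀ x x′ → (-ᴹ (x +ᴹ (-ᴹ x′))) ≈ᴹ ((-ᴹ x) +ᴹ (-ᴹ (-ᴹ x′)))
    diff-neg x x′ = ≈ᴹ-sym (⁻¹-∙-comm x (-ᴹ x′))

    diff-*ₗ : ∀ a x x′ → (a *ₗ (x +ᴹ (-ᴹ x′))) ≈ᴹ ((a *ₗ x) +ᴹ (-ᴹ (a *ₗ x′)))
    diff-*ₗ a x x′ = ≈ᴹ-trans (*ₗ-distribˡ a _ _) (+ᴹ-cong ≈ᴹ-refl (*ₗ-neg a x′))

    ≈⇒diff≈0 : ∀ {x y} → x ≈ᴹ y → (x +ᴹ (-ᴹ y)) ≈ᴹ 0ᴹ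
    ≈⇒diff≈0 {y = y} x≈y = ≈ᴹ-trans (+ᴹ-cong x≈y ≈ᴹ-refl) (-ᴹ‿inverseʳ y)

    diff-0 : ∀ x → (x +ᴹ (-ᴹ 0ᴹ)) ≈ᴹ x
    diff-0 x = ≈ᴹ-trans (+ᴹ-cong ≈ᴹ-refl ε⁻¹≈ε) (+ᴹ-identityʳ x)

  record Hom (M : Module R m ℓm) (N : Module R m′ ℓm′)
             : Set (r ⊔ m ⊔ ℓm ⊔ m′ ⊔ ℓm′) where
    private
      module M = Module M
      module N = Module N
    open ModuleMorphisms M.rawModule N.rawModule using (IsModuleHomomorphism)
    field
      ⟦_⟧ : M.Carrierᴹ → N.Carrierᴹ
      isModuleHomomorphism : IsModuleHomomorphism ⟦_⟧
    open IsModuleHomomorphism isModuleHomomorphism public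

  open Hom using (⟦_⟧)

  module _ (M : Module R m ℓm) (N : Module R m′ ℓm′) where
    private
      module M = ModuleProperties M
      module N = ModuleProperties N

    open ModuleMorphisms M.rawModule N.rawModule using (IsModuleHomomorphism)

    abstract
      linear⇒isModuleHomomorphism : (f : M.Carrierᴹ → N.Carrierᴹ) →
        (∀ {x y} → x M.≈ᴹ y → f x N.≈ᴹ f y) →
        (∀ x y → f (x M.+ᴹ y) N.≈ᴹ (f x N.+ᴹ f y)) →
        (∀ a x → f (a M.*ₗ x) N.≈ᴹ (a N.*ₗ f x)) →
        IsModuleHomomorphism f
      linear⇒isModuleHomomorphism f f-cong f-+ f-* = record
        { isBimoduleHomomorphism = record
          { +ᴹ-isGroupHomomorphism = record
            { isMonoidHomomorphism = record
              { isMagmaHomomorphism = record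
                { isRelHomomorphism = record { cong = f-cong }
                ; homo = f-+ }
              ; ε-homo = f-0 }
            ; ⁻¹-homo = λ x → N.inverseˡ-unique _ _
                (N.≈ᴹ-trans (N.≈ᴹ-sym (f-+ _ x))
                (N.≈ᴹ-trans (f-cong (M.-ᴹ‿inverseˡ x)) f-0)) }
          ; *ₗ-homo = f-*
          ; *ᵣ-homo = λ a x →
              N.≈ᴹ-trans (f-cong (M.≈ᴹ-sym (M.*ₗ-*ᵣ-coincident a x)))
              (N.≈ᴹ-trans (f-* a x) (N.*ₗ-*ᵣ-coincident a (f x))) } }
        where
        f-0 : f M.0ᴹ N.≈ᴹ N.0ᴹ
        f-0 = N.≈ᴹ-trans (f-cong (M.≈ᴹ-sym (M.*ₗ-zeroˡ M.0ᴹ)))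
              (N.≈ᴹ-trans (f-* 0# M.0ᴹ) (N.*ₗ-zeroˡ (f M.0ᴹ)))

    mkHom : (f : M.Carrierᴹ → N.Carrierᴹ) →
            (∀ {x y} → x M.≈ᴹ y → f x N.≈ᴹ f y) →
            (∀ x y → f (x M.+ᴹ y) N.≈ᴹ (f x N.+ᴹ f y)) →
            (∀ a x → f (a M.*ₗ x) N.≈ᴹ (a N.*ₗ f x)) →
            Hom M N
    mkHom f f-cong f-+ f-* = record
      { ⟦_⟧ = f
      ; isModuleHomomorphism = linear⇒isModuleHomomorphism f f-cong f-+ f-* }

    homModule : Module R (r ⊔ m ⊔ ℓm ⊔ m′ ⊔ ℓm′) (m ⊔ ℓm′)
    homModule = ModuleLaws.module′ laws
      where
      module H (φ : Hom M N) = Hom φ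

      laws : ModuleLaws R
        (λ (φ ψ : Hom M N) → ∀ x → ⟦ φ ⟧ x N.≈ᴹ ⟦ ψ ⟧ x)
        (λ φ ψ → mkHom (λ x → ⟦ φ ⟧ x N.+ᴹ ⟦ ψ ⟧ x)
          (λ e → N.+ᴹ-cong (H.⟦⟧-cong φ e) (H.⟦⟧-cong ψ e))
          (λ x y → N.≈ᴹ-trans (N.+ᴹ-cong (H.+ᴹ-homo φ x y) (H.+ᴹ-homo ψ x y))
                              (N.interchange _ _ _ _))
          (λ a x → N.≈ᴹ-trans (N.+ᴹ-cong (H.*ₗ-homo φ a x) (H.*ₗ-homo ψ a x))
                              (N.≈ᴹ-sym (N.*ₗ-distribˡ a _ _))))
        (mkHom (λ _ → N.0ᴹ) (λ _ → N.≈ᴹ-refl)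
          (λ _ _ → N.≈ᴹ-sym (N.+ᴹ-identityˡ _))
          (λ a _ → N.≈ᴹ-sym (N.*ₗ-zeroʳ a)))
        (λ φ → mkHom (λ x → N.-ᴹ ⟦ φ ⟧ x)
          (λ e → N.-ᴹ‿cong (H.⟦⟧-cong φ e))
          (λ x y → N.≈ᴹ-trans (N.-ᴹ‿cong (H.+ᴹ-homo φ x y))
                              (N.≈ᴹ-sym (N.⁻¹-∙-comm _ _)))
          (λ a x → N.≈ᴹ-trans (N.-ᴹ‿cong (H.*ₗ-homo φ a x))
                              (N.≈ᴹ-sym (N.*ₗ-neg a _))))
        (λ a φ → mkHom (λ x → a N.*ₗ ⟦ φ ⟧ x)
          (λ e → N.*ₗ-cong refl (H.⟦⟧-cong φ e))
          (λ x y → N.≈ᴹ-trans (N.*ₗ-cong refl (H.+ᴹ-homo φ x y))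
                              (N.*ₗ-distribˡ a _ _))
          (λ b x → N.≈ᴹ-trans (N.*ₗ-cong refl (H.*ₗ-homo φ b x))
                              (N.*ₗ-comm a b _)))
      laws = record
        { isEquivalence = record
          { refl = λ _ → N.≈ᴹ-refl
          ; sym = λ e x → N.≈ᴹ-sym (e x)
          ; trans = λ e f x → N.≈ᴹ-trans (e x) (f x) }
        ; +-cong = λ e f x → N.+ᴹ-cong (e x) (f x)
        ; +-assoc = λ _ _ _ _ → N.+ᴹ-assoc _ _ _
        ; +-identityˡ = λ _ _ → N.+ᴹ-identityˡ _
        ; +-comm = λ _ _ _ → N.+ᴹ-comm _ _
        ; -‿cong = λ e x → N.-ᴹ‿cong (e x)
        ; -‿inverseˡ = λ _ _ → N.-ᴹ‿inverseˡ _
        ; *-cong = λ e f x → N.*ₗ-cong e (f x)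
        ; *-distribˡ = λ a _ _ _ → N.*ₗ-distribˡ a _ _
        ; *-distribʳ = λ _ a b _ → N.*ₗ-distribʳ _ a b
        ; *-assoc = λ a b _ _ → N.*ₗ-assoc a b _
        ; *-identityˡ = λ _ _ → N.*ₗ-identityˡ _ }

  record Submodule (M : Module R m ℓm) (p : Level)
                   : Set (r ⊔ m ⊔ ℓm ⊔ lsuc p) where
    open Module M
    field
      Mem   : Pred Carrierᴹ p
      resp  : ∀ {x y} → x ≈ᴹ y → Mem x → Mem y
      0-mem : Mem 0ᴹ
      +-mem : ∀ {x y} → Mem x → Mem y → Mem (x +ᴹ y)
      *-mem : ∀ a {x} → Mem x → Mem (a *ₗ x)

    neg-mem : ∀ {x} → Mem x → Mem (-ᴹ x)
    neg-mem {x} x∈ = resp (ModuleProperties.-ᴹ≈-1*ₗ M x) (*-mem _ x∈)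

  open Submodule

  data Span (M : Module R m ℓm) (P : Pred (Module.Carrierᴹ M) p)
            : Pred (Module.Carrierᴹ M) (r ⊔ m ⊔ ℓm ⊔ p) where
    gen   : ∀ {x} → P x → Span M P x
    zero  : Span M P (Module.0ᴹ M)
    plus  : ∀ {x y} → Span M P x → Span M P y → Span M P (Module._+ᴹ_ M x y)
    scale : ∀ a {x} → Span M P x → Span M P (Module._*ₗ_ M a x)
    equal : ∀ {x y} → Module._≈ᴹ_ M x y → Span M P x → Span M P y

  span : (M : Module R m ℓm) → Pred (Module.Carrierᴹ M) p →
         Submodule M (r ⊔ m ⊔ ℓm ⊔ p)
  span M P = record
    { Mem = Span M P ; resp = equal ; 0-mem = zero ; +-mem = plus ; *-mem = scale }

  span-least : (M : Module R m ℓm) (P : Pred (Module.Carrierᴹ M) p)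
               (N : Submodule M p′) →
               (∀ {x} → P x → Mem N x) → ∀ {x} → Span M P x → Mem N x
  span-least M P N f (gen x∈P)    = f x∈P
  span-least M P N f zero         = 0-mem N
  span-least M P N f (plus x y)   = +-mem N (span-least M P N f x) (span-least M P N f y)
  span-least M P N f (scale a x)  = *-mem N a (span-least M P N f x)
  span-least M P N f (equal e x)  = resp N e (span-least M P N f x)

  module _ (M : Module R m ℓm) (N : Submodule M p) where
    private module M = ModuleProperties M

    subModule : Module R (m ⊔ p) ℓm
    subModule = ModuleLaws.module′ laws
      where
      laws : ModuleLaws R {A = Σ M.Carrierᴹ (Mem N)}
        (λ x y → proj₁ x M.≈ᴹ proj₁ y)
        (λ x y → (proj₁ x M.+ᴹ proj₁ y) , +-mem N (proj₂ x) (proj₂ y))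
        (M.0ᴹ , 0-mem N)
        (λ x → (M.-ᴹ proj₁ x) , neg-mem N (proj₂ x))
        (λ a x → (a M.*ₗ proj₁ x) , *-mem N a (proj₂ x))
      laws = record
        { isEquivalence = record
          { refl = M.≈ᴹ-refl ; sym = M.≈ᴹ-sym ; trans = M.≈ᴹ-trans }
        ; +-cong = M.+ᴹ-cong
        ; +-assoc = λ _ _ _ → M.+ᴹ-assoc _ _ _
        ; +-identityˡ = λ _ → M.+ᴹ-identityˡ _
        ; +-comm = λ _ _ → M.+ᴹ-comm _ _
        ; -‿cong = M.-ᴹ‿cong
        ; -‿inverseˡ = λ _ → M.-ᴹ‿inverseˡ _
        ; *-cong = M.*ₗ-cong
        ; *-distribˡ = λ a _ _ → M.*ₗ-distribˡ a _ _
        ; *-distribʳ = λ _ a b → M.*ₗ-distribʳ _ a b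
        ; *-assoc = λ a b _ → M.*ₗ-assoc a b _
        ; *-identityˡ = λ _ → M.*ₗ-identityˡ _ }

    inclusion : Hom subModule M
    inclusion = mkHom subModule M proj₁ id
      (λ _ _ → M.≈ᴹ-refl) (λ _ _ → M.≈ᴹ-refl)

    private
      _~_ : Rel M.Carrierᴹ p
      x ~ y = Mem N (x M.+ᴹ (M.-ᴹ y))

    ≈⇒~ : ∀ {x y} → x M.≈ᴹ y → x ~ y
    ≈⇒~ e = resp N (M.≈ᴹ-sym (M.≈⇒diff≈0 e)) (0-mem N)

    quotientLaws : (∀ {x} a a′ → CommutativeRing._≈_ R a a′ → (a M.*ₗ x) ~ (a′ M.*ₗ x)) →
      ModuleLaws R _~_ M._+ᴹ_ M.0ᴹ M.-ᴹ_ M._*ₗ_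
    quotientLaws *-congʳ = record
      { isEquivalence = record
        { refl = ≈⇒~ M.≈ᴹ-refl
        ; sym = λ e → resp N (M.diff-sym _ _) (neg-mem N e)
        ; trans = ~-trans }
      ; +-cong = λ e f → resp N (M.diff-+ _ _ _ _) (+-mem N e f)
      ; +-assoc = λ _ _ _ → ≈⇒~ (M.+ᴹ-assoc _ _ _)
      ; +-identityˡ = λ _ → ≈⇒~ (M.+ᴹ-identityˡ _)
      ; +-comm = λ _ _ → ≈⇒~ (M.+ᴹ-comm _ _)
      ; -‿cong = λ e → resp N (M.diff-neg _ _) (neg-mem N e)
      ; -‿inverseˡ = λ _ → ≈⇒~ (M.-ᴹ‿inverseˡ _)
      ; *-cong = λ {a} {a′} e f →
          ~-trans (resp N (M.diff-*ₗ a _ _) (*-mem N a f)) (*-congʳ a a′ e)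
      ; *-distribˡ = λ a _ _ → ≈⇒~ (M.*ₗ-distribˡ a _ _)
      ; *-distribʳ = λ _ a b → ≈⇒~ (M.*ₗ-distribʳ _ a b)
      ; *-assoc = λ a b _ → ≈⇒~ (M.*ₗ-assoc a b _)
      ; *-identityˡ = λ _ → ≈⇒~ (M.*ₗ-identityˡ _) }
      where
      ~-trans : ∀ {x y z} → x ~ y → y ~ z → x ~ z
      ~-trans e f = resp N (M.diff-trans _ _ _) (+-mem N e f)

    quotient : Module R m p
    quotient = ModuleLaws.module′
      (quotientLaws (λ _ _ e → ≈⇒~ (M.*ₗ-cong e M.≈ᴹ-refl)))

    projection : Hom M quotient
    projection = mkHom M quotient id ≈⇒~
      (λ _ _ → ≈⇒~ M.≈ᴹ-refl) (λ _ _ → ≈⇒~ M.≈ᴹ-refl)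

  module _ {M : Module R m ℓm} {N : Module R m′ ℓm′} (f : Hom M N) where
    private
      module M = Module M
      module N = Module N
      module f = Hom f

    comap : Submodule N p → Submodule M p
    comap P = record
      { Mem = Mem P ∘ f.⟦_⟧
      ; resp = resp P ∘ f.⟦⟧-cong
      ; 0-mem = resp P (N.≈ᴹ-sym f.0ᴹ-homo) (0-mem P)
      ; +-mem = λ x∈ y∈ → resp P (N.≈ᴹ-sym (f.+ᴹ-homo _ _)) (+-mem P x∈ y∈)
      ; *-mem = λ a x∈ → resp P (N.≈ᴹ-sym (f.*ₗ-homo a _)) (*-mem P a x∈) }

    map : Submodule M p → Submodule N (m ⊔ p ⊔ ℓm′)
    map P = record
      { Mem = λ y → ∃ λ x → Mem P x × f.⟦ x ⟧ N.≈ᴹ y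
      ; resp = λ y≈z (x , x∈ , fx≈y) → x , x∈ , N.≈ᴹ-trans fx≈y y≈z
      ; 0-mem = M.0ᴹ , 0-mem P , f.0ᴹ-homo
      ; +-mem = λ (x , x∈ , e) (y , y∈ , e′) → (x M.+ᴹ y) , +-mem P x∈ y∈ ,
                  N.≈ᴹ-trans (f.+ᴹ-homo x y) (N.+ᴹ-cong e e′)
      ; *-mem = λ a (x , x∈ , e) → (a M.*ₗ x) , *-mem P a x∈ ,
                  N.≈ᴹ-trans (f.*ₗ-homo a x) (N.*ₗ-cong refl e) }

    kernel : Submodule M ℓm′
    kernel = record
      { Mem = λ x → f.⟦ x ⟧ N.≈ᴹ N.0ᴹ
      ; resp = λ x≈y e → N.≈ᴹ-trans (f.⟦⟧-cong (M.≈ᴹ-sym x≈y)) e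
      ; 0-mem = f.0ᴹ-homo
      ; +-mem = λ e e′ → N.≈ᴹ-trans (f.+ᴹ-homo _ _)
                         (N.≈ᴹ-trans (N.+ᴹ-cong e e′) (N.+ᴹ-identityˡ _))
      ; *-mem = λ a e → N.≈ᴹ-trans (f.*ₗ-homo a _)
                        (N.≈ᴹ-trans (N.*ₗ-cong refl e) (N.*ₗ-zeroʳ a)) }

    image : Submodule N (m ⊔ ℓm′)
    image = record
      { Mem = λ y → ∃ λ x → f.⟦ x ⟧ N.≈ᴹ y
      ; resp = λ y≈z (x , e) → x , N.≈ᴹ-trans e y≈z
      ; 0-mem = M.0ᴹ , f.0ᴹ-homo
      ; +-mem = λ (x , e) (y , e′) → (x M.+ᴹ y) ,
                  N.≈ᴹ-trans (f.+ᴹ-homo x y) (N.+ᴹ-cong e e′)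
      ; *-mem = λ a (x , e) → (a M.*ₗ x) ,
                  N.≈ᴹ-trans (f.*ₗ-homo a x) (N.*ₗ-cong refl e) }

    cokernel : Module R m′ (m ⊔ ℓm′)
    cokernel = quotient N image

  free : ℕ → Module R r ℓr
  free k = ModuleLaws.module′ laws
    where
    module R = CommutativeRing R
    laws : ModuleLaws R {A = Fin k → Carrier}
      (λ f g → ∀ i → f i R.≈ g i) (λ f g i → f i R.+ g i) (λ _ → 0#)
      (λ f i → R.- f i) (λ a f i → a R.* f i)
    laws = record
      { isEquivalence = record
        { refl = λ _ → R.refl
        ; sym = λ e i → R.sym (e i)
        ; trans = λ e f i → R.trans (e i) (f i) }
      ; +-cong = λ e f i → R.+-cong (e i) (f i)
      ; +-assoc = λ _ _ _ _ → R.+-assoc _ _ _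
      ; +-identityˡ = λ _ _ → R.+-identityˡ _
      ; +-comm = λ _ _ _ → R.+-comm _ _
      ; -‿cong = λ e i → R.-‿cong (e i)
      ; -‿inverseˡ = λ _ _ → R.-‿inverseˡ _
      ; *-cong = λ e f i → R.*-cong e (f i)
      ; *-distribˡ = λ _ _ _ _ → R.distribˡ _ _ _
      ; *-distribʳ = λ _ _ _ _ → R.distribʳ _ _ _
      ; *-assoc = λ _ _ _ _ → R.*-assoc _ _ _
      ; *-identityˡ = λ _ _ → R.*-identityˡ _ }

  unitVector : ∀ {k} → Fin k → Fin k → Carrier
  unitVector i j = if does (i Fin.≟ j) then 1# else 0#

  module _ (M : Module R m ℓm) where
    open ModuleProperties M

    combination : ∀ {k} → (Fin k → Carrier) → (Fin k → Carrierᴹ) → Carrierᴹ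
    combination c v = sum (λ i → c i *ₗ v i)

    linearMap : ∀ {k} → (Fin k → Carrierᴹ) → Hom (free k) M
    linearMap {k} v = mkHom (free k) M (λ c → combination c v)
      (λ e → Summation.sum-cong-≋ +ᴹ-commutativeMonoid (λ i → *ₗ-cong (e i) ≈ᴹ-refl))
      (λ c c′ → ≈ᴹ-trans
        (Summation.sum-cong-≋ +ᴹ-commutativeMonoid
          (λ i → *ₗ-distribʳ (v i) (c i) (c′ i)))
        (Summation.∑-distrib-+ +ᴹ-commutativeMonoid
          (λ i → c i *ₗ v i) (λ i → c′ i *ₗ v i)))
      (λ a c → homogeneous a c v)
      where
      homogeneous : ∀ {k} a (c : Fin k → Carrier) (v : Fin k → Carrierᴹ) →
        combination (λ i → CommutativeRing._*_ R a (c i)) v ≈ᴹ (a *ₗ combination c v)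
      homogeneous {zero}  a c v = ≈ᴹ-sym (*ₗ-zeroʳ a)
      homogeneous {suc k} a c v = ≈ᴹ-trans
        (+ᴹ-cong (*ₗ-assoc a _ _) (homogeneous a (c ∘ suc) (v ∘ suc)))
        (≈ᴹ-sym (*ₗ-distribˡ a _ _))

    linearMap-unitVector : ∀ {k} (v : Fin k → Carrierᴹ) i →
                           combination (unitVector i) v ≈ᴹ v i
    linearMap-unitVector {suc k} v zero =
      ≈ᴹ-trans (+ᴹ-cong (*ₗ-identityˡ _) (zeros (v ∘ suc))) (+ᴹ-identityʳ _)
      where
      zeros : ∀ {k} (v : Fin k → Carrierᴹ) → combination (λ _ → 0#) v ≈ᴹ 0ᴹ
      zeros {zero}  v = ≈ᴹ-refl
      zeros {suc k} v = ≈ᴹ-trans (+ᴹ-cong (*ₗ-zeroˡ _) (zeros (v ∘ suc))) (+ᴹ-identityˡ _)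
    linearMap-unitVector {suc k} v (suc i) =
      ≈ᴹ-trans (+ᴹ-cong (*ₗ-zeroˡ _) (linearMap-unitVector (v ∘ suc) i)) (+ᴹ-identityˡ _)

    record IsBasis {k} (v : Fin k → Carrierᴹ) : Set (r ⊔ ℓr ⊔ m ⊔ ℓm) where
      field
        spanning    : ∀ x → ∃ λ c → combination c v ≈ᴹ x
        independent : ∀ c → combination c v ≈ᴹ 0ᴹ → ∀ i → CommutativeRing._≈_ R (c i) 0#

    -- A relation, since the dimension need not be computable.
    HasDimension : ℕ → Set (r ⊔ ℓr ⊔ m ⊔ ℓm)
    HasDimension k = ∃ λ (v : Fin k → Carrierᴹ) → IsBasis v

    IsZero : Set (m ⊔ ℓm)
    IsZero = ∀ x → x ≈ᴹ 0ᴹ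

open Hom using (⟦_⟧) public
open Submodule using (Mem) public

record RingHom (R : CommutativeRing r ℓr) (S : CommutativeRing s ℓs)
               : Set (r ⊔ ℓr ⊔ s ⊔ ℓs) where
  private
    module R = CommutativeRing R
    module S = CommutativeRing S
  open RingMorphisms R.rawRing S.rawRing using (IsRingHomomorphism)
  field
    ⟦_⟧ : R.Carrier → S.Carrier
    isRingHomomorphism : IsRingHomomorphism ⟦_⟧
  open IsRingHomomorphism isRingHomomorphism public

module _ {R : CommutativeRing r ℓr} {S : CommutativeRing s ℓs} (f : RingHom R S) where
  private module f = RingHom f

  restrictScalars : Module S m ℓm → Module R m ℓm
  restrictScalars M = ModuleLaws.module′ laws
    where
    module M = Module M
    laws : ModuleLaws R M._≈ᴹ_ M._+ᴹ_ M.0ᴹ M.-ᴹ_ (λ a x → f.⟦ a ⟧ M.*ₗ x)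
    laws = record
      { isEquivalence = M.≈ᴹ-isEquivalence
      ; +-cong = M.+ᴹ-cong
      ; +-assoc = M.+ᴹ-assoc
      ; +-identityˡ = M.+ᴹ-identityˡ
      ; +-comm = M.+ᴹ-comm
      ; -‿cong = M.-ᴹ‿cong
      ; -‿inverseˡ = M.-ᴹ‿inverseˡ
      ; *-cong = λ e → M.*ₗ-cong (f.⟦⟧-cong e)
      ; *-distribˡ = λ a → M.*ₗ-distribˡ f.⟦ a ⟧
      ; *-distribʳ = λ x a b → M.≈ᴹ-trans (M.*ₗ-cong (f.+-homo a b) M.≈ᴹ-refl)
                                          (M.*ₗ-distribʳ x f.⟦ a ⟧ f.⟦ b ⟧)
      ; *-assoc = λ a b x → M.≈ᴹ-trans (M.*ₗ-cong (f.*-homo a b) M.≈ᴹ-refl)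
                                       (M.*ₗ-assoc f.⟦ a ⟧ f.⟦ b ⟧ x)
      ; *-identityˡ = λ x → M.≈ᴹ-trans (M.*ₗ-cong f.1#-homo M.≈ᴹ-refl) (M.*ₗ-identityˡ x) }

  restrictHom : {M : Module S m ℓm} {N : Module S m′ ℓm′} →
                Hom M N → Hom (restrictScalars M) (restrictScalars N)
  restrictHom {M = M} {N = N} φ =
    mkHom (restrictScalars M) (restrictScalars N) φ.⟦_⟧
      φ.⟦⟧-cong φ.+ᴹ-homo (λ a → φ.*ₗ-homo f.⟦ a ⟧)
    where module φ = Hom φ

Ideal : CommutativeRing r ℓr → (p : Level) → Set (r ⊔ ℓr ⊔ lsuc p)
Ideal R p = Submodule (⟨module⟩ {R = R}) p

module _ (R : CommutativeRing r ℓr) (I : Ideal R p) where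
  private
    module R = CommutativeRing R
    module Q = ModuleLaws (quotientLaws (⟨module⟩ {R = R}) I
                 (λ _ _ e → ≈⇒~ ⟨module⟩ I (R.*-cong e R.refl)))

  abstract
    quotient-isCommutativeRing : IsCommutativeRing (λ x y → Mem I (x R.- y))
                                   R._+_ R._*_ R.-_ R.0# R.1#
    quotient-isCommutativeRing = record
      { isRing = record
        { +-isAbelianGroup = Q.+-isAbelianGroup
        ; *-cong = λ {x} {x′} {y} {y′} e f → IsEquivalence.trans Q.isEquivalence
            (Q.*-cong R.refl f)
            (IsEquivalence.trans Q.isEquivalence (lift (R.*-comm x y′))
            (IsEquivalence.trans Q.isEquivalence (Q.*-cong R.refl e)
                                                 (lift (R.*-comm y′ x′))))
        ; *-assoc = λ x y z → lift (R.*-assoc x y z)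
        ; *-identity = (λ x → lift (R.*-identityˡ x)) , (λ x → lift (R.*-identityʳ x))
        ; distrib = (λ x y z → lift (R.distribˡ x y z)) , (λ x y z → lift (R.distribʳ x y z)) }
      ; *-comm = λ x y → lift (R.*-comm x y) }
      where
      lift : ∀ {x y} → x R.≈ y → Mem I (x R.- y)
      lift = ≈⇒~ ⟨module⟩ I

  quotientRing : CommutativeRing r p
  quotientRing = record { isCommutativeRing = quotient-isCommutativeRing }

  quotientMap : RingHom R quotientRing
  quotientMap = record
    { ⟦_⟧ = id
    ; isRingHomomorphism = record
      { isSemiringHomomorphism = record
        { isNearSemiringHomomorphism = record
          { +-isMonoidHomomorphism = record
            { isMagmaHomomorphism = record
              { isRelHomomorphism = record { cong = ≈⇒~ ⟨module⟩ I }
              ; homo = λ _ _ → A.refl }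
            ; ε-homo = A.refl }
          ; *-homo = λ _ _ → A.refl }
        ; 1#-homo = A.refl }
      ; -‿homo = λ _ → A.refl } }
    where module A = CommutativeRing quotientRing

  quotientScalars : (M : Module R m ℓm) →
    (∀ {a} x → Mem I a → Module._≈ᴹ_ M (Module._*ₗ_ M a x) (Module.0ᴹ M)) →
    Module quotientRing m ℓm
  quotientScalars M annihilates = ModuleLaws.module′ laws
    where
    module M = ModuleProperties M
    laws : ModuleLaws quotientRing M._≈ᴹ_ M._+ᴹ_ M.0ᴹ M.-ᴹ_ M._*ₗ_
    laws = record
      { isEquivalence = M.≈ᴹ-isEquivalence
      ; +-cong = M.+ᴹ-cong
      ; +-assoc = M.+ᴹ-assoc
      ; +-identityˡ = M.+ᴹ-identityˡ
      ; +-comm = M.+ᴹ-comm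
      ; -‿cong = M.-ᴹ‿cong
      ; -‿inverseˡ = M.-ᴹ‿inverseˡ
      ; *-cong = λ {a} {a′} {x} {x′} e f → M.≈ᴹ-trans (M.*ₗ-cong (split a a′) f)
          (M.≈ᴹ-trans (M.*ₗ-distribʳ x′ (a R.- a′) a′)
          (M.≈ᴹ-trans (M.+ᴹ-cong (annihilates x′ e) M.≈ᴹ-refl) (M.+ᴹ-identityˡ _)))
      ; *-distribˡ = M.*ₗ-distribˡ
      ; *-distribʳ = M.*ₗ-distribʳ
      ; *-assoc = M.*ₗ-assoc
      ; *-identityˡ = M.*ₗ-identityˡ }
      where
      split : ∀ a a′ → a R.≈ ((a R.- a′) R.+ a′)
      split a a′ = R.sym (R.trans (R.+-assoc _ _ _)
        (R.trans (R.+-cong R.refl (R.-‿inverseˡ a′)) (R.+-identityʳ a)))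

Exponent : ℕ → Set
Exponent = Vec ℕ

module _ {n : ℕ} where

  infixl 6 _⊕_
  infix 4 _∣ₑ_

  0ₑ : Exponent n
  0ₑ = Vec.replicate n 0

  _⊕_ : Op₂ (Exponent n)
  _⊕_ = Vec.zipWith ℕ._+_

  _≟ₑ_ : (a b : Exponent n) → Dec (a ≡ b)
  _≟ₑ_ = ≡-dec ℕ._≟_

  -- a ∣ₑ b when xᵃ divides xᵇ.
  _∣ₑ_ : Rel (Exponent n) 0ℓ
  _∣ₑ_ = Pointwise _≤_

⊕-comm : ∀ {n} (a b : Exponent n) → a ⊕ b ≡ b ⊕ a
⊕-comm []      []      = ≡.refl
⊕-comm (x ∷ a) (y ∷ b) = ≡.cong₂ _∷_ (ℕ.+-comm x y) (⊕-comm a b)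

⊕-assoc : ∀ {n} (a b c : Exponent n) → (a ⊕ b) ⊕ c ≡ a ⊕ (b ⊕ c)
⊕-assoc []      []      []      = ≡.refl
⊕-assoc (x ∷ a) (y ∷ b) (z ∷ c) = ≡.cong₂ _∷_ (ℕ.+-assoc x y z) (⊕-assoc a b c)

⊕-identityˡ : ∀ {n} (a : Exponent n) → 0ₑ ⊕ a ≡ a
⊕-identityˡ []      = ≡.refl
⊕-identityˡ (x ∷ a) = ≡.cong (x ∷_) (⊕-identityˡ a)

⊕-cancelˡ : ∀ {n} (a : Exponent n) {b c} → a ⊕ b ≡ a ⊕ c → b ≡ c
⊕-cancelˡ [] {[]} {[]} _ = ≡.refl
⊕-cancelˡ (x ∷ a) {y ∷ b} {z ∷ c} e =
  ≡.cong₂ _∷_ (ℕ.+-cancelˡ-≡ x y z (proj₁ (∷-injective e)))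
              (⊕-cancelˡ a (proj₂ (∷-injective e)))

_∣ₑ?_ : ∀ {n} (a b : Exponent n) → Dec (a ∣ₑ b)
_∣ₑ?_ = Pointwise.decidable ℕ._≤?_

∣ₑ⇒⊕ : ∀ {n} {a b : Exponent n} → a ∣ₑ b → ∃ λ c → b ≡ a ⊕ c
∣ₑ⇒⊕ [] = [] , ≡.refl
∣ₑ⇒⊕ (_∷_ {x = x} {y = y} x≤y a∣b) with ∣ₑ⇒⊕ a∣b
... | c , e = (y ℕ.∸ x) ∷ c , ≡.cong₂ _∷_ (≡.sym (ℕ.m+[n∸m]≡n x≤y)) e

∣ₑ-⊕ : ∀ {n} (a c : Exponent n) → a ∣ₑ a ⊕ c
∣ₑ-⊕ []      []      = []
∣ₑ-⊕ (x ∷ a) (y ∷ c) = ℕ.m≤m+n x y ∷ ∣ₑ-⊕ a c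

module Polynomials (K : CommutativeRing r ℓr) (n : ℕ) where
  open CommutativeRing K

  -- A polynomial is a formal sum of terms (coefficient , exponent); the
  -- representation is not unique, and polynomials are compared by coefficients.
  Poly : Set r
  Poly = List (Carrier × Exponent n)

  coeff : Poly → Exponent n → Carrier
  coeff []            e = 0#
  coeff ((c , a) ∷ p) e = (if does (a ≟ₑ e) then c else 0#) + coeff p e

  infix 4 _≈ₚ_
  record _≈ₚ_ (p q : Poly) : Set ℓr where
    constructor mk≈
    field coeff-≈ : ∀ e → coeff p e ≈ coeff q e
  open _≈ₚ_ public

  infixl 6 _+ₚ_
  infixl 7 _*ₚ_

  _+ₚ_ : Op₂ Poly
  _+ₚ_ = _++_

  0ₚ : Poly
  0ₚ = []

  -ₚ_ : Op₁ Poly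
  -ₚ_ = List.map (λ (c , a) → (- c) , a)

  _·ₜ_ : Carrier × Exponent n → Poly → Poly
  (c , a) ·ₜ p = List.map (λ (d , b) → (c * d) , (a ⊕ b)) p

  _*ₚ_ : Op₂ Poly
  []      *ₚ q = []
  (t ∷ p) *ₚ q = (t ·ₜ q) +ₚ (p *ₚ q)

  const : Carrier → Poly
  const c = (c , 0ₑ) ∷ []

  monomial : Exponent n → Poly
  monomial a = (1# , a) ∷ []

  1ₚ : Poly
  1ₚ = const 1#

  private
    open AbelianGroupProperties +-abelianGroup using (ε⁻¹≈ε; ⁻¹-∙-comm)

    ≈ₚ-isEquivalence : IsEquivalence _≈ₚ_
    ≈ₚ-isEquivalence = record
      { refl  = mk≈ λ _ → refl
      ; sym   = λ p≈q → mk≈ λ e → sym (coeff-≈ p≈q e)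
      ; trans = λ p≈q q≈r → mk≈ λ e → trans (coeff-≈ p≈q e) (coeff-≈ q≈r e) }

    module ≈ₚ = IsEquivalence ≈ₚ-isEquivalence

  coeff-+ : ∀ p q e → coeff (p +ₚ q) e ≈ coeff p e + coeff q e
  coeff-+ []      q e = sym (+-identityˡ _)
  coeff-+ (t ∷ p) q e = trans (+-congˡ (coeff-+ p q e)) (sym (+-assoc _ _ _))

  coeff-neg : ∀ p e → coeff (-ₚ p) e ≈ - coeff p e
  coeff-neg []            e = sym ε⁻¹≈ε
  coeff-neg ((c , a) ∷ p) e =
    trans (+-cong (neg-if (does (a ≟ₑ e))) (coeff-neg p e)) (⁻¹-∙-comm _ _)
    where
    neg-if : ∀ b → (if b then - c else 0#) ≈ - (if b then c else 0#)
    neg-if true  = refl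
    neg-if false = sym ε⁻¹≈ε

  coeff-·ₜ : ∀ c a p e → coeff ((c , a) ·ₜ p) (a ⊕ e) ≈ c * coeff p e
  coeff-·ₜ c a []            e = sym (zeroʳ c)
  coeff-·ₜ c a ((d , b) ∷ p) e =
    trans (+-cong head (coeff-·ₜ c a p e)) (sym (distribˡ c _ _))
    where
    head : (if does ((a ⊕ b) ≟ₑ (a ⊕ e)) then c * d else 0#)
           ≈ c * (if does (b ≟ₑ e) then d else 0#)
    head with (a ⊕ b) ≟ₑ (a ⊕ e) | b ≟ₑ e
    ... | yes _  | yes _  = refl
    ... | yes eq | no ¬eq = contradiction (⊕-cancelˡ a eq) ¬eq
    ... | no ¬eq | yes eq = contradiction (≡.cong (a ⊕_) eq) ¬eq
    ... | no _   | no _   = sym (zeroʳ c)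

  coeff-·ₜ-∤ : ∀ c a p {e} → ¬ (a ∣ₑ e) → coeff ((c , a) ·ₜ p) e ≈ 0#
  coeff-·ₜ-∤ c a []            ∤ = refl
  coeff-·ₜ-∤ c a ((d , b) ∷ p) {e} ∤ with (a ⊕ b) ≟ₑ e
  ... | yes ≡.refl = contradiction (∣ₑ-⊕ a b) ∤
  ... | no _       = trans (+-identityˡ _) (coeff-·ₜ-∤ c a p ∤)

  ·ₜ-cong : ∀ {c c′} a {p q} → c ≈ c′ → p ≈ₚ q → ((c , a) ·ₜ p) ≈ₚ ((c′ , a) ·ₜ q)
  ·ₜ-cong {c} {c′} a {p} {q} c≈c′ p≈q = mk≈ go
    where
    go : ∀ e → coeff ((c , a) ·ₜ p) e ≈ coeff ((c′ , a) ·ₜ q) e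
    go e with a ∣ₑ? e
    ... | no ∤ = trans (coeff-·ₜ-∤ c a p ∤) (sym (coeff-·ₜ-∤ c′ a q ∤))
    ... | yes ∣ with ∣ₑ⇒⊕ ∣
    ...   | e′ , ≡.refl = trans (coeff-·ₜ c a p e′)
            (trans (*-cong c≈c′ (coeff-≈ p≈q e′)) (sym (coeff-·ₜ c′ a q e′)))

  +ₚ-cong : ∀ {p p′ q q′} → p ≈ₚ p′ → q ≈ₚ q′ → (p +ₚ q) ≈ₚ (p′ +ₚ q′)
  +ₚ-cong {p} {p′} {q} {q′} p≈ q≈ = mk≈ λ e →
    trans (coeff-+ p q e) (trans (+-cong (coeff-≈ p≈ e) (coeff-≈ q≈ e)) (sym (coeff-+ p′ q′ e)))

  +ₚ-assoc : ∀ p q r → ((p +ₚ q) +ₚ r) ≈ₚ (p +ₚ (q +ₚ r))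
  +ₚ-assoc []      q r = ≈ₚ.refl
  +ₚ-assoc (t ∷ p) q r = mk≈ λ e → +-congˡ (coeff-≈ (+ₚ-assoc p q r) e)

  +ₚ-comm : ∀ p q → (p +ₚ q) ≈ₚ (q +ₚ p)
  +ₚ-comm p q = mk≈ λ e →
    trans (coeff-+ p q e) (trans (+-comm _ _) (sym (coeff-+ q p e)))

  +ₚ-swap : ∀ p q r → (p +ₚ (q +ₚ r)) ≈ₚ (q +ₚ (p +ₚ r))
  +ₚ-swap p q r = ≈ₚ.trans (≈ₚ.sym (+ₚ-assoc p q r))
    (≈ₚ.trans (+ₚ-cong (+ₚ-comm p q) ≈ₚ.refl) (+ₚ-assoc q p r))

  ·ₜ-+ : ∀ t p q → (t ·ₜ (p +ₚ q)) ≈ₚ ((t ·ₜ p) +ₚ (t ·ₜ q))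
  ·ₜ-+ t []      q = ≈ₚ.refl
  ·ₜ-+ t (u ∷ p) q = mk≈ λ e → +-congˡ (coeff-≈ (·ₜ-+ t p q) e)

  term≈ : ∀ {c c′ a a′} {p q} → c ≈ c′ → a ≡ a′ → p ≈ₚ q → ((c , a) ∷ p) ≈ₚ ((c′ , a′) ∷ q)
  term≈ {c} {c′} {a} c≈c′ ≡.refl p≈q = mk≈ λ e →
    +-cong (if-cong (does (a ≟ₑ e))) (coeff-≈ p≈q e)
    where
    if-cong : ∀ b → (if b then c else 0#) ≈ (if b then c′ else 0#)
    if-cong true  = c≈c′
    if-cong false = refl

  ·ₜ-·ₜ : ∀ c a d b p →
          (((c * d) , (a ⊕ b)) ·ₜ p) ≈ₚ ((c , a) ·ₜ ((d , b) ·ₜ p))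
  ·ₜ-·ₜ c a d b []            = ≈ₚ.refl
  ·ₜ-·ₜ c a d b ((e , x) ∷ p) =
    term≈ (*-assoc c d e) (⊕-assoc a b x) (·ₜ-·ₜ c a d b p)

  *ₚ-congˡ : ∀ p {q q′} → q ≈ₚ q′ → (p *ₚ q) ≈ₚ (p *ₚ q′)
  *ₚ-congˡ []            q≈ = ≈ₚ.refl
  *ₚ-congˡ ((c , a) ∷ p) q≈ = +ₚ-cong (·ₜ-cong a refl q≈) (*ₚ-congˡ p q≈)

  *ₚ-zeroʳ : ∀ p → (p *ₚ []) ≈ₚ []
  *ₚ-zeroʳ []      = ≈ₚ.refl
  *ₚ-zeroʳ (t ∷ p) = *ₚ-zeroʳ p

  *ₚ-∷ʳ : ∀ p t q → (p *ₚ (t ∷ q)) ≈ₚ ((t ·ₜ p) +ₚ (p *ₚ q))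
  *ₚ-∷ʳ []            t       q = ≈ₚ.refl
  *ₚ-∷ʳ ((c , a) ∷ p) (d , b) q =
    term≈ (*-comm c d) (⊕-comm a b)
      (≈ₚ.trans (+ₚ-cong ≈ₚ.refl (*ₚ-∷ʳ p (d , b) q))
                (+ₚ-swap ((c , a) ·ₜ q) ((d , b) ·ₜ p) (p *ₚ q)))

  *ₚ-comm : ∀ p q → (p *ₚ q) ≈ₚ (q *ₚ p)
  *ₚ-comm []      q = ≈ₚ.sym (*ₚ-zeroʳ q)
  *ₚ-comm (t ∷ p) q =
    ≈ₚ.trans (+ₚ-cong ≈ₚ.refl (*ₚ-comm p q)) (≈ₚ.sym (*ₚ-∷ʳ q t p))

  *ₚ-cong : ∀ {p p′ q q′} → p ≈ₚ p′ → q ≈ₚ q′ → (p *ₚ q) ≈ₚ (p′ *ₚ q′)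
  *ₚ-cong {p} {p′} {q} {q′} p≈ q≈ = ≈ₚ.trans (*ₚ-congˡ p q≈)
    (≈ₚ.trans (*ₚ-comm p q′) (≈ₚ.trans (*ₚ-congˡ q′ p≈) (*ₚ-comm q′ p′)))

  *ₚ-distribʳ : ∀ r p q → ((p +ₚ q) *ₚ r) ≈ₚ ((p *ₚ r) +ₚ (q *ₚ r))
  *ₚ-distribʳ r []      q = ≈ₚ.refl
  *ₚ-distribʳ r (t ∷ p) q = ≈ₚ.trans (+ₚ-cong ≈ₚ.refl (*ₚ-distribʳ r p q))
                                     (≈ₚ.sym (+ₚ-assoc (t ·ₜ r) (p *ₚ r) (q *ₚ r)))

  ·ₜ-* : ∀ t p q → ((t ·ₜ p) *ₚ q) ≈ₚ (t ·ₜ (p *ₚ q))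
  ·ₜ-* t             []            q = ≈ₚ.refl
  ·ₜ-* t@(c , a) ((d , b) ∷ p) q =
    ≈ₚ.trans (+ₚ-cong (·ₜ-·ₜ c a d b q) (·ₜ-* t p q))
             (≈ₚ.sym (·ₜ-+ t ((d , b) ·ₜ q) (p *ₚ q)))

  *ₚ-assoc : ∀ p q r → ((p *ₚ q) *ₚ r) ≈ₚ (p *ₚ (q *ₚ r))
  *ₚ-assoc []      q r = ≈ₚ.refl
  *ₚ-assoc (t ∷ p) q r = ≈ₚ.trans (*ₚ-distribʳ r (t ·ₜ q) (p *ₚ q))
    (+ₚ-cong (·ₜ-* t q r) (*ₚ-assoc p q r))

  *ₚ-identityˡ : ∀ p → (1ₚ *ₚ p) ≈ₚ p
  *ₚ-identityˡ []            = ≈ₚ.refl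
  *ₚ-identityˡ ((c , a) ∷ p) =
    term≈ (*-identityˡ c) (⊕-identityˡ a) (*ₚ-identityˡ p)

  -ₚ-cong : ∀ {p q} → p ≈ₚ q → (-ₚ p) ≈ₚ (-ₚ q)
  -ₚ-cong {p} {q} p≈q = mk≈ λ e →
    trans (coeff-neg p e) (trans (-‿cong (coeff-≈ p≈q e)) (sym (coeff-neg q e)))

  -ₚ-inverseˡ : ∀ p → ((-ₚ p) +ₚ p) ≈ₚ 0ₚ
  -ₚ-inverseˡ p = mk≈ λ e → trans (coeff-+ (-ₚ p) p e)
    (trans (+-congʳ (coeff-neg p e)) (-‿inverseˡ _))

  private
    ≈ₚ-setoid : Setoid r ℓr
    ≈ₚ-setoid = record { isEquivalence = ≈ₚ-isEquivalence }

    open Consequences ≈ₚ-setoid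
      using (comm∧idˡ⇒id; comm∧invˡ⇒inv; comm∧distrʳ⇒distrˡ)

  abstract
    isCommutativeRing-Poly : IsCommutativeRing _≈ₚ_ _+ₚ_ _*ₚ_ -ₚ_ 0ₚ 1ₚ
    isCommutativeRing-Poly = record
      { isRing = record
        { +-isAbelianGroup = record
          { isGroup = record
            { isMonoid = record
              { isSemigroup = record
                { isMagma = record { isEquivalence = ≈ₚ-isEquivalence ; ∙-cong = +ₚ-cong }
                ; assoc = +ₚ-assoc }
              ; identity = comm∧idˡ⇒id +ₚ-comm (λ _ → ≈ₚ.refl) }
            ; inverse = comm∧invˡ⇒inv +ₚ-comm -ₚ-inverseˡ
            ; ⁻¹-cong = -ₚ-cong }
          ; comm = +ₚ-comm }
        ; *-cong = *ₚ-cong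
        ; *-assoc = *ₚ-assoc
        ; *-identity = comm∧idˡ⇒id *ₚ-comm *ₚ-identityˡ
        ; distrib = comm∧distrʳ⇒distrˡ +ₚ-cong *ₚ-comm *ₚ-distribʳ , *ₚ-distribʳ }
      ; *-comm = *ₚ-comm }

  polynomialRing : CommutativeRing r ℓr
  polynomialRing = record { isCommutativeRing = isCommutativeRing-Poly }

  coeff-const-* : ∀ c p e → coeff (const c *ₚ p) e ≈ c * coeff p e
  coeff-const-* c p e = trans (coeff-+ ((c , 0ₑ) ·ₜ p) [] e) (trans (+-identityʳ _)
    (≡.subst (λ x → coeff ((c , 0ₑ) ·ₜ p) x ≈ c * coeff p e)
             (⊕-identityˡ e) (coeff-·ₜ c 0ₑ p e)))

  private
    merge : ∀ c d → ((c , 0ₑ) ∷ (d , 0ₑ) ∷ []) ≈ₚ const (c + d)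
    merge c d = mk≈ λ e → trans (sym (+-assoc _ _ _)) (+-congʳ (if-+ (does (0ₑ ≟ₑ e))))
      where
      if-+ : ∀ b → (if b then c else 0#) + (if b then d else 0#) ≈ (if b then c + d else 0#)
      if-+ true  = refl
      if-+ false = +-identityˡ 0#

    const-0 : const 0# ≈ₚ 0ₚ
    const-0 = mk≈ λ e → trans (+-identityʳ _) (if-0 (does (0ₑ ≟ₑ e)))
      where
      if-0 : ∀ b → (if b then 0# else 0#) ≈ 0#
      if-0 true  = refl
      if-0 false = refl

  scalars : RingHom K polynomialRing
  scalars = record
    { ⟦_⟧ = const
    ; isRingHomomorphism = record
      { isSemiringHomomorphism = record
        { isNearSemiringHomomorphism = record
          { +-isMonoidHomomorphism = record
            { isMagmaHomomorphism = record
              { isRelHomomorphism = record { cong = λ e → term≈ e ≡.refl ≈ₚ.refl }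
              ; homo = λ c d → ≈ₚ.sym (merge c d) }
            ; ε-homo = const-0 }
          ; *-homo = λ c d → term≈ refl (≡.sym (⊕-identityˡ 0ₑ)) ≈ₚ.refl }
        ; 1#-homo = ≈ₚ.refl }
      ; -‿homo = λ _ → ≈ₚ.refl } }

-- Faces form a decidable family, as any family of subsets of a finite set
-- does classically.
record SimplicialComplex (n : ℕ) : Set₁ where
  field
    Face   : Pred (Subset n) 0ℓ
    face?  : Decidable Face
    closed : ∀ {F G} → G ⊆ F → Face F → Face G

module _ {n : ℕ} (Δ : SimplicialComplex n) where
  open SimplicialComplex Δ

  -- The dimension of a face F is ∣ F ∣ - 1.
  IsZeroDimensional : Set
  IsZeroDimensional = (∀ F → Face F → ∣ F ∣ ≤ 1) × (∃ λ F → Face F × ∣ F ∣ ≡ 1)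

  NoLoops : Set
  NoLoops = ∀ i → Face ⁅ i ⁆

allSubsets : ∀ n → List (Subset n)
allSubsets zero    = [] ∷ []
allSubsets (suc n) = List.map (true ∷_) (allSubsets n) ++ List.map (false ∷_) (allSubsets n)

∈-allSubsets : ∀ {n} (F : Subset n) → F ∈ allSubsets n
∈-allSubsets []          = here ≡.refl
∈-allSubsets (true  ∷ F) = ∈-++⁺ˡ (∈-map⁺ (true ∷_) (∈-allSubsets F))
∈-allSubsets (false ∷ F) =
  ∈-++⁺ʳ (List.map (true ∷_) (allSubsets _)) (∈-map⁺ (false ∷_) (∈-allSubsets F))

-- The exponent of ∏_{i ∈ F} xᵢ.
indicator : ∀ {n} → Subset n → Exponent n
indicator = Vec.map (λ b → if b then 1 else 0)

support : ∀ {n} → Exponent n → Subset n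
support = Vec.map (λ k → does (0 ℕ.<? k))

IsMinimal : ∀ {n} → List (Exponent n) → Pred (Exponent n) 0ℓ
IsMinimal es e = All (λ f → f ∣ₑ e → f ≡ e) es

isMinimal? : ∀ {n} (es : List (Exponent n)) → Decidable (IsMinimal es)
isMinimal? es e = all? (λ f → (f ∣ₑ? e) →-dec (f ≟ₑ e)) es

module _ {n : ℕ} (Δ : SimplicialComplex n) where
  open SimplicialComplex Δ

  nonfaceExponents : List (Exponent n)
  nonfaceExponents = List.map indicator (filter (¬? ∘ face?) (allSubsets n))

  -- Exponents of the minimal monomial generators of the Stanley-Reisner ideal:
  -- of the monomials generating it, those not properly divisible by another one.
  minimalExponents : List (Exponent n)
  minimalExponents = filter (isMinimal? nonfaceExponents) nonfaceExponents

  private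
    ∣ₑ-trans : {a b c : Exponent n} → a ∣ₑ b → b ∣ₑ c → a ∣ₑ c
    ∣ₑ-trans = Pointwise.trans ℕ.≤-trans

    sum-≤ : ∀ {n} {a b : Exponent n} → a ∣ₑ b → Vec.sum a ≤ Vec.sum b
    sum-≤ []        = ℕ.z≤n
    sum-≤ (x≤y ∷ r) = ℕ.+-mono-≤ x≤y (sum-≤ r)

    sum-< : ∀ {n} {a b : Exponent n} → a ∣ₑ b → a ≢ b → Vec.sum a < Vec.sum b
    sum-< [] a≢b = contradiction ≡.refl a≢b
    sum-< (_∷_ {x = x} {y = y} x≤y r) a≢b with x ℕ.≟ y
    ... | yes ≡.refl = ℕ.+-mono-≤-< x≤y (sum-< r (a≢b ∘ ≡.cong (x ∷_)))
    ... | no x≢y     = ℕ.+-mono-<-≤ (ℕ.≤∧≢⇒< x≤y x≢y) (sum-≤ r)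

  minimalDivisor : ∀ {e} → e ∈ nonfaceExponents →
                   ∃ λ (i : Fin (length minimalExponents)) → lookup minimalExponents i ∣ₑ e
  minimalDivisor {e} e∈ = go e e∈ (ℕ.<-wellFounded (Vec.sum e))
    where
    go : ∀ e → e ∈ nonfaceExponents → Acc _<_ (Vec.sum e) →
         ∃ λ (i : Fin (length minimalExponents)) → lookup minimalExponents i ∣ₑ e
    go e e∈ (acc rec) with isMinimal? nonfaceExponents e
    ... | yes min = Any.index e∈′ ,
          ≡.subst (_∣ₑ e) (lookup-index e∈′) (Pointwise.refl ℕ.≤-refl)
      where e∈′ = ∈-filter⁺ (isMinimal? nonfaceExponents) e∈ min
    ... | no ¬min with find (¬All⇒Any¬ (λ f → (f ∣ₑ? e) →-dec (f ≟ₑ e)) _ ¬min)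
    ...   | f , f∈ , ¬imp with f ∣ₑ? e
    ...     | no f∤e = contradiction (λ f∣e → contradiction f∣e f∤e) ¬imp
    ...     | yes f∣e with go f f∈ (rec (sum-< f∣e (λ f≡e → ¬imp (λ _ → f≡e))))
    ...       | i , i∣f = i , ∣ₑ-trans i∣f f∣e

module _ {S : CommutativeRing r ℓr} where

  -- The S-linear map S^k → S sending the canonical basis to the generators g.
  presentation : ∀ {k} → (Fin k → CommutativeRing.Carrier S) → Hom (free k) (⟨module⟩ {R = S})
  presentation = linearMap ⟨module⟩

  record Generates {k} (g : Fin k → CommutativeRing.Carrier S) (I : Ideal S p)
                   : Set (r ⊔ ℓr ⊔ p) where
    field
      gens∈ideal  : ∀ i → Mem I (g i)
      ideal⊆image : ∀ {a} → Mem I a → Mem (image (presentation g)) a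

module Cotangent (S : CommutativeRing r ℓr) (ideal : Ideal S (r ⊔ ℓr)) {numGens : ℕ}
                 (g : Fin numGens → CommutativeRing.Carrier S)
                 (generates : Generates g ideal) where
  open Generates generates
  private module S = CommutativeRing S

  S/I : CommutativeRing r (r ⊔ ℓr)
  S/I = quotientRing S ideal

  S/I-asSModule : Module S r (r ⊔ ℓr)
  S/I-asSModule = quotient ⟨module⟩ ideal

  Sᵐ : Module S r ℓr
  Sᵐ = free numGens

  d : Hom Sᵐ ⟨module⟩
  d = presentation g

  private
    module d = Hom d
    module Sᵐ = ModuleProperties Sᵐ

  Syz : Module S (r ⊔ ℓr) ℓr
  Syz = subModule Sᵐ (kernel d)

  koszulRelation : Sᵐ.Carrierᴹ → Sᵐ.Carrierᴹ → Module.Carrierᴹ Syz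
  koszulRelation f g = κ , isSyzygy
    where
    κ : Sᵐ.Carrierᴹ
    κ = (d.⟦ f ⟧ Sᵐ.*ₗ g) Sᵐ.+ᴹ (Sᵐ.-ᴹ (d.⟦ g ⟧ Sᵐ.*ₗ f))

    isSyzygy : d.⟦ κ ⟧ S.≈ S.0#
    isSyzygy = S.trans (d.+ᴹ-homo (d.⟦ f ⟧ Sᵐ.*ₗ g) (Sᵐ.-ᴹ (d.⟦ g ⟧ Sᵐ.*ₗ f)))
      (S.trans (S.+-cong (d.*ₗ-homo d.⟦ f ⟧ g)
        (S.trans (d.-ᴹ-homo (d.⟦ g ⟧ Sᵐ.*ₗ f))
          (S.-‿cong (S.trans (d.*ₗ-homo d.⟦ g ⟧ f) (S.*-comm d.⟦ g ⟧ d.⟦ f ⟧)))))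
      (S.-‿inverseʳ (d.⟦ f ⟧ S.* d.⟦ g ⟧)))

  Kosz : Submodule Syz (r ⊔ ℓr)
  Kosz = span Syz (λ s → ∃₂ λ f g → Module._≈ᴹ_ Syz s (koszulRelation f g))

  Syz/Kosz-asSModule : Module S (r ⊔ ℓr) (r ⊔ ℓr)
  Syz/Kosz-asSModule = quotient Syz Kosz

  private
    module Syz = ModuleProperties Syz
    module Q = ModuleProperties Syz/Kosz-asSModule
    module SI = CommutativeRing S/I

  d∈ideal : ∀ f → Mem ideal d.⟦ f ⟧
  d∈ideal f = sum∈ (λ i → f i S.* g i)
                (λ i → Submodule.*-mem ideal (f i) (gens∈ideal i))
    where
    sum∈ : ∀ {k} (v : Fin k → S.Carrier) → (∀ i → Mem ideal (v i)) →
           Mem ideal (ModuleProperties.sum (⟨module⟩ {R = S}) v)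
    sum∈ {zero}  v v∈ = Submodule.0-mem ideal
    sum∈ {suc k} v v∈ = Submodule.+-mem ideal (v∈ zero) (sum∈ (v ∘ suc) (v∈ ∘ suc))

  ideal-annihilates : ∀ {a} x → Mem ideal a → (a Q.*ₗ x) Q.≈ᴹ Q.0ᴹ
  ideal-annihilates {a} x a∈ with ideal⊆image a∈
  ... | f , df≈a = Submodule.resp Kosz {a Syz.*ₗ x} {(a Syz.*ₗ x) Syz.+ᴹ (Syz.-ᴹ Syz.0ᴹ)}
        (Syz.≈ᴹ-sym {(a Syz.*ₗ x) Syz.+ᴹ (Syz.-ᴹ Syz.0ᴹ)} {a Syz.*ₗ x}
          (Syz.diff-0 (a Syz.*ₗ x)))
        (gen (f , proj₁ x , Sᵐ.≈ᴹ-trans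
          (Sᵐ.*ₗ-cong {x = a} {y = d.⟦ f ⟧} (S.sym df≈a) (Sᵐ.≈ᴹ-refl {proj₁ x}))
          (Sᵐ.≈ᴹ-sym (Sᵐ.≈ᴹ-trans
            (Sᵐ.+ᴹ-cong (Sᵐ.≈ᴹ-refl {d.⟦ f ⟧ Sᵐ.*ₗ proj₁ x})
              (Sᵐ.-ᴹ‿cong (Sᵐ.≈ᴹ-trans (Sᵐ.*ₗ-cong (proj₂ x) (Sᵐ.≈ᴹ-refl {f})) (Sᵐ.*ₗ-zeroˡ f))))
            (Sᵐ.diff-0 (d.⟦ f ⟧ Sᵐ.*ₗ proj₁ x))))))

  -- Scalars in S/I are represented by elements of S, compared modulo the ideal.
  Syz/Kosz : Module S/I (r ⊔ ℓr) (r ⊔ ℓr)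
  Syz/Kosz = quotientScalars S ideal Syz/Kosz-asSModule ideal-annihilates

  Hom-Sᵐ : Module S (r ⊔ ℓr) (r ⊔ ℓr)
  Hom-Sᵐ = homModule Sᵐ S/I-asSModule

  Hom-Syz/Kosz : Module S (r ⊔ ℓr) (r ⊔ ℓr)
  Hom-Syz/Kosz = restrictScalars (quotientMap S ideal) (homModule Syz/Kosz ⟨module⟩)

  restriction : Hom Hom-Sᵐ Hom-Syz/Kosz
  restriction = mkHom Hom-Sᵐ Hom-Syz/Kosz restrict
    (λ e x → e (proj₁ x))
    (λ φ ψ x → SI.refl {⟦ φ ⟧ (proj₁ x) S.+ ⟦ ψ ⟧ (proj₁ x)})
    (λ a φ x → SI.refl {a S.* ⟦ φ ⟧ (proj₁ x)})
    where
    restrict : Hom Sᵐ S/I-asSModule → Hom Syz/Kosz ⟨module⟩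
    restrict χ = mkHom Syz/Kosz ⟨module⟩ (λ s → χ.⟦ proj₁ s ⟧) respects
      (λ x y → χ.+ᴹ-homo (proj₁ x) (proj₁ y))
      (λ a x → χ.*ₗ-homo a (proj₁ x))
      where
      module χ = Hom χ
      module N = ModuleProperties S/I-asSModule

      χ∘incl : Hom Syz S/I-asSModule
      χ∘incl = mkHom Syz S/I-asSModule (λ s → χ.⟦ proj₁ s ⟧) χ.⟦⟧-cong
        (λ x y → χ.+ᴹ-homo (proj₁ x) (proj₁ y)) (λ a x → χ.*ₗ-homo a (proj₁ x))

      ideal-* : ∀ {a} x → Mem ideal a → (a N.*ₗ x) N.≈ᴹ N.0ᴹ
      ideal-* {a} x a∈ = Submodule.resp ideal
        (S.trans (S.*-comm x a) (S.sym (ModuleProperties.diff-0 (⟨module⟩ {R = S}) (a S.* x))))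
        (Submodule.*-mem ideal x a∈)

      killsKosz : ∀ {s} → Mem Kosz s → χ.⟦ proj₁ s ⟧ N.≈ᴹ N.0ᴹ
      killsKosz = span-least Syz _ (kernel χ∘incl) λ { {s} (f , g , s≈) →
        N.≈ᴹ-trans (χ.⟦⟧-cong {proj₁ s} {proj₁ (koszulRelation f g)} s≈)
        (N.≈ᴹ-trans (χ.+ᴹ-homo (d.⟦ f ⟧ Sᵐ.*ₗ g) (Sᵐ.-ᴹ (d.⟦ g ⟧ Sᵐ.*ₗ f)))
        (N.≈ᴹ-trans (N.+ᴹ-cong
          (N.≈ᴹ-trans (χ.*ₗ-homo d.⟦ f ⟧ g) (ideal-* χ.⟦ g ⟧ (d∈ideal f)))
          (N.≈ᴹ-trans (χ.-ᴹ-homo (d.⟦ g ⟧ Sᵐ.*ₗ f)) (N.-ᴹ‿cong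
            (N.≈ᴹ-trans (χ.*ₗ-homo d.⟦ g ⟧ f) (ideal-* χ.⟦ f ⟧ (d∈ideal g))))))
        (N.-ᴹ‿inverseʳ N.0ᴹ))) }

      respects : ∀ {s t} → Mem Kosz (s Syz.+ᴹ (Syz.-ᴹ t)) →
                 χ.⟦ proj₁ s ⟧ N.≈ᴹ χ.⟦ proj₁ t ⟧
      respects {s} {t} s-t∈ = N.x∙y⁻¹≈ε⇒x≈y χ.⟦ proj₁ s ⟧ χ.⟦ proj₁ t ⟧
        (N.≈ᴹ-trans (N.+ᴹ-cong (N.≈ᴹ-refl {χ.⟦ proj₁ s ⟧}) (N.≈ᴹ-sym (χ.-ᴹ-homo (proj₁ t))))
        (N.≈ᴹ-trans (N.≈ᴹ-sym (χ.+ᴹ-homo (proj₁ s) (Sᵐ.-ᴹ proj₁ t)))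
                    (killsKosz s-t∈)))

  T² : Module S (r ⊔ ℓr) (r ⊔ ℓr)
  T² = cokernel restriction

Degree : ℕ → Set
Degree = Vec ℤ

infixl 6 _+ᵈ_ _-ᵈ_
_+ᵈ_ _-ᵈ_ : ∀ {n} → Op₂ (Degree n)
_+ᵈ_ = Vec.zipWith ℤ._+_
_-ᵈ_ = Vec.zipWith ℤ._-_

exponentDegree : ∀ {n} → Exponent n → Degree n
exponentDegree = Vec.map +_

-- A ℤⁿ-grading assigns to each degree a K-subspace.
Grading : {K : CommutativeRing r ℓr} {S : CommutativeRing s ℓs} → RingHom K S →
          ℕ → Module S m ℓm → (p : Level) → Set (r ⊔ m ⊔ ℓm ⊔ lsuc p)
Grading scalars n M p = Degree n → Submodule (restrictScalars scalars M) p

module GradedCotangent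
  {K : CommutativeRing r ℓr} {S : CommutativeRing s ℓs} (scalars : RingHom K S) {n : ℕ}
  (gradingS : Grading scalars n (⟨module⟩ {R = S}) p)
  (ideal : Ideal S (s ⊔ ℓs)) {numGens : ℕ}
  (g : Fin numGens → CommutativeRing.Carrier S) (generates : Generates g ideal)
  (genDegree : Fin numGens → Degree n) where

  open Cotangent S ideal g generates public

  imageGrading : (M : Module S m ℓm) (N : Module S m′ ℓm′) → Hom M N →
                 Grading scalars n M p′ → Grading scalars n N (m ⊔ p′ ⊔ ℓm′)
  imageGrading M N f γ u =
    map {M = restrictScalars scalars M} {N = restrictScalars scalars N}
        (restrictHom scalars {M = M} {N = N} f) (γ u)

  preimageGrading : (M : Module S m ℓm) (N : Module S m′ ℓm′) → Hom M N →
                    Grading scalars n N p′ → Grading scalars n M p′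
  preimageGrading M N f γ u =
    comap {M = restrictScalars scalars M} {N = restrictScalars scalars N}
          (restrictHom scalars {M = M} {N = N} f) (γ u)

  gradingS/I : Grading scalars n S/I-asSModule _
  gradingS/I = imageGrading ⟨module⟩ S/I-asSModule (projection ⟨module⟩ ideal) gradingS

  -- The basis element of Sᵐ over a generator g has degree deg g.
  gradingSᵐ : Grading scalars n Sᵐ p
  gradingSᵐ u = record
    { Mem = λ f → ∀ i → Mem (component i) (f i)
    ; resp = λ {f} {g} f≈g h i → Submodule.resp (component i) {f i} {g i} (f≈g i) (h i)
    ; 0-mem = λ i → Submodule.0-mem (component i)
    ; +-mem = λ {f} {g} h h′ i → Submodule.+-mem (component i) {f i} {g i} (h i) (h′ i)
    ; *-mem = λ c {f} h i → Submodule.*-mem (component i) c {f i} (h i) }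
    where
    component : Fin numGens → Submodule (restrictScalars scalars ⟨module⟩) p
    component i = gradingS (u -ᵈ genDegree i)

  gradingSyz/Kosz : Grading scalars n Syz/Kosz-asSModule _
  gradingSyz/Kosz = imageGrading Syz Syz/Kosz-asSModule (projection Syz Kosz)
    (preimageGrading Syz Sᵐ (inclusion Sᵐ (kernel d)) gradingSᵐ)

  -- Homomorphisms that shift degrees by c.
  gradingHom : Grading scalars n Hom-Syz/Kosz _
  gradingHom c = record
    { Mem = λ φ → ∀ u {s} → Mem (gradingSyz/Kosz u) s → Mem (gradingS/I (u +ᵈ c)) (⟦ φ ⟧ s)
    ; resp = λ φ≈ψ h u {s} s∈ → Submodule.resp (gradingS/I (u +ᵈ c)) (φ≈ψ s) (h u s∈)
    ; 0-mem = λ u _ → Submodule.0-mem (gradingS/I (u +ᵈ c))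
    ; +-mem = λ h h′ u s∈ → Submodule.+-mem (gradingS/I (u +ᵈ c)) (h u s∈) (h′ u s∈)
    ; *-mem = λ a h u s∈ → Submodule.*-mem (gradingS/I (u +ᵈ c)) a (h u s∈) }

  gradingT² : Grading scalars n T² _
  gradingT² = imageGrading Hom-Syz/Kosz T² (projection Hom-Syz/Kosz (image restriction)) gradingHom

  -- The K-subspace of classes of homomorphisms of degree c.
  T²-component : Degree n → Module K _ _
  T²-component c = subModule (restrictScalars scalars T²) (gradingT² c)

module StanleyReisner (K : CommutativeRing r ℓr) {n : ℕ} (Δ : SimplicialComplex n) where
  open SimplicialComplex Δ using (Face; face?)
  open Polynomials K n using (coeff; monomial; scalars; polynomialRing)
  private
    module P = Polynomials K n
    module S = CommutativeRing polynomialRing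

  gradingS : Grading scalars n ⟨module⟩ ℓr
  gradingS u = record
    { Mem = λ p → ∀ e → exponentDegree e ≢ u → coeff p e K.≈ K.0#
    ; resp = λ p≈q h e e≢ → K.trans (K.sym (P.coeff-≈ p≈q e)) (h e e≢)
    ; 0-mem = λ _ _ → K.refl
    ; +-mem = λ {p} {q} h h′ e e≢ → K.trans (P.coeff-+ p q e)
        (K.trans (K.+-cong (h e e≢) (h′ e e≢)) (K.+-identityˡ K.0#))
    ; *-mem = λ c {p} h e e≢ → K.trans (P.coeff-const-* c p e)
        (K.trans (K.*-congˡ (h e e≢)) (K.zeroʳ c)) }
    where module K = CommutativeRing K

  ideal : Ideal polynomialRing (r ⊔ ℓr)
  ideal = span ⟨module⟩ (λ p → ∃ λ F → (¬ Face F) × (p S.≈ monomial (indicator F)))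

  numGens : ℕ
  numGens = length (minimalExponents Δ)

  genExponent : Fin numGens → Exponent n
  genExponent = lookup (minimalExponents Δ)

  generator : Fin numGens → S.Carrier
  generator = monomial ∘ genExponent

  minimalGenerators : Generates {S = polynomialRing} generator ideal
  minimalGenerators = record
    { gens∈ideal = gen∈ideal
    ; ideal⊆image = span-least (⟨module⟩ {R = polynomialRing}) _ (image d) onGenerators }
    where
    d : Hom (free numGens) (⟨module⟩ {R = polynomialRing})
    d = presentation generator

    module d = Hom d
    module Sᵐ = Module (free {R = polynomialRing} numGens)

    gen∈ideal : ∀ i → Mem ideal (monomial (genExponent i))
    gen∈ideal i with ∈-map⁻ indicator (proj₁ (∈-filter⁻ (isMinimal? (nonfaceExponents Δ))
                       {xs = nonfaceExponents Δ} (∈-lookup {xs = minimalExponents Δ} i)))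
    ... | F , F∈ , eq = gen (F , proj₂ (∈-filter⁻ (¬? ∘ face?) {xs = allSubsets n} F∈) ,
                             S.reflexive (≡.cong monomial eq))

    onGenerators : ∀ {p} → (∃ λ F → (¬ Face F) × (p S.≈ monomial (indicator F))) →
                   Mem (image d) p
    onGenerators {p} (F , F∉ , p≈)
      with minimalDivisor Δ (∈-map⁺ indicator
             (∈-filter⁺ (¬? ∘ face?) (∈-allSubsets F) F∉))
    ... | i , i∣F with ∣ₑ⇒⊕ i∣F
    ...   | c , eq = (monomial c Sᵐ.*ₗ unitVector {R = polynomialRing} i) ,
            S.trans (d.*ₗ-homo (monomial c) (unitVector {R = polynomialRing} i))
            (S.trans (S.*-congˡ {monomial c}
              (linearMap-unitVector (⟨module⟩ {R = polynomialRing}) generator i))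
            (S.trans product (S.trans (S.reflexive (≡.cong monomial eq′)) (S.sym p≈))))
      where
      eq′ : c ⊕ genExponent i ≡ indicator F
      eq′ = ≡.trans (⊕-comm c (genExponent i)) (≡.sym eq)
      product : (monomial c S.* monomial (genExponent i)) S.≈ monomial (c ⊕ genExponent i)
      product = record { coeff-≈ = λ e →
        K.+-congʳ (if-cong (does ((c ⊕ genExponent i) ≟ₑ e))) }
        where
        module K = CommutativeRing K
        if-cong : ∀ b → (if b then K.1# K.* K.1# else K.0#) K.≈ (if b then K.1# else K.0#)
        if-cong true  = K.*-identityˡ K.1#
        if-cong false = K.refl

  open GradedCotangent scalars gradingS ideal generator minimalGenerators
    (exponentDegree ∘ genExponent) public

-- With x # y taken to be ¬ (x ≈ y), a Heyting field is classically just a field;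
-- it is nontrivial because its apartness is irreflexive.
module _ (K : HeytingField r ℓr s) where

  fieldRing : CommutativeRing r ℓr
  fieldRing = HeytingCommutativeRing.commutativeRing (HeytingField.heytingCommutativeRing K)

  module _ {n : ℕ} (Δ : SimplicialComplex n) where
    open Polynomials fieldRing n using (polynomialRing)

    T² : Module polynomialRing _ _
    T² = StanleyReisner.T² fieldRing Δ

    T²-component : Degree n → Module fieldRing _ _
    T²-component = StanleyReisner.T²-component fieldRing Δ

{-# OPTIONS --safe #-}
module Submission where

open import Defs
open import Algebra.Apartness.Bundles using (HeytingField)
open import Algebra.Bundles using (CommutativeRing)
open import Algebra.Module.Bundles using (Module)
open import Algebra.Module.Construct.TensorUnit using (⟨module⟩)
open import Data.Bool.Base using (true; false; if_then_else_)
open import Data.Fin.Base using (Fin; zero; suc; punchIn; punchOut)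
import Data.Fin.Properties as Fin
open import Data.Fin.Subset as Subset using (Subset; ⁅_⁆; ∣_∣; _∩_; _∪_; Empty)
import Data.Fin.Subset.Properties as Subset
open import Data.Integer.Base as ℤ using (+_)
import Data.Integer.Properties as ℤ
open import Data.Integer.Tactic.RingSolver using (solve-∀)
open import Data.List.Base as List using (List; []; _∷_; _++_)
open import Data.List.Membership.Propositional using (_∈_)
open import Data.List.Membership.Propositional.Properties
  using (∈-filter⁺; ∈-filter⁻; ∈-map⁺; ∈-map⁻; ∈-lookup)
import Data.List.Relation.Unary.All as ListAll
open import Data.List.Relation.Unary.AllPairs using ([]; _∷_)
import Data.List.Relation.Unary.Any as Any
open import Data.List.Relation.Unary.Any.Properties using (lookup-index)
open import Data.List.Relation.Unary.Unique.Propositional using (Unique)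
import Data.List.Relation.Unary.Unique.Propositional.Properties as Unique
open import Data.Maybe.Base using (Maybe; just; nothing)
open import Data.Maybe.Properties using (just-injective)
open import Data.Nat.Base as ℕ using (ℕ; zero; suc; _≤_; _<_; _∸_; z≤n; s≤s)
import Data.Nat.Properties as ℕ
open import Data.Product.Base using (Σ; ∃; ∃₂; _×_; _,_; proj₁; proj₂)
open import Data.Sum.Base using (_⊎_; inj₁; inj₂)
open import Data.Vec.Base as Vec using ([]; _∷_; _[_]≔_; lookup)
import Data.Vec.Properties as Vec
open import Data.Vec.Relation.Binary.Pointwise.Inductive as Pointwise using ([]; _∷_)
open import Data.Vec.Relation.Unary.All using (All; []; _∷_)
open import Function.Base using (_∘_)
open import Function.Bundles using (_⇔_; mk⇔)
open import Level using (_⊔_)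
open import Relation.Binary.PropositionalEquality as ≡ using (_≡_; _≢_)
open import Relation.Nullary.Decidable using (Dec; yes; no; does; dec-true; ¬?; _×-dec_)
open import Relation.Nullary.Negation using (¬_; contradiction)

-- Write e_pq for the basis vector of Sᵐ over the generator x_p x_q.  Modulo Koszul
-- relations, the syzygies are generated by x_r e_pq - x_q e_pr.  A homomorphism φ from
-- Syz/Kosz to S/I is therefore determined by its values there, which are sums of powers
-- of x_q and of x_r without constant term, and whose x_r-part depends only on r and on
-- {p, q}.  Dividing the x_r-parts by x_r, for all r outside {p, q}, gives the image of
-- e_pq under an extension of φ to Sᵐ, except that the constant terms obtained from
-- different r have to agree.  Hence T² is the direct sum over the pairs {p, q} of
-- K^(n-2) / K(1, …, 1), with the summand of {p, q} in degree - e_p - e_q.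

-- In S/I, where a product of two different variables vanishes, the axes K[x_i] meet only in the
-- constants. This drives both bounds. Every condition on an extension can be met one axis at a
-- time, except on the monomial 1, which all axes share. Conversely, the part of S/I without
-- constant terms is the direct sum of its axes as an S-module. Since no syzygy has a constant term
-- at e_jk, its coefficient there can be projected S-linearly to a single axis x_i. This gives one
-- functional for each i outside {j, k}, and these functionals realise all the coordinates of
-- K^(n-2). Restrictions from Sᵐ add the same constant to each of those coordinates. Subtracting the
-- coordinate at one reference vertex therefore leaves n-3 invariants, dual to the functionals of
-- the other vertices.
--
-- Coefficients come without a zero test, and polynomials are unnormalised lists of terms. Arguments
-- by leading terms are replaced by operations on exponents alone: partial reindexing of terms, and
-- a section of d that assigns each monomial of I to one generator.

private variable n : ℕ

-- Exponents of pure powers and of products of two variables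

pure : Fin n → ℕ → Exponent n
pure i t = 0ₑ [ i ]≔ t

pair : Fin n → Fin n → Exponent n
pair p q = pure p 1 ⊕ pure q 1

lookup-pure : (i : Fin n) (t : ℕ) → lookup (pure i t) i ≡ t
lookup-pure i t = Vec.lookup∘update i 0ₑ t

lookup-pure-≢ : {i j : Fin n} → j ≢ i → ∀ t → lookup (pure i t) j ≡ 0
lookup-pure-≢ {i = i} {j} j≢i t =
  ≡.trans (Vec.lookup∘update′ j≢i 0ₑ t) (Vec.lookup-replicate j 0)

pure-injective : {i : Fin n} {s t : ℕ} → pure i s ≡ pure i t → s ≡ t
pure-injective {i = i} {s} {t} eq = ≡.trans (≡.sym (lookup-pure i s))
  (≡.trans (≡.cong (λ v → lookup v i) eq) (lookup-pure i t))

pure-0 : (i : Fin n) → pure i 0 ≡ 0ₑ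
pure-0 zero    = ≡.refl
pure-0 (suc i) = ≡.cong (0 ∷_) (pure-0 i)

pure-⊕ : (i : Fin n) (s t : ℕ) → pure i s ⊕ pure i t ≡ pure i (s ℕ.+ t)
pure-⊕ zero    s t = ≡.cong (s ℕ.+ t ∷_) (⊕-identityˡ _)
pure-⊕ (suc i) s t = ≡.cong (0 ∷_) (pure-⊕ i s t)

lookup-⊕ : (a b : Exponent n) (i : Fin n) → lookup (a ⊕ b) i ≡ lookup a i ℕ.+ lookup b i
lookup-⊕ a b i = Vec.lookup-zipWith ℕ._+_ i a b

lookup-ext : {a b : Exponent n} → (∀ i → lookup a i ≡ lookup b i) → a ≡ b
lookup-ext {a = []}    {[]}    eq = ≡.refl
lookup-ext {a = _ ∷ _} {_ ∷ _} eq = ≡.cong₂ _∷_ (eq zero) (lookup-ext (eq ∘ suc))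

∣ₑ-lookup : {a b : Exponent n} → a ∣ₑ b → ∀ i → lookup a i ≤ lookup b i
∣ₑ-lookup = Pointwise.lookup

lookup-∣ₑ : {a b : Exponent n} → (∀ i → lookup a i ≤ lookup b i) → a ∣ₑ b
lookup-∣ₑ {a = []}    {[]}    le = []
lookup-∣ₑ {a = _ ∷ _} {_ ∷ _} le = le zero ∷ lookup-∣ₑ (le ∘ suc)

∣ₑ-antisym : {a b : Exponent n} → a ∣ₑ b → b ∣ₑ a → a ≡ b
∣ₑ-antisym a∣b b∣a = lookup-ext λ i → ℕ.≤-antisym (∣ₑ-lookup a∣b i) (∣ₑ-lookup b∣a i)

zero-off⇒pure : {e : Exponent n} (i : Fin n) → (∀ j → j ≢ i → lookup e j ≡ 0) →
                e ≡ pure i (lookup e i)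
zero-off⇒pure {e = e} i off = lookup-ext go
  where
  go : ∀ j → lookup e j ≡ lookup (pure i (lookup e i)) j
  go j with j Fin.≟ i
  ... | yes ≡.refl = ≡.sym (lookup-pure i _)
  ... | no j≢i     = ≡.trans (off j j≢i) (≡.sym (lookup-pure-≢ j≢i _))

∣ₑ-pure : {a : Exponent n} {i : Fin n} {t : ℕ} → a ∣ₑ pure i t → a ≡ pure i (lookup a i)
∣ₑ-pure {i = i} {t} a∣ = zero-off⇒pure i λ j j≢i →
  ℕ.n≤0⇒n≡0 (≡.subst (_ ≤_) (lookup-pure-≢ j≢i t) (∣ₑ-lookup a∣ j))

pure-suc-≢ : {i j : Fin n} {s t : ℕ} → i ≢ j → pure i (suc s) ≢ pure j t
pure-suc-≢ {i = i} {s = s} {t} i≢j eq = ℕ.1+n≢0 (≡.trans (≡.sym (lookup-pure i (suc s)))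
  (≡.trans (≡.cong (λ v → lookup v i) eq) (lookup-pure-≢ i≢j t)))

pure-suc-∤ : {i j : Fin n} {s t : ℕ} → i ≢ j → ¬ (pure i (suc s) ∣ₑ pure j t)
pure-suc-∤ {i = i} {j} {s} {t} i≢j div = ℕ.n≮0 (≡.subst₂ _≤_ (lookup-pure i (suc s))
  (lookup-pure-≢ i≢j t) (∣ₑ-lookup div i))

lookup-pairˡ : (p q : Fin n) → 0 < lookup (pair p q) p
lookup-pairˡ p q rewrite lookup-⊕ (pure p 1) (pure q 1) p | lookup-pure p 1 = s≤s z≤n

pair-comm : (p q : Fin n) → pair p q ≡ pair q p
pair-comm p q = ⊕-comm (pure p 1) (pure q 1)

lookup-pairʳ : (p q : Fin n) → 0 < lookup (pair p q) q
lookup-pairʳ p q = ≡.subst (λ v → 0 < lookup v q) (pair-comm q p) (lookup-pairˡ q p)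

lookup-pair-pos : {p q i : Fin n} → 0 < lookup (pair p q) i → i ≡ p ⊎ i ≡ q
lookup-pair-pos {p = p} {q} {i} pos with i Fin.≟ p | i Fin.≟ q
... | yes eq | _      = inj₁ eq
... | no _   | yes eq = inj₂ eq
... | no i≢p | no i≢q = contradiction (≡.subst (0 <_) zero-at pos) ℕ.n≮0
  where
  zero-at : lookup (pair p q) i ≡ 0
  zero-at = ≡.trans (lookup-⊕ (pure p 1) (pure q 1) i)
    (≡.cong₂ ℕ._+_ (lookup-pure-≢ i≢p 1) (lookup-pure-≢ i≢q 1))

pair-∣ₑ : {p q : Fin n} {e : Exponent n} → p ≢ q → 0 < lookup e p → 0 < lookup e q →
          pair p q ∣ₑ e
pair-∣ₑ {p = p} {q} {e} p≢q 0<p 0<q = lookup-∣ₑ go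
  where
  go : ∀ i → lookup (pair p q) i ≤ lookup e i
  go i rewrite lookup-⊕ (pure p 1) (pure q 1) i with i Fin.≟ p | i Fin.≟ q
  ... | yes ≡.refl | yes ≡.refl = contradiction ≡.refl p≢q
  ... | yes ≡.refl | no i≢q rewrite lookup-pure i 1 | lookup-pure-≢ i≢q 1 = 0<p
  ... | no i≢p | yes ≡.refl rewrite lookup-pure i 1 | lookup-pure-≢ i≢p 1 = 0<q
  ... | no i≢p | no i≢q rewrite lookup-pure-≢ i≢p 1 | lookup-pure-≢ i≢q 1 = z≤n

pair-∣ₑ-lookupˡ : {p q : Fin n} {e : Exponent n} → pair p q ∣ₑ e → 0 < lookup e p
pair-∣ₑ-lookupˡ {p = p} {q} div = ℕ.≤-trans (lookup-pairˡ p q) (∣ₑ-lookup div p)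

pair-∣ₑ-lookupʳ : {p q : Fin n} {e : Exponent n} → pair p q ∣ₑ e → 0 < lookup e q
pair-∣ₑ-lookupʳ {p = p} {q} div = ℕ.≤-trans (lookup-pairʳ p q) (∣ₑ-lookup div q)

pair-∤-pure : {p q : Fin n} → p ≢ q → ∀ i t → ¬ (pair p q ∣ₑ pure i t)
pair-∤-pure {p = p} {q} p≢q i t div with p Fin.≟ i
... | no p≢i = contradiction
  (≡.subst (0 <_) (lookup-pure-≢ p≢i t) (pair-∣ₑ-lookupˡ {q = q} div)) ℕ.n≮0
... | yes ≡.refl = contradiction
  (≡.subst (0 <_) (lookup-pure-≢ (p≢q ∘ ≡.sym) t) (pair-∣ₑ-lookupʳ {p = p} div)) ℕ.n≮0

pair-∣ₑ-pair : {p q r s : Fin n} → p ≢ q → pair p q ∣ₑ pair r s →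
               (p ≡ r × q ≡ s) ⊎ (p ≡ s × q ≡ r)
pair-∣ₑ-pair {p = p} {q} p≢q div
  with lookup-pair-pos (pair-∣ₑ-lookupˡ {q = q} div) | lookup-pair-pos (pair-∣ₑ-lookupʳ {p = p} div)
... | inj₁ p≡r | inj₂ q≡s = inj₁ (p≡r , q≡s)
... | inj₂ p≡s | inj₁ q≡r = inj₂ (p≡s , q≡r)
... | inj₁ ≡.refl | inj₁ ≡.refl = contradiction ≡.refl p≢q
... | inj₂ ≡.refl | inj₂ ≡.refl = contradiction ≡.refl p≢q

∣ₑ-refl : {e : Exponent n} → e ∣ₑ e
∣ₑ-refl = Pointwise.refl ℕ.≤-refl

-- The monomials outside the Stanley-Reisner ideal of n points are the pure powers.
pure-or-pair : Fin n → (e : Exponent n) →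
  (∃₂ λ i t → e ≡ pure i t) ⊎ (∃₂ λ p q → p ≢ q × pair p q ∣ₑ e)
pure-or-pair o e with Fin.any? (λ i → 0 ℕ.<? lookup e i)
... | no ¬pos = inj₁ (o , _ , zero-off⇒pure o λ j _ → ℕ.n≤0⇒n≡0 (ℕ.≮⇒≥ λ pos → ¬pos (j , pos)))
... | yes (p , 0<p) with Fin.any? (λ q → ¬? (p Fin.≟ q) ×-dec (0 ℕ.<? lookup e q))
...   | yes (q , p≢q , 0<q) = inj₂ (p , q , p≢q , pair-∣ₑ p≢q 0<p 0<q)
...   | no ¬pos = inj₁ (p , _ , zero-off⇒pure p λ j j≢p →
          ℕ.n≤0⇒n≡0 (ℕ.≮⇒≥ λ pos → ¬pos (j , (λ eq → j≢p (≡.sym eq)) , pos)))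

-- Coefficients of polynomials along the coordinate axes

-- A partial map, as `reindex` takes it: `nothing` deletes a term whatever its coefficient.
onAxis : ∀ {n} → Fin n → Exponent n → Maybe (Exponent n)
onAxis i e with e ≟ₑ pure i (lookup e i)
... | yes _ = just e
... | no _  = nothing

onAxis-pure : ∀ {n} (i : Fin n) t → onAxis i (pure i t) ≡ just (pure i t)
onAxis-pure i t with pure i t ≟ₑ pure i (lookup (pure i t) i)
... | yes _  = ≡.refl
... | no ¬eq = contradiction (≡.cong (pure i) (≡.sym (lookup-pure i t))) ¬eq

onAxis-just : ∀ {n} (i : Fin n) x {e} → onAxis i x ≡ just e → x ≡ e × ∃ λ t → e ≡ pure i t
onAxis-just i x eq with x ≟ₑ pure i (lookup x i)
onAxis-just i x ≡.refl | yes x-pure = ≡.refl , _ , x-pure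
onAxis-just i x () | no _

lowered : ∀ {n} → Fin n → Exponent n → Maybe (Exponent n)
lowered i e with lookup e i
... | zero        = nothing
... | suc zero    = nothing
... | suc (suc t) with e ≟ₑ pure i (suc (suc t))
...   | yes _ = just (pure i (suc t))
...   | no _  = nothing

lowered-pure : ∀ {n} (i : Fin n) t → lowered i (pure i (suc (suc t))) ≡ just (pure i (suc t))
lowered-pure i t with lookup (pure i (suc (suc t))) i | lookup-pure i (suc (suc t))
... | _ | ≡.refl with pure i (suc (suc t)) ≟ₑ pure i (suc (suc t))
...   | yes _  = ≡.refl
...   | no ¬eq = contradiction ≡.refl ¬eq

lowered-just : ∀ {n} (i : Fin n) x {e} → lowered i x ≡ just e →
               ∃ λ t → x ≡ pure i (suc (suc t)) × e ≡ pure i (suc t)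
lowered-just i x eq with lookup x i
lowered-just i x () | zero
lowered-just i x () | suc zero
lowered-just i x eq | suc (suc s) with x ≟ₑ pure i (suc (suc s))
lowered-just i x ≡.refl | suc (suc s) | yes x≡ = s , x≡ , ≡.refl
lowered-just i x () | suc (suc s) | no _

module PolynomialCoefficients {r ℓr} (K : CommutativeRing r ℓr) (n : ℕ) where
  open CommutativeRing K
  open Polynomials K n

  X : Fin n → Poly
  X i = monomial (pure i 1)

  coeff-∷-≡ : ∀ c a p {e} → a ≡ e → coeff ((c , a) ∷ p) e ≈ c + coeff p e
  coeff-∷-≡ c a p {e} a≡e with a ≟ₑ e
  ... | yes _  = refl
  ... | no a≢e = contradiction a≡e a≢e

  coeff-∷-≢ : ∀ c a p {e} → a ≢ e → coeff ((c , a) ∷ p) e ≈ coeff p e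
  coeff-∷-≢ c a p {e} a≢e with a ≟ₑ e
  ... | yes a≡e = contradiction a≡e a≢e
  ... | no _    = +-identityˡ _

  coeff-term-≡ : ∀ c a {e} → a ≡ e → coeff ((c , a) ∷ []) e ≈ c
  coeff-term-≡ c a a≡e = trans (coeff-∷-≡ c a [] a≡e) (+-identityʳ c)

  coeff-·ₜ-≡ : ∀ c a p {e u} → u ≡ a ⊕ e → coeff ((c , a) ·ₜ p) u ≈ c * coeff p e
  coeff-·ₜ-≡ c a p {e} ≡.refl = coeff-·ₜ c a p e

  coeff-monomial-* : ∀ a p {e u} → u ≡ a ⊕ e → coeff (monomial a *ₚ p) u ≈ coeff p e
  coeff-monomial-* a p {e} {u} u≡ = trans (coeff-+ ((1# , a) ·ₜ p) [] u)
    (trans (+-identityʳ _) (trans (coeff-·ₜ-≡ 1# a p u≡) (*-identityˡ _)))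

  coeff-monomial-*-∤ : ∀ a p {u} → ¬ (a ∣ₑ u) → coeff (monomial a *ₚ p) u ≈ 0#
  coeff-monomial-*-∤ a p {u} a∤u = trans (coeff-+ ((1# , a) ·ₜ p) [] u)
    (trans (+-identityʳ _) (coeff-·ₜ-∤ 1# a p a∤u))

  coeff-X-* : ∀ i p t → coeff (X i *ₚ p) (pure i (suc t)) ≈ coeff p (pure i t)
  coeff-X-* i p t = coeff-monomial-* (pure i 1) p (≡.sym (pure-⊕ i 1 t))

  coeff-X-*-≢ : ∀ {i j} p t → i ≢ j → coeff (X i *ₚ p) (pure j t) ≈ 0#
  coeff-X-*-≢ {i} p t i≢j = coeff-monomial-*-∤ (pure i 1) p (pure-suc-∤ i≢j)

  coeff-X-*-0 : ∀ i j p → coeff (X i *ₚ p) (pure j 0) ≈ 0#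
  coeff-X-*-0 i j p = coeff-monomial-*-∤ (pure i 1) p λ div →
    contradiction (≡.subst₂ ℕ._≤_ (lookup-pure i 1)
      (≡.trans (≡.cong (λ v → lookup v i) (≡.trans (pure-0 j) (≡.sym (pure-0 i)))) (lookup-pure i 0))
      (∣ₑ-lookup div i)) λ ()

  coeff-minus : ∀ p q e → coeff (p +ₚ (-ₚ q)) e ≈ coeff p e - coeff q e
  coeff-minus p q e = trans (coeff-+ p (-ₚ q) e) (+-congˡ (coeff-neg q e))

  infix 4 _∼[_]_
  -- The case `t = 0` compares the constant terms, so these are compared on every axis.
  _∼[_]_ : Poly → Fin n → Poly → Set ℓr
  p ∼[ i ] q = ∀ t → coeff p (pure i t) ≈ coeff q (pure i t)

  -- Divisors of a power of x_i are powers of x_i; restricting to the axis is setting the other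
  -- variables to 0, a ring homomorphism.
  *ₚ-axis-congˡ : ∀ {i} p {q q′} → q ∼[ i ] q′ → (p *ₚ q) ∼[ i ] (p *ₚ q′)
  *ₚ-axis-congˡ []            q∼ t = refl
  *ₚ-axis-congˡ {i} ((c , a) ∷ p) {q} {q′} q∼ t =
    trans (coeff-+ ((c , a) ·ₜ q) (p *ₚ q) _)
    (trans (+-cong head (*ₚ-axis-congˡ p {q} {q′} q∼ t))
    (sym (coeff-+ ((c , a) ·ₜ q′) (p *ₚ q′) _)))
    where
    head : coeff ((c , a) ·ₜ q) (pure i t) ≈ coeff ((c , a) ·ₜ q′) (pure i t)
    head with a ∣ₑ? pure i t
    ... | no ∤ = trans (coeff-·ₜ-∤ c a q ∤) (sym (coeff-·ₜ-∤ c a q′ ∤))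
    ... | yes div with ∣ₑ⇒⊕ div
    ...   | e , eq = trans (coeff-·ₜ-≡ c a q eq)
            (trans (*-congˡ (≡.subst (λ e → coeff q e ≈ coeff q′ e) (≡.sym e-pure) (q∼ _)))
            (sym (coeff-·ₜ-≡ c a q′ eq)))
      where
      e-pure : e ≡ pure i (lookup e i)
      e-pure = ∣ₑ-pure (≡.subst (e ∣ₑ_) (≡.trans (⊕-comm e a) (≡.sym eq)) (∣ₑ-⊕ e a))

  module _ (f : Exponent n → Maybe (Exponent n)) where

    reindex : Poly → Poly
    reindex [] = []
    reindex ((c , e) ∷ p) with f e
    ... | just e′ = (c , e′) ∷ reindex p
    ... | nothing = reindex p

    -- As `e` is the only preimage of `e′`, no other terms are merged into it.
    coeff-reindex : ∀ {e e′} → f e ≡ just e′ → (∀ x → f x ≡ just e′ → x ≡ e) →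
                    ∀ p → coeff (reindex p) e′ ≈ coeff p e
    coeff-reindex fe≡ inj [] = refl
    coeff-reindex {e} {e′} fe≡ inj ((c , a) ∷ p) with f a in fa≡
    ... | nothing = trans (coeff-reindex fe≡ inj p) (sym (coeff-∷-≢ c a p λ where
            ≡.refl → contradiction (≡.trans (≡.sym fa≡) fe≡) λ ()))
    ... | just b with b ≟ₑ e′
    ...   | yes ≡.refl = trans (+-congˡ (coeff-reindex fe≡ inj p)) (sym (coeff-∷-≡ c a p (inj a fa≡)))
    ...   | no b≢e′ = trans (+-identityˡ _) (trans (coeff-reindex fe≡ inj p)
            (sym (coeff-∷-≢ c a p λ where
              ≡.refl → b≢e′ (just-injective (≡.trans (≡.sym fa≡) fe≡)))))

    coeff-reindex-∉ : ∀ {e′} → (∀ x → f x ≢ just e′) → ∀ p → coeff (reindex p) e′ ≈ 0#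
    coeff-reindex-∉ ∉ [] = refl
    coeff-reindex-∉ {e′} ∉ ((c , a) ∷ p) with f a in fa≡
    ... | nothing = coeff-reindex-∉ ∉ p
    ... | just b = trans (coeff-∷-≢ c b (reindex p) λ where ≡.refl → ∉ a fa≡)
            (coeff-reindex-∉ ∉ p)

    reindex-++ : ∀ p q → reindex (p ++ q) ≡ reindex p ++ reindex q
    reindex-++ [] q = ≡.refl
    reindex-++ ((c , e) ∷ p) q with f e
    ... | just e′ = ≡.cong ((c , e′) ∷_) (reindex-++ p q)
    ... | nothing = reindex-++ p q

  -- The projection of K[x₁,…,xₙ] onto K[xᵢ].
  axis : Fin n → Poly → Poly
  axis i = reindex (onAxis i)

  coeff-axis : ∀ i p t → coeff (axis i p) (pure i t) ≈ coeff p (pure i t)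
  coeff-axis i p t = coeff-reindex (onAxis i) (onAxis-pure i t)
    (λ x eq → proj₁ (onAxis-just i x eq)) p

  coeff-axis-∉ : ∀ i p {e} → (∀ t → e ≢ pure i t) → coeff (axis i p) e ≈ 0#
  coeff-axis-∉ i p ∉ = coeff-reindex-∉ (onAxis i)
    (λ x eq → let _ , t , e≡ = onAxis-just i x eq in ∉ t e≡) p

  -- Division by xᵢ of the part of degree at least 2 in K[xᵢ]; the linear part is left
  -- out because it carries the obstruction to extending homomorphisms.
  lower : Fin n → Poly → Poly
  lower i = reindex (lowered i)

  coeff-lower : ∀ i p t → coeff (lower i p) (pure i (suc t)) ≈ coeff p (pure i (suc (suc t)))
  coeff-lower i p t = coeff-reindex (lowered i) (lowered-pure i t)
    (λ x eq → let s , x≡ , e≡ = lowered-just i x eq in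
      ≡.trans x≡ (≡.cong (pure i ∘ suc) (≡.sym (pure-injective e≡)))) p

  coeff-lower-∉ : ∀ i p {e} → (∀ t → e ≢ pure i (suc t)) → coeff (lower i p) e ≈ 0#
  coeff-lower-∉ i p ∉ = coeff-reindex-∉ (lowered i)
    (λ x eq → let t , _ , e≡ = lowered-just i x eq in ∉ t e≡) p

-- Minimal nonfaces

lookup-indicator-∈ : {F : Subset n} {i : Fin n} → i Subset.∈ F → lookup (indicator F) i ≡ 1
lookup-indicator-∈ {F = F} {i} i∈F = ≡.trans (Vec.lookup-map i _ F)
  (≡.cong (λ b → if b then 1 else 0) (Vec.[]=⇒lookup i∈F))

lookup-indicator-∉ : {F : Subset n} {i : Fin n} → i Subset.∉ F → lookup (indicator F) i ≡ 0
lookup-indicator-∉ {F = F} {i} i∉F with lookup F i in eq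
... | true  = contradiction (Vec.lookup⇒[]= i F eq) i∉F
... | false = ≡.trans (Vec.lookup-map i _ F) (≡.cong (λ b → if b then 1 else 0) eq)

indicator-injective : {F G : Subset n} → indicator F ≡ indicator G → F ≡ G
indicator-injective {F = []} {[]} _ = ≡.refl
indicator-injective {F = true  ∷ F} {true  ∷ G} eq = ≡.cong (true ∷_) (indicator-injective (Vec.∷-injectiveʳ eq))
indicator-injective {F = false ∷ F} {false ∷ G} eq = ≡.cong (false ∷_) (indicator-injective (Vec.∷-injectiveʳ eq))

indicator-pair : {p q : Fin n} → p ≢ q → indicator (⁅ p ⁆ ∪ ⁅ q ⁆) ≡ pair p q
indicator-pair {p = p} {q} p≢q = ∣ₑ-antisym (lookup-∣ₑ ≤pair)
  (pair-∣ₑ p≢q (pos (Subset.x∈p∪q⁺ (inj₁ (Subset.x∈⁅x⁆ p)))) (pos (Subset.x∈p∪q⁺ (inj₂ (Subset.x∈⁅x⁆ q)))))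
  where
  pos : ∀ {i} → i Subset.∈ ⁅ p ⁆ ∪ ⁅ q ⁆ → 0 < lookup (indicator (⁅ p ⁆ ∪ ⁅ q ⁆)) i
  pos i∈ = ≡.subst (0 <_) (≡.sym (lookup-indicator-∈ i∈)) (s≤s z≤n)
  ≤pair : ∀ i → lookup (indicator (⁅ p ⁆ ∪ ⁅ q ⁆)) i ≤ lookup (pair p q) i
  ≤pair i with i Subset.∈? (⁅ p ⁆ ∪ ⁅ q ⁆)
  ... | no i∉ = ≡.subst (_≤ lookup (pair p q) i) (≡.sym (lookup-indicator-∉ i∉)) z≤n
  ... | yes i∈ with Subset.x∈p∪q⁻ ⁅ p ⁆ ⁅ q ⁆ i∈
  ...   | inj₁ i∈p rewrite lookup-indicator-∈ i∈ | Subset.x∈⁅y⁆⇒x≡y p i∈p = lookup-pairˡ p q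
  ...   | inj₂ i∈q rewrite lookup-indicator-∈ i∈ | Subset.x∈⁅y⁆⇒x≡y q i∈q = lookup-pairʳ p q

two-elements⇒1<∣∣ : {F : Subset n} {p q : Fin n} → p ≢ q → p Subset.∈ F → q Subset.∈ F → 1 < ∣ F ∣
two-elements⇒1<∣∣ {F = F} {p} {q} p≢q p∈ q∈ = ℕ.≤-<-trans
  (ℕ.≤-<-trans z≤n (Subset.x∈p⇒∣p-x∣<∣p∣ (Subset.x∈p∧x≢y⇒x∈p-y p∈ p≢q)))
  (Subset.x∈p⇒∣p-x∣<∣p∣ q∈)

allSubsets-unique : ∀ n → Unique (allSubsets n)
allSubsets-unique zero    = ListAll.[] ∷ []
allSubsets-unique (suc n) = Unique.++⁺
  (Unique.map⁺ Vec.∷-injectiveʳ (allSubsets-unique n))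
  (Unique.map⁺ Vec.∷-injectiveʳ (allSubsets-unique n))
  λ (t , f) → disjoint (∈-map⁻ (true ∷_) t) (∈-map⁻ (false ∷_) f)
  where
  disjoint : ∀ {F} → (∃ λ G → G ∈ allSubsets n × F ≡ true ∷ G) →
                     ¬ (∃ λ G → G ∈ allSubsets n × F ≡ false ∷ G)
  disjoint (_ , _ , ≡.refl) (_ , _ , ())

lookup-injective : ∀ {a} {A : Set a} {xs : List A} → Unique xs →
                   ∀ {i j} → List.lookup xs i ≡ List.lookup xs j → i ≡ j
lookup-injective (x∉ ∷ u) {zero}  {zero}  eq = ≡.refl
lookup-injective (x∉ ∷ u) {suc i} {suc j} eq = ≡.cong suc (lookup-injective u eq)
lookup-injective {xs = _ ∷ xs} (x∉ ∷ u) {zero}  {suc j} eq = contradiction eq (ListAll.lookup x∉ (∈-lookup {xs = xs} j))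
lookup-injective {xs = _ ∷ xs} (x∉ ∷ u) {suc i} {zero}  eq = contradiction (≡.sym eq) (ListAll.lookup x∉ (∈-lookup {xs = xs} i))

module _ (Δ : SimplicialComplex n) where

  minimalExponents-unique : Unique (minimalExponents Δ)
  minimalExponents-unique = Unique.filter⁺ (isMinimal? (nonfaceExponents Δ))
    (Unique.map⁺ indicator-injective (Unique.filter⁺ (¬? ∘ SimplicialComplex.face? Δ) (allSubsets-unique _)))

module Points (Δ : SimplicialComplex n) (zeroDim : IsZeroDimensional Δ) (noLoops : NoLoops Δ) where
  open SimplicialComplex Δ

  -- A face with one element provides a vertex, hence an axis on which the monomial 1 can be written
  -- as a pure power.
  origin : Fin n
  origin with proj₂ zeroDim
  ... | F , _ , ∣F∣≡1 with Subset.nonempty? F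
  ...   | yes (i , _) = i
  ...   | no empty = contradiction (≡.trans (≡.sym (Subset.∣⊥∣≡0 n))
            (≡.trans (≡.cong ∣_∣ (≡.sym (Subset.Empty-unique empty))) ∣F∣≡1)) λ ()

  nonface⇒two-elements : ∀ {F} → ¬ Face F → ∃₂ λ p q → p ≢ q × p Subset.∈ F × q Subset.∈ F
  nonface⇒two-elements {F} F∉ with Subset.nonempty? F
  ... | no empty = contradiction (closed (λ i∈ → contradiction (_ , i∈) empty) (noLoops origin)) F∉
  ... | yes (p , p∈) with Fin.any? (λ q → ¬? (p Fin.≟ q) ×-dec (q Subset.∈? F))
  ...   | yes (q , p≢q , q∈) = p , q , p≢q , p∈ , q∈
  ...   | no ¬two = contradiction (closed F⊆ (noLoops p)) F∉
    where
    F⊆ : F Subset.⊆ ⁅ p ⁆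
    F⊆ {q} q∈ with p Fin.≟ q
    ... | yes ≡.refl = Subset.x∈⁅x⁆ p
    ... | no p≢q     = contradiction (q , p≢q , q∈) ¬two

  pair∈nonfaceExponents : ∀ {p q} → p ≢ q → pair p q ∈ nonfaceExponents Δ
  pair∈nonfaceExponents {p} {q} p≢q = ≡.subst (_∈ nonfaceExponents Δ) (indicator-pair p≢q)
    (∈-map⁺ indicator (∈-filter⁺ (¬? ∘ face?) (∈-allSubsets (⁅ p ⁆ ∪ ⁅ q ⁆)) λ face →
      ℕ.<⇒≱ (two-elements⇒1<∣∣ p≢q (Subset.x∈p∪q⁺ (inj₁ (Subset.x∈⁅x⁆ p)))
                                   (Subset.x∈p∪q⁺ (inj₂ (Subset.x∈⁅x⁆ q))))
            (proj₁ zeroDim _ face)))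

  pair-∣ₑ-nonfaceExponent : ∀ {e} → e ∈ nonfaceExponents Δ → ∃₂ λ p q → p ≢ q × pair p q ∣ₑ e
  pair-∣ₑ-nonfaceExponent e∈ with ∈-map⁻ indicator e∈
  ... | F , F∈ , ≡.refl with nonface⇒two-elements (proj₂ (∈-filter⁻ (¬? ∘ face?) {xs = allSubsets n} F∈))
  ...   | p , q , p≢q , p∈ , q∈ = p , q , p≢q , pair-∣ₑ p≢q (pos p∈) (pos q∈)
    where
    pos : ∀ {i} → i Subset.∈ F → 0 < lookup (indicator F) i
    pos i∈ = ≡.subst (0 <_) (≡.sym (lookup-indicator-∈ i∈)) (s≤s z≤n)

  -- Every nonface exponent is divisible by some pair, and a pair dividing another pair equals it.
  pair∈minimalExponents : ∀ {p q} → p ≢ q → pair p q ∈ minimalExponents Δ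
  pair∈minimalExponents {p} {q} p≢q = ∈-filter⁺ (isMinimal? (nonfaceExponents Δ))
    (pair∈nonfaceExponents p≢q) (ListAll.tabulate λ f∈ f∣ → ∣ₑ-antisym f∣ (pair∣ f∈ f∣))
    where
    pair∣ : ∀ {f} → f ∈ nonfaceExponents Δ → f ∣ₑ pair p q → pair p q ∣ₑ f
    pair∣ {f} f∈ f∣ with pair-∣ₑ-nonfaceExponent f∈
    ... | r , s , r≢s , rs∣f with pair-∣ₑ-pair r≢s (lookup-∣ₑ λ i →
            ℕ.≤-trans (∣ₑ-lookup rs∣f i) (∣ₑ-lookup f∣ i))
    ...   | inj₁ (≡.refl , ≡.refl) = rs∣f
    ...   | inj₂ (≡.refl , ≡.refl) = ≡.subst (_∣ₑ f) (pair-comm r s) rs∣f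

  private
    exponent : Fin (List.length (minimalExponents Δ)) → Exponent n
    exponent = List.lookup (minimalExponents Δ)

  abstract
    -- The index of the generator x_p x_q. Exchanging p and q gives the same index, but only through
    -- `exponent-injective`.
    edge : {p q : Fin n} → p ≢ q → Fin (List.length (minimalExponents Δ))
    edge p≢q = Any.index (pair∈minimalExponents p≢q)

    exponent-edge : {p q : Fin n} (p≢q : p ≢ q) → exponent (edge p≢q) ≡ pair p q
    exponent-edge p≢q = ≡.sym (lookup-index (pair∈minimalExponents p≢q))

    exponent-injective : ∀ {i j} → exponent i ≡ exponent j → i ≡ j
    exponent-injective = lookup-injective (minimalExponents-unique Δ)

    -- A minimal nonface exponent is divisible by a pair that is itself a nonface exponent, so
    -- minimality makes them equal. The order of p and q is an arbitrary choice.
    exponent-pair : ∀ i → ∃₂ λ (p q : Fin n) → Σ (p ≢ q) λ p≢q → i ≡ edge p≢q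
    exponent-pair i with ∈-filter⁻ (isMinimal? (nonfaceExponents Δ)) {xs = nonfaceExponents Δ}
                           (∈-lookup {xs = minimalExponents Δ} i)
    ... | i∈ , min with pair-∣ₑ-nonfaceExponent i∈
    ...   | p , q , p≢q , div = p , q , p≢q , exponent-injective
            (≡.trans (≡.sym (ListAll.lookup min (pair∈nonfaceExponents p≢q) div)) (≡.sym (exponent-edge p≢q)))

-- Degrees and supports

exponentDegree-⊕-minus : (e g : Exponent n) → exponentDegree (e ⊕ g) -ᵈ exponentDegree g ≡ exponentDegree e
exponentDegree-⊕-minus []      []      = ≡.refl
exponentDegree-⊕-minus (x ∷ e) (y ∷ g) = ≡.cong₂ _∷_ (cancel (+ x) (+ y)) (exponentDegree-⊕-minus e g)
  where
  cancel : ∀ x y → (x ℤ.+ y) ℤ.- y ≡ x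
  cancel = solve-∀

-ᵈ≡+ᵈ0- : (u v : Degree n) → u -ᵈ v ≡ u +ᵈ (exponentDegree 0ₑ -ᵈ v)
-ᵈ≡+ᵈ0- []      []      = ≡.refl
-ᵈ≡+ᵈ0- (x ∷ u) (y ∷ v) = ≡.cong₂ _∷_ (≡.cong (λ z → x ℤ.+ z) (≡.sym (ℤ.+-identityˡ (ℤ.- y)))) (-ᵈ≡+ᵈ0- u v)

shift-degree : (x y a b : Exponent n) →
  exponentDegree x ≡ exponentDegree (x ⊕ y) +ᵈ (exponentDegree a -ᵈ exponentDegree b) → y ⊕ a ≡ b
shift-degree [] [] [] [] _ = ≡.refl
shift-degree (x ∷ xs) (y ∷ ys) (a ∷ as) (b ∷ bs) eq = ≡.cong₂ _∷_
  (ℤ.+-injective (≡.trans (left (+ x) (+ y) (+ a) (+ b))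
    (≡.trans (≡.cong (λ z → (+ b ℤ.+ z) ℤ.- + x) (≡.sym (Vec.∷-injectiveˡ eq))) (right (+ x) (+ b)))))
  (shift-degree xs ys as bs (Vec.∷-injectiveʳ eq))
  where
  left : ∀ x y a b → y ℤ.+ a ≡ (b ℤ.+ ((x ℤ.+ y) ℤ.+ (a ℤ.- b))) ℤ.- x
  left = solve-∀
  right : ∀ x b → (b ℤ.+ x) ℤ.- x ≡ b
  right = solve-∀

⊕-identityʳ : (a : Exponent n) → a ⊕ 0ₑ ≡ a
⊕-identityʳ a = ≡.trans (⊕-comm a 0ₑ) (⊕-identityˡ a)

∣support-0∣ : ∀ n → ∣ support (0ₑ {n}) ∣ ≡ 0
∣support-0∣ zero    = ≡.refl
∣support-0∣ (suc n) = ∣support-0∣ n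

∣support-pure∣ : (i : Fin n) → ∣ support (pure i 1) ∣ ≡ 1
∣support-pure∣ {suc n} zero = ≡.cong suc (∣support-0∣ n)
∣support-pure∣ (suc i) = ∣support-pure∣ i

∣support-pair∣ : {p q : Fin n} → p ≢ q → ∣ support (pair p q) ∣ ≡ 2
∣support-pair∣ {p = zero}  {zero}  p≢q = contradiction ≡.refl p≢q
∣support-pair∣ {p = zero}  {suc q} p≢q = ≡.cong suc (≡.trans (≡.cong (∣_∣ ∘ support) (⊕-identityˡ (pure q 1))) (∣support-pure∣ q))
∣support-pair∣ {p = suc p} {zero}  p≢q = ≡.cong suc (≡.trans (≡.cong (∣_∣ ∘ support) (⊕-identityʳ (pure p 1))) (∣support-pure∣ p))
∣support-pair∣ {p = suc p} {suc q} p≢q = ∣support-pair∣ (p≢q ∘ ≡.cong suc)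

∣support∣≡0 : {b : Exponent n} → ∣ support b ∣ ≡ 0 → b ≡ 0ₑ
∣support∣≡0 {b = []}        _  = ≡.refl
∣support∣≡0 {b = zero ∷ b}  eq = ≡.cong (0 ∷_) (∣support∣≡0 eq)
∣support∣≡0 {b = suc _ ∷ b} ()

∣support∣≡1 : {b : Exponent n} → All (_≤ 1) b → ∣ support b ∣ ≡ 1 → ∃ λ i → b ≡ pure i 1
∣support∣≡1 {b = zero ∷ b} (_ ∷ b≤1) eq with ∣support∣≡1 b≤1 eq
... | i , b≡ = suc i , ≡.cong (0 ∷_) b≡
∣support∣≡1 {b = suc zero ∷ b} (_ ∷ b≤1) eq = zero , ≡.cong (1 ∷_) (∣support∣≡0 (ℕ.suc-injective eq))
∣support∣≡1 {b = suc (suc _) ∷ b} (s≤s () ∷ _) eq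

∣support∣≡2 : {b : Exponent n} → All (_≤ 1) b → ∣ support b ∣ ≡ 2 → ∃₂ λ p q → p ≢ q × b ≡ pair p q
∣support∣≡2 {b = zero ∷ b} (_ ∷ b≤1) eq with ∣support∣≡2 b≤1 eq
... | p , q , p≢q , b≡ = suc p , suc q , p≢q ∘ Fin.suc-injective , ≡.cong (0 ∷_) b≡
∣support∣≡2 {b = suc zero ∷ b} (_ ∷ b≤1) eq with ∣support∣≡1 b≤1 (ℕ.suc-injective eq)
... | q , b≡ = zero , suc q , (λ ()) , ≡.cong (1 ∷_) (≡.trans b≡ (≡.sym (⊕-identityˡ _)))
∣support∣≡2 {b = suc (suc _) ∷ b} (s≤s () ∷ _) eq

disjoint-supports : (a b c : Exponent n) → Empty (support a ∩ support b) → c ⊕ a ≡ b → a ≡ 0ₑ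
disjoint-supports a b c empty eq = lookup-ext λ i →
  ≡.trans (go i (lookup a i) ≡.refl) (≡.sym (Vec.lookup-replicate i 0))
  where
  in-support : ∀ {v i} → 0 < lookup v i → lookup (support v) i ≡ does (0 ℕ.<? lookup v i) → support v Vec.[ i ]= true
  in-support {v} {i} 0< l = Vec.lookup⇒[]= i (support v) (≡.trans l (dec-true (0 ℕ.<? lookup v i) 0<))
  go : ∀ i m → lookup a i ≡ m → lookup a i ≡ 0
  go i zero    a≡ = a≡
  go i (suc m) a≡ = contradiction (i , Subset.x∈p∩q⁺
    (in-support {a} 0<a (Vec.lookup-map i _ a) , in-support {b} 0<b (Vec.lookup-map i _ b))) empty
    where
    0<a : 0 < lookup a i
    0<a = ≡.subst (0 <_) (≡.sym a≡) (s≤s z≤n)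
    0<b : 0 < lookup b i
    0<b = ≡.subst (λ v → 0 < lookup v i) eq
      (≡.subst (0 <_) (≡.sym (lookup-⊕ c a i)) (ℕ.≤-trans 0<a (ℕ.m≤n+m _ _)))

-- Enumeration of the vertices outside a pair

module _ {m : ℕ} {j k : Fin (suc (suc m))} (j≢k : j ≢ k) where

  -- Once `j` is removed, `k` sits at position `punchOut j≢k`; the inner `punchIn` skips that
  -- position.
  others : Fin m → Fin (suc (suc m))
  others x = punchIn j (punchIn (punchOut j≢k) x)

  others-injective : ∀ {x y} → others x ≡ others y → x ≡ y
  others-injective eq = Fin.punchIn-injective _ _ _ (Fin.punchIn-injective j _ _ eq)

  j≢others : ∀ x → j ≢ others x
  j≢others x eq = Fin.punchInᵢ≢i j _ (≡.sym eq)

  k≢others : ∀ x → k ≢ others x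
  k≢others x eq = Fin.punchInᵢ≢i (punchOut j≢k) x (≡.sym (Fin.punchIn-injective j _ _
    (≡.trans (Fin.punchIn-punchOut j≢k) eq)))

  others-surjective : ∀ {i} → j ≢ i → k ≢ i → ∃ λ x → others x ≡ i
  others-surjective {i} j≢i k≢i = punchOut k≢i′ ,
    ≡.trans (≡.cong (punchIn j) (Fin.punchIn-punchOut k≢i′)) (Fin.punchIn-punchOut j≢i)
    where
    k≢i′ : punchOut j≢k ≢ punchOut j≢i
    k≢i′ eq = k≢i (Fin.punchOut-injective j≢k j≢i eq)

-- Keeps the monomials of the Stanley-Reisner ideal, by `pure-or-pair`.
nonpure : ∀ {n} → Fin n → Exponent n → Maybe (Exponent n)
nonpure o e with pure-or-pair o e
... | inj₁ _ = nothing
... | inj₂ _ = just e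

-- Monomials with two factorisations through edges

pos⇒⊕ : {e : Exponent n} {i : Fin n} → 0 < lookup e i → ∃ λ e′ → e ≡ pure i 1 ⊕ e′
pos⇒⊕ {e = e} {i} 0<e = ∣ₑ⇒⊕ (lookup-∣ₑ go)
  where
  go : ∀ j → lookup (pure i 1) j ≤ lookup e j
  go j with j Fin.≟ i
  ... | yes ≡.refl rewrite lookup-pure i 1 = 0<e
  ... | no j≢i rewrite lookup-pure-≢ j≢i 1 = z≤n

⊕-left-swap : (a b c : Exponent n) → a ⊕ (b ⊕ c) ≡ b ⊕ (a ⊕ c)
⊕-left-swap a b c = ≡.trans (≡.sym (⊕-assoc a b c))
  (≡.trans (≡.cong (_⊕ c) (⊕-comm a b)) (⊕-assoc b a c))

pos-cancel : {e f : Exponent n} (a b : Exponent n) (i : Fin n) → e ⊕ a ≡ f ⊕ b →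
             lookup a i ≡ 0 → 0 < lookup b i → 0 < lookup e i
pos-cancel {e = e} {f} a b i eq a≡0 0<b = ≡.subst (0 <_) (≡.sym at-i) (ℕ.≤-trans 0<b (ℕ.m≤n+m _ _))
  where
  at-i : lookup e i ≡ lookup f i ℕ.+ lookup b i
  at-i = ≡.trans (≡.sym (ℕ.+-identityʳ _)) (≡.trans (≡.cong (lookup e i ℕ.+_) (≡.sym a≡0))
    (≡.trans (≡.sym (lookup-⊕ e a i)) (≡.trans (≡.cong (λ v → lookup v i) eq) (lookup-⊕ f b i))))

-- Cancelling x_p leaves x^e x_q = x^f x_r, so x_r divides x^e. The binomial x^e e_pq - x^f e_pr is
-- thus x^c times a linear relation.
common-vertex : {e f : Exponent n} {p q r : Fin n} → q ≢ r → e ⊕ pair p q ≡ f ⊕ pair p r →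
                ∃ λ c → e ≡ c ⊕ pure r 1 × f ≡ c ⊕ pure q 1
common-vertex {e = e} {f} {p} {q} {r} q≢r eq =
  c , ≡.trans e≡ (⊕-comm _ c) , ⊕-cancelˡ (pure r 1) (≡.trans (⊕-comm _ f)
    (≡.trans (≡.sym cancelled) (≡.trans (≡.cong (_⊕ pure q 1) e≡) (⊕-assoc _ c _))))
  where
  cancelled : e ⊕ pure q 1 ≡ f ⊕ pure r 1
  cancelled = ⊕-cancelˡ (pure p 1) (≡.trans (⊕-left-swap (pure p 1) e _)
    (≡.trans eq (⊕-left-swap f (pure p 1) _)))
  e⇒ : ∃ λ c → e ≡ pure r 1 ⊕ c
  e⇒ = pos⇒⊕ (pos-cancel {f = f} (pure q 1) (pure r 1) r cancelled (lookup-pure-≢ (q≢r ∘ ≡.sym) 1)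
    (≡.subst (0 <_) (≡.sym (lookup-pure r 1)) (s≤s z≤n)))
  c = proj₁ e⇒
  e≡ = proj₂ e⇒

-- Neither x_r nor x_s divides x_p x_q, so both divide x^e. The binomial x^e e_pq - x^f e_rs is thus
-- x^c times a Koszul relation.
disjoint-edges : {e f : Exponent n} {p q r s : Fin n} → r ≢ s → r ≢ p → r ≢ q → s ≢ p → s ≢ q →
                 e ⊕ pair p q ≡ f ⊕ pair r s → ∃ λ c → e ≡ c ⊕ pair r s × f ≡ c ⊕ pair p q
disjoint-edges {e = e} {f} {p} {q} {r} {s} r≢s r≢p r≢q s≢p s≢q eq =
  c , ≡.trans e≡ (⊕-comm _ c) , ⊕-cancelˡ (pair r s) (≡.trans (⊕-comm _ f)
    (≡.trans (≡.sym eq) (≡.trans (≡.cong (_⊕ pair p q) e≡) (⊕-assoc _ c _))))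
  where
  off : ∀ {i} → i ≢ p → i ≢ q → lookup (pair p q) i ≡ 0
  off {i} i≢p i≢q = ≡.trans (lookup-⊕ (pure p 1) (pure q 1) i) (≡.cong₂ ℕ._+_ (lookup-pure-≢ i≢p 1) (lookup-pure-≢ i≢q 1))
  e⇒ : ∃ λ c → e ≡ pair r s ⊕ c
  e⇒ = ∣ₑ⇒⊕ (pair-∣ₑ r≢s
    (pos-cancel {f = f} (pair p q) (pair r s) r eq (off r≢p r≢q) (lookup-pairˡ r s))
    (pos-cancel {f = f} (pair p q) (pair r s) s eq (off s≢p s≢q) (lookup-pairʳ r s)))
  c = proj₁ e⇒
  e≡ = proj₂ e⇒

-- Assigning each monomial of an ideal to one generator

module Division {n m : ℕ} (g : Fin m → Exponent n) where

  private
    quotientBy : ∀ {u} → Dec (∃ λ j → g j ∣ₑ u) → Fin m → Maybe (Exponent n)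
    quotientBy (no _) i = nothing
    quotientBy (yes (j , div)) i with j Fin.≟ i
    ... | yes _ = just (proj₁ (∣ₑ⇒⊕ div))
    ... | no _  = nothing

    quotientBy-just : ∀ {u} (p : Dec (∃ λ j → g j ∣ₑ u)) i {e} → quotientBy p i ≡ just e → u ≡ g i ⊕ e
    quotientBy-just (yes (j , div)) i eq with j Fin.≟ i
    quotientBy-just (yes (j , div)) j ≡.refl | yes ≡.refl = proj₂ (∣ₑ⇒⊕ div)
    quotientBy-just (yes (j , div)) i () | no _

    quotientBy-index : ∀ {u} (p : Dec (∃ λ j → g j ∣ₑ u)) → ∃ (λ i → g i ∣ₑ u) →
      ∃₂ λ j e → quotientBy p j ≡ just e × (∀ i → i ≢ j → quotientBy p i ≡ nothing)
    quotientBy-index (no ∤) div = contradiction div ∤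
    quotientBy-index (yes (j , div)) _ = j , proj₁ (∣ₑ⇒⊕ div) , here , off
      where
      here : quotientBy (yes (j , div)) j ≡ just (proj₁ (∣ₑ⇒⊕ div))
      here with j Fin.≟ j
      ... | yes _  = ≡.refl
      ... | no j≢j = contradiction ≡.refl j≢j
      off : ∀ i → i ≢ j → quotientBy (yes (j , div)) i ≡ nothing
      off i i≢j with j Fin.≟ i
      ... | yes j≡i = contradiction (≡.sym j≡i) i≢j
      ... | no _    = ≡.refl

    divides? : ∀ u → Dec (∃ λ j → g j ∣ₑ u)
    divides? u = Fin.any? (λ j → g j ∣ₑ? u)

  abstract
    -- Each xᵘ in the ideal generated by the x^(g i) is divided by the first generator
    -- dividing it; quotientAt i u is the quotient if that generator is the i-th.
    quotientAt : Fin m → Exponent n → Maybe (Exponent n)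
    quotientAt i u = quotientBy (divides? u) i

    quotientAt-just : ∀ i u {e} → quotientAt i u ≡ just e → u ≡ g i ⊕ e
    quotientAt-just i u = quotientBy-just (divides? u) i

    -- A monomial of the ideal is assigned to exactly one generator, so `section` turns a term into
    -- a single term.
    quotientAt-index : ∀ u → ∃ (λ i → g i ∣ₑ u) →
      ∃₂ λ j e → quotientAt j u ≡ just e × (∀ i → i ≢ j → quotientAt i u ≡ nothing)
    quotientAt-index u = quotientBy-index (divides? u)

-- Dual bases

module DualBasis {r ℓr m ℓm} {R : CommutativeRing r ℓr} (M : Module R m ℓm) where
  open CommutativeRing R hiding (zero)
  private module M = ModuleProperties M

  module _ (f : Hom M (⟨module⟩ {R = R})) where
    private module f = Hom f

    hom-combination-0 : ∀ {k} c (v : Fin k → M.Carrierᴹ) → (∀ i → ⟦ f ⟧ (v i) ≈ 0#) →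
                        ⟦ f ⟧ (combination M c v) ≈ 0#
    hom-combination-0 {zero}  c v v≈0 = f.0ᴹ-homo
    hom-combination-0 {suc k} c v v≈0 = trans (f.+ᴹ-homo _ _)
      (trans (+-cong (trans (f.*ₗ-homo _ _) (trans (*-congˡ (v≈0 zero)) (zeroʳ _)))
                     (hom-combination-0 (c ∘ suc) (v ∘ suc) (v≈0 ∘ suc)))
      (+-identityˡ 0#))

    hom-combination : ∀ {k} c (v : Fin k → M.Carrierᴹ) j → (∀ i → i ≢ j → ⟦ f ⟧ (v i) ≈ 0#) →
                      ⟦ f ⟧ (combination M c v) ≈ c j * ⟦ f ⟧ (v j)
    hom-combination {suc k} c v zero off = trans (f.+ᴹ-homo _ _)
      (trans (+-cong (f.*ₗ-homo _ _) (hom-combination-0 (c ∘ suc) (v ∘ suc) λ i → off (suc i) λ ()))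
      (+-identityʳ _))
    hom-combination {suc k} c v (suc j) off = trans (f.+ᴹ-homo _ _)
      (trans (+-cong (trans (f.*ₗ-homo _ _) (trans (*-congˡ (off zero λ ())) (zeroʳ _)))
        (hom-combination (c ∘ suc) (v ∘ suc) j λ i i≢j → off (suc i) (i≢j ∘ Fin.suc-injective)))
      (+-identityˡ _))

  -- The δ i take equal values on x and on the sum of the (δ i)(x) v i, so separation makes these
  -- two equal; applying δ i to a relation gives independence.
  dual-basis : ∀ {k} (v : Fin k → M.Carrierᴹ) (δ : Fin k → Hom M (⟨module⟩ {R = R})) →
    (∀ i → ⟦ δ i ⟧ (v i) ≈ 1#) → (∀ i j → j ≢ i → ⟦ δ i ⟧ (v j) ≈ 0#) →
    (∀ x → (∀ i → ⟦ δ i ⟧ x ≈ 0#) → x M.≈ᴹ M.0ᴹ) → IsBasis M v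
  dual-basis v δ δv≈1 δv≈0 separating = record
    { spanning = λ x → (λ i → ⟦ δ i ⟧ x) , M.x∙y⁻¹≈ε⇒x≈y _ _ (separating _ λ i →
        trans (Hom.+ᴹ-homo (δ i) _ _) (trans (+-cong (δ-combination _ i) (Hom.-ᴹ-homo (δ i) x)) (-‿inverseʳ _)))
    ; independent = λ c c≈0 i → trans (sym (δ-combination c i))
        (trans (Hom.⟦⟧-cong (δ i) c≈0) (Hom.0ᴹ-homo (δ i))) }
    where
    δ-combination : ∀ c i → ⟦ δ i ⟧ (combination M c v) ≈ c i
    δ-combination c i = trans (hom-combination (δ i) c v i (δv≈0 i))
      (trans (*-congˡ (δv≈1 i)) (*-identityʳ _))

-- For n ≤ 3 at most one vertex lies outside a pair, so there are no two constant terms to compare.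
third-unique : ∀ {n} → n ≤ 3 → {p q r s : Fin n} → p ≢ q → p ≢ r → q ≢ r → p ≢ s → q ≢ s → r ≡ s
third-unique {suc zero} _ {zero} {zero} p≢q = contradiction ≡.refl p≢q
third-unique {suc (suc m)} (s≤s (s≤s m≤1)) p≢q p≢r q≢r p≢s q≢s
  with others-surjective p≢q p≢r q≢r | others-surjective p≢q p≢s q≢s
... | x , x≡ | y , y≡ = ≡.trans (≡.sym x≡) (≡.trans (≡.cong (others p≢q) (one m≤1 x y)) y≡)
  where
  one : ∀ {m} → m ≤ 1 → (x y : Fin m) → x ≡ y
  one (s≤s z≤n) zero zero = ≡.refl

module PointComplex {r ℓr} (K : CommutativeRing r ℓr) {n} (Δ : SimplicialComplex n)
  (zeroDim : IsZeroDimensional Δ) (noLoops : NoLoops Δ) where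

  open CommutativeRing K hiding (zero)
  open Polynomials K n
  open PolynomialCoefficients K n
  open Points Δ zeroDim noLoops
  open StanleyReisner K Δ renaming (T² to T²Δ; T²-component to component)
  open Division genExponent
  open import Algebra.Properties.AbelianGroup +-abelianGroup using (ε⁻¹≈ε; x∙y⁻¹≈ε⇒x≈y)
  private
    module K   = ModuleProperties (⟨module⟩ {R = K})
    module S   = CommutativeRing polynomialRing
    module Sᵐ  = ModuleProperties Sᵐ
    module d   = Hom d
    module Syz = ModuleProperties Syz
    module H   = ModuleProperties Hom-Syz/Kosz
    module T²  = Module T²Δ
  open import Algebra.Properties.Ring S.ring using (-‿distribʳ-*)

  -- The Stanley-Reisner ideal and its quotient

  -- Vanishing on an axis defines an ideal, and it contains the generators because each is divisible
  -- by a pair.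
  ideal⇒axis : ∀ {p} → Mem ideal p → ∀ i → p ∼[ i ] 0ₚ
  ideal⇒axis {p} p∈ i = span-least ⟨module⟩ _ vanishing onGenerators p∈
    where
    vanishing : Ideal polynomialRing ℓr
    vanishing = record
      { Mem = λ p → p ∼[ i ] 0ₚ
      ; resp = λ p≈q p∼ t → trans (sym (coeff-≈ p≈q _)) (p∼ t)
      ; 0-mem = λ _ → refl
      ; +-mem = λ {p} {q} p∼ q∼ t → trans (coeff-+ p q _)
          (trans (+-cong (p∼ t) (q∼ t)) (+-identityˡ 0#))
      ; *-mem = λ a {p} p∼ t → trans (*ₚ-axis-congˡ a {p} {0ₚ} p∼ t) (coeff-≈ (*ₚ-zeroʳ a) _) }
    onGenerators : ∀ {p} → (∃ λ F → ¬ SimplicialComplex.Face Δ F × p S.≈ monomial (indicator F)) →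
                   p ∼[ i ] 0ₚ
    onGenerators {p} (F , F∉ , p≈) t = trans (coeff-≈ p≈ (pure i t)) (coeff-∷-≢ 1# (indicator F) [] λ eq →
      let p , q , p≢q , div = pair-∣ₑ-nonfaceExponent (∈-map⁺ indicator
            (∈-filter⁺ (¬? ∘ SimplicialComplex.face? Δ) (∈-allSubsets F) F∉))
      in pair-∤-pure p≢q i t (≡.subst (pair p q ∣ₑ_) eq div))

  monomial∈ideal : ∀ {p q e} c → p ≢ q → pair p q ∣ₑ e → Mem ideal ((c , e) ∷ [])
  monomial∈ideal {p} {q} c p≢q div with ∣ₑ⇒⊕ div
  ... | f , ≡.refl = Submodule.resp ideal
        {((c , f) ∷ []) *ₚ monomial (pair p q)}
        (term≈ (*-identityʳ c) (⊕-comm f (pair p q)) S.refl)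
        (Submodule.*-mem ideal ((c , f) ∷ []) {monomial (pair p q)}
          (gen (_ , (λ face → ℕ.<⇒≱ (two-elements⇒1<∣∣ p≢q (proj₁ (pair∈ p q)) (proj₂ (pair∈ p q)))
                       (proj₁ zeroDim _ face))
                 , S.reflexive (≡.cong monomial (≡.sym (indicator-pair p≢q))))))
    where
    pair∈ : ∀ p q → p Subset.∈ ⁅ p ⁆ ∪ ⁅ q ⁆ × q Subset.∈ ⁅ p ⁆ ∪ ⁅ q ⁆
    pair∈ p q = Subset.x∈p∪q⁺ (inj₁ (Subset.x∈⁅x⁆ p)) , Subset.x∈p∪q⁺ (inj₂ (Subset.x∈⁅x⁆ q))

  -- Terms at pure powers are deleted together: single ones may be nonzero, but their total at each
  -- exponent is 0. The terms that remain are in the ideal one by one.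
  axis⇒ideal : ∀ {p} → (∀ i → p ∼[ i ] 0ₚ) → Mem ideal p
  axis⇒ideal {p} p∼ = Submodule.resp ideal {reindex (nonpure origin) p} {p} (mk≈ same) (mixed∈ p)
    where
    same : ∀ e → coeff (reindex (nonpure origin) p) e ≈ coeff p e
    same e with pure-or-pair origin e in eq
    ... | inj₁ (i , t , ≡.refl) = trans (coeff-reindex-∉ (nonpure origin) miss p) (sym (p∼ i t))
      where
      miss : ∀ x → nonpure origin x ≢ just (pure i t)
      miss x nx with pure-or-pair origin x in eq′
      miss x ≡.refl | inj₂ _ = contradiction (≡.trans (≡.sym eq) eq′) λ ()
      miss x () | inj₁ _
    ... | inj₂ _ = coeff-reindex (nonpure origin) hit unique p
      where
      hit : nonpure origin e ≡ just e
      hit rewrite eq = ≡.refl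
      unique : ∀ x → nonpure origin x ≡ just e → x ≡ e
      unique x nx with pure-or-pair origin x
      unique x ≡.refl | inj₂ _ = ≡.refl
      unique x () | inj₁ _

    mixed∈ : ∀ p → Mem ideal (reindex (nonpure origin) p)
    mixed∈ [] = zero
    mixed∈ ((c , e) ∷ p) with pure-or-pair origin e
    ... | inj₁ _ = mixed∈ p
    ... | inj₂ (_ , _ , p≢q , div) = plus (monomial∈ideal c p≢q div) (mixed∈ p)

  -- Equality in S/I: the pure powers are a basis of S/I.
  infix 4 _≋_
  record _≋_ (p q : Poly) : Set ℓr where
    constructor mk≋
    field on-axis : ∀ i → p ∼[ i ] q
  open _≋_ public

  ≋⇒ideal : ∀ {p q} → p ≋ q → Mem ideal (p S.- q)
  ≋⇒ideal {p} {q} p≋q = axis⇒ideal λ i t → trans (coeff-minus p q _)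
    (trans (+-congʳ (on-axis p≋q i t)) (-‿inverseʳ _))

  ideal⇒≋ : ∀ {p q} → Mem ideal (p S.- q) → p ≋ q
  ideal⇒≋ {p} {q} p-q∈ = mk≋ λ i t →
    x∙y⁻¹≈ε⇒x≈y _ _ (trans (sym (coeff-minus p q _)) (ideal⇒axis p-q∈ i t))

  ≋⇒-≋0 : ∀ p q → p ≋ q → (p +ₚ (-ₚ q)) ≋ 0ₚ
  ≋⇒-≋0 p q p≋q = mk≋ (ideal⇒axis (≋⇒ideal p≋q))

  -≋0⇒≋ : ∀ p q → (p +ₚ (-ₚ q)) ≋ 0ₚ → p ≋ q
  -≋0⇒≋ p q p-q≋0 = ideal⇒≋ (axis⇒ideal (on-axis p-q≋0))

  ≋-refl : ∀ {p} → p ≋ p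
  ≋-refl = mk≋ λ _ _ → refl

  ≋-sym : ∀ {p q} → p ≋ q → q ≋ p
  ≋-sym p≋q = mk≋ λ i t → sym (on-axis p≋q i t)

  ≋-trans : ∀ {p q s} → p ≋ q → q ≋ s → p ≋ s
  ≋-trans p≋q q≋s = mk≋ λ i t → trans (on-axis p≋q i t) (on-axis q≋s i t)

  ≈⇒≋ : ∀ {p q} → p ≈ₚ q → p ≋ q
  ≈⇒≋ p≈q = mk≋ λ i t → coeff-≈ p≈q _

  +-≋ : ∀ {p p′ q q′} → p ≋ p′ → q ≋ q′ → (p +ₚ q) ≋ (p′ +ₚ q′)
  +-≋ {p} {p′} {q} {q′} p≋ q≋ = mk≋ λ i t → trans (coeff-+ p q _)
    (trans (+-cong (on-axis p≋ i t) (on-axis q≋ i t)) (sym (coeff-+ p′ q′ _)))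

  neg-≋ : ∀ {p q} → p ≋ q → (-ₚ p) ≋ (-ₚ q)
  neg-≋ {p} {q} p≋q = mk≋ λ i t → trans (coeff-neg p _)
    (trans (-‿cong (on-axis p≋q i t)) (sym (coeff-neg q _)))

  *-≋ : ∀ a {p q} → p ≋ q → (a *ₚ p) ≋ (a *ₚ q)
  *-≋ a {p} {q} p≋q = mk≋ λ i → *ₚ-axis-congˡ a {p} {q} (on-axis p≋q i)

  *-≋0 : ∀ a {p} → p ≋ 0ₚ → (a *ₚ p) ≋ 0ₚ
  *-≋0 a p≋0 = ≋-trans (*-≋ a p≋0) (≈⇒≋ (*ₚ-zeroʳ a))

  ideal⇒≋0 : ∀ {p} → Mem ideal p → p ≋ 0ₚ
  ideal⇒≋0 p∈ = mk≋ (ideal⇒axis p∈)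

  -- Syzygies

  Syzygy : Set _
  Syzygy = Module.Carrierᴹ Syz

  coeff-sum : ∀ {k} (v : Fin k → Poly) j {u} → (∀ i → i ≢ j → coeff (v i) u ≈ 0#) →
              coeff (ModuleProperties.sum (⟨module⟩ {R = polynomialRing}) v) u ≈ coeff (v j) u
  coeff-sum {suc k} v zero {u} off = trans (coeff-+ (v zero) _ u)
    (trans (+-congˡ (zeros (v ∘ suc) λ i → off (suc i) λ ())) (+-identityʳ _))
    where
    zeros : ∀ {k} (v : Fin k → Poly) → (∀ i → coeff (v i) u ≈ 0#) →
            coeff (ModuleProperties.sum (⟨module⟩ {R = polynomialRing}) v) u ≈ 0#
    zeros {zero}  v v≈0 = refl
    zeros {suc k} v v≈0 = trans (coeff-+ (v zero) _ u)
      (trans (+-cong (v≈0 zero) (zeros (v ∘ suc) (v≈0 ∘ suc))) (+-identityˡ 0#))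
  coeff-sum {suc k} v (suc j) {u} off = trans (coeff-+ (v zero) _ u)
    (trans (+-cong (off zero λ ()) (coeff-sum (v ∘ suc) j λ i i≢j → off (suc i) (i≢j ∘ Fin.suc-injective)))
    (+-identityˡ _))

  edge-cong : ∀ {p q p′ q′} (p≢q : p ≢ q) (p′≢q′ : p′ ≢ q′) → pair p q ≡ pair p′ q′ →
              edge p≢q ≡ edge p′≢q′
  edge-cong p≢q p′≢q′ eq = exponent-injective
    (≡.trans (exponent-edge p≢q) (≡.trans eq (≡.sym (exponent-edge p′≢q′))))

  pair-cong : ∀ {p q r s : Fin n} → (r ≡ p × s ≡ q) ⊎ (r ≡ q × s ≡ p) → pair r s ≡ pair p q
  pair-cong (inj₁ (≡.refl , ≡.refl)) = ≡.refl
  pair-cong {r = r} {s} (inj₂ (≡.refl , ≡.refl)) = pair-comm r s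

  exponent-∣ₑ-pair : ∀ {p q} (p≢q : p ≢ q) {i} → genExponent i ∣ₑ pair p q → i ≡ edge p≢q
  exponent-∣ₑ-pair {p} {q} p≢q {i} = go (exponent-pair i)
    where
    go : (∃₂ λ r s → Σ (r ≢ s) λ r≢s → i ≡ edge r≢s) → genExponent i ∣ₑ pair p q → i ≡ edge p≢q
    go (r , s , r≢s , i≡) div = ≡.trans i≡ (edge-cong r≢s p≢q (pair-cong (pair-∣ₑ-pair r≢s
      (≡.subst (_∣ₑ pair p q) (≡.trans (≡.cong genExponent i≡) (exponent-edge r≢s)) div))))

  coeff-*-generator : ∀ p i e → coeff (p *ₚ generator i) (genExponent i ⊕ e) ≈ coeff p e
  coeff-*-generator p i e = trans (coeff-≈ (*ₚ-comm p (generator i)) _)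
    (coeff-monomial-* (genExponent i) p ≡.refl)

  coeff-*-generator-∤ : ∀ p i {u} → ¬ (genExponent i ∣ₑ u) → coeff (p *ₚ generator i) u ≈ 0#
  coeff-*-generator-∤ p i ∤ = trans (coeff-≈ (*ₚ-comm p (generator i)) _)
    (coeff-monomial-*-∤ (genExponent i) p ∤)

  -- Among the generators only x_p x_q divides x_p x_q, so the coefficient of this monomial in `d s`
  -- is the constant term in question.
  syzygy-constant : ∀ {p q} (p≢q : p ≢ q) (s : Syzygy) → coeff (proj₁ s (edge p≢q)) 0ₑ ≈ 0#
  syzygy-constant {p} {q} p≢q (s , ds≈0) = trans (sym (coeff-*-generator (s j) j 0ₑ))
    (trans (reflexive (≡.cong (coeff (s j *ₚ generator j)) u≡))
    (trans (sym (coeff-sum (λ i → s i *ₚ generator i) j λ i i≢j →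
             coeff-*-generator-∤ (s i) i λ div → i≢j (exponent-∣ₑ-pair p≢q div)))
    (coeff-≈ ds≈0 (pair p q))))
    where
    j = edge p≢q
    u≡ : genExponent j ⊕ 0ₑ ≡ pair p q
    u≡ = ≡.trans (⊕-comm _ 0ₑ) (≡.trans (⊕-identityˡ _) (exponent-edge p≢q))

  basis : Fin numGens → Fin numGens → Poly
  basis = unitVector {R = polynomialRing}

  basis-diagonal : ∀ i → basis i i S.≈ S.1#
  basis-diagonal i = go (i Fin.≟ i)
    where
    go : (i≟i : Dec (i ≡ i)) → (if does i≟i then S.1# else S.0#) S.≈ S.1#
    go (yes _)  = S.refl
    go (no i≢i) = contradiction ≡.refl i≢i

  coeff-unit : ∀ i j {e} → i ≢ j → coeff (basis i j) e ≈ 0#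
  coeff-unit i j i≢j with i Fin.≟ j
  ... | yes i≡j = contradiction i≡j i≢j
  ... | no _    = refl

  d-basis : ∀ p i → ⟦ d ⟧ (p Sᵐ.*ₗ basis i) S.≈ p *ₚ generator i
  d-basis p i = S.trans (d.*ₗ-homo p (basis i))
    (S.*-congˡ {p} (linearMap-unitVector (⟨module⟩ {R = polynomialRing}) generator i))

  module _ (e : Exponent n) (i : Fin numGens) (f : Exponent n) (j : Fin numGens) where

    binomial : Fin numGens → Poly
    binomial = (monomial e Sᵐ.*ₗ basis i) Sᵐ.+ᴹ (Sᵐ.-ᴹ (monomial f Sᵐ.*ₗ basis j))

    binomial-syzygy : e ⊕ genExponent i ≡ f ⊕ genExponent j → ⟦ d ⟧ binomial S.≈ S.0#
    binomial-syzygy eq =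
      S.trans (d.+ᴹ-homo (monomial e Sᵐ.*ₗ basis i) (Sᵐ.-ᴹ (monomial f Sᵐ.*ₗ basis j)))
      (S.trans (S.+-cong (d-basis (monomial e) i)
        (S.trans (d.-ᴹ-homo (monomial f Sᵐ.*ₗ basis j)) (S.-‿cong (d-basis (monomial f) j))))
      (S.trans (S.+-congʳ {S.- (monomial f *ₚ generator j)}
        (S.reflexive (≡.cong (λ u → (1# * 1# , u) ∷ []) eq)))
      (S.-‿inverseʳ (monomial f *ₚ generator j))))

  relation-exponent : ∀ {p q r} (p≢q : p ≢ q) (p≢r : p ≢ r) →
    pure r 1 ⊕ genExponent (edge p≢q) ≡ pure q 1 ⊕ genExponent (edge p≢r)
  relation-exponent {p} {q} {r} p≢q p≢r rewrite exponent-edge p≢q | exponent-edge p≢r =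
    ≡.trans (⊕-comm (pure r 1) (pair p q))
    (≡.trans (≡.cong (_⊕ pure r 1) (⊕-comm (pure p 1) (pure q 1)))
    (⊕-assoc (pure q 1) (pure p 1) (pure r 1)))

  -- The relation xᵣ e_pq = x_q e_pr.
  relation : ∀ {p q r} → p ≢ q → p ≢ r → Syzygy
  relation {p} {q} {r} p≢q p≢r =
    binomial (pure r 1) (edge p≢q) (pure q 1) (edge p≢r) ,
    binomial-syzygy _ _ _ _ (relation-exponent p≢q p≢r)

  -- Homomorphisms from Syz/Kosz to S/I

  Functional : Set _
  Functional = Hom Syz/Kosz (⟨module⟩ {R = S/I})

  infix 4 _≈ˢ_ _≈ᴷ_
  -- The right side is a bare vector, so a syzygy can be compared with a binomial before the latter
  -- is known to be one.
  _≈ˢ_ : Syzygy → (Fin numGens → Poly) → Set _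
  s ≈ˢ f = ∀ i → proj₁ s i ≈ₚ f i

  _≈ᴷ_ : Syzygy → Syzygy → Set _
  s ≈ᴷ t = Mem Kosz (s Syz.+ᴹ (Syz.-ᴹ t))

  binomial-cong : ∀ {e e′ i i′ f f′ j j′} → e ≡ e′ → f ≡ f′ → i ≡ i′ → j ≡ j′ →
                  ∀ k → binomial e i f j k S.≈ binomial e′ i′ f′ j′ k
  binomial-cong ≡.refl ≡.refl ≡.refl ≡.refl k = S.refl

  monomial-* : ∀ c e p → (monomial c *ₚ (monomial e *ₚ p)) S.≈ (monomial (c ⊕ e) *ₚ p)
  monomial-* c e p = S.trans (S.sym (S.*-assoc (monomial c) (monomial e) p))
    (S.*-congʳ {p} {monomial c *ₚ monomial e} {monomial (c ⊕ e)} (term≈ (*-identityˡ 1#) ≡.refl (S.refl {0ₚ})))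

  scale-binomial : ∀ c e i f j k →
    (monomial c *ₚ binomial e i f j k) S.≈ binomial (c ⊕ e) i (c ⊕ f) j k
  scale-binomial c e i f j k = S.trans
    (S.distribˡ (monomial c) (monomial e *ₚ basis i k) (-ₚ (monomial f *ₚ basis j k)))
    (S.+-cong (monomial-* c e (basis i k))
      (S.trans (S.sym (-‿distribʳ-* (monomial c) (monomial f *ₚ basis j k)))
               (S.-‿cong (monomial-* c f (basis j k)))))

  koszul≈binomial : ∀ i j → koszulRelation (basis j) (basis i) ≈ˢ
                            binomial (genExponent j) i (genExponent i) j
  koszul≈binomial i j k = S.+-cong
    (S.*-congʳ {basis i k} (linearMap-unitVector (⟨module⟩ {R = polynomialRing}) generator j))
    (S.-‿cong (S.*-congʳ {basis j k}
      (linearMap-unitVector (⟨module⟩ {R = polynomialRing}) generator i)))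

  module _ (φ : Functional) where
    private module φ = Hom φ

    hom-≈ᴷ : ∀ s t → s ≈ᴷ t → ⟦ φ ⟧ s ≋ ⟦ φ ⟧ t
    hom-≈ᴷ s t s≈t = ideal⇒≋ (φ.⟦⟧-cong {s} {t} s≈t)

    hom-≈ : ∀ s t → s ≈ˢ proj₁ t → ⟦ φ ⟧ s ≋ ⟦ φ ⟧ t
    hom-≈ s t s≈t = hom-≈ᴷ s t (≈⇒~ Syz Kosz {s} {t} s≈t)

    hom-+ : ∀ s t → ⟦ φ ⟧ (s Syz.+ᴹ t) ≋ (⟦ φ ⟧ s +ₚ ⟦ φ ⟧ t)
    hom-+ s t = ideal⇒≋ (φ.+ᴹ-homo s t)

    hom-neg : ∀ s → ⟦ φ ⟧ (Syz.-ᴹ s) ≋ (-ₚ ⟦ φ ⟧ s)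
    hom-neg s = ideal⇒≋ (φ.-ᴹ-homo s)

    hom-* : ∀ a s → ⟦ φ ⟧ (a Syz.*ₗ s) ≋ (a *ₚ ⟦ φ ⟧ s)
    hom-* a s = ideal⇒≋ (φ.*ₗ-homo a s)

    hom-0 : ⟦ φ ⟧ Syz.0ᴹ ≋ 0ₚ
    hom-0 = ideal⇒≋ φ.0ᴹ-homo

    hom-Kosz : ∀ f g → ⟦ φ ⟧ (koszulRelation f g) ≋ 0ₚ
    hom-Kosz f g = ≋-trans (hom-≈ᴷ (koszulRelation f g) Syz.0ᴹ (Submodule.resp Kosz
      {koszulRelation f g} {koszulRelation f g Syz.+ᴹ (Syz.-ᴹ Syz.0ᴹ)}
      (Syz.≈ᴹ-sym {koszulRelation f g Syz.+ᴹ (Syz.-ᴹ Syz.0ᴹ)} {koszulRelation f g}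
        (Syz.diff-0 (koszulRelation f g)))
      (gen (f , g , λ i → S.refl)))) hom-0

  -- Binomial syzygies as multiples of linear and Koszul relations

  module Generation (φ : Functional)
    (vanishes : ∀ {p q r} (p≢q : p ≢ q) (p≢r : p ≢ r) → q ≢ r → ⟦ φ ⟧ (relation p≢q p≢r) ≋ 0ₚ) where

    hom-scaled : ∀ s t c {e i f j} → s ≈ˢ binomial (c ⊕ e) i (c ⊕ f) j → t ≈ˢ binomial e i f j →
                 ⟦ φ ⟧ t ≋ 0ₚ → ⟦ φ ⟧ s ≋ 0ₚ
    hom-scaled s t c {e} {i} {f} {j} s≈ t≈ φt≋0 =
      ≋-trans (hom-≈ φ s (monomial c Syz.*ₗ t) λ k → S.trans (s≈ k)
        (S.sym (S.trans (S.*-congˡ {monomial c} (t≈ k)) (scale-binomial c e i f j k))))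
      (≋-trans (hom-* φ (monomial c) t) (*-≋0 (monomial c) φt≋0))

    module _ (s : Syzygy) {e f : Exponent n} {i j : Fin numGens}
             (s≈ : s ≈ˢ binomial e i f j) (eq : e ⊕ genExponent i ≡ f ⊕ genExponent j) where

      eq-pairs : ∀ {p q r t} (p≢q : p ≢ q) (r≢t : r ≢ t) → i ≡ edge p≢q → j ≡ edge r≢t →
                 e ⊕ pair p q ≡ f ⊕ pair r t
      eq-pairs p≢q r≢t i≡ j≡ = ≡.trans
        (≡.cong (e ⊕_) (≡.sym (≡.trans (≡.cong genExponent i≡) (exponent-edge p≢q))))
        (≡.trans eq (≡.cong (f ⊕_) (≡.trans (≡.cong genExponent j≡) (exponent-edge r≢t))))

      same-edge : i ≡ j → ⟦ φ ⟧ s ≋ 0ₚ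
      same-edge ≡.refl = ≋-trans (hom-≈ φ s Syz.0ᴹ λ k → S.trans (s≈ k)
        (S.trans (binomial-cong {i = i} {i} {j = i} {i} e≡f ≡.refl ≡.refl ≡.refl k) (S.-‿inverseʳ (monomial f *ₚ basis i k)))) (hom-0 φ)
        where
        e≡f : e ≡ f
        e≡f = ⊕-cancelˡ (genExponent i) (≡.trans (⊕-comm _ e) (≡.trans eq (⊕-comm f _)))

      share-vertex : ∀ {p q r} (p≢q : p ≢ q) (p≢r : p ≢ r) → i ≡ edge p≢q → j ≡ edge p≢r →
                     ⟦ φ ⟧ s ≋ 0ₚ
      share-vertex {p} {q} {r} p≢q p≢r i≡ j≡ = go (q Fin.≟ r)
        where
        scaled : q ≢ r → (∃ λ c → e ≡ c ⊕ pure r 1 × f ≡ c ⊕ pure q 1) → ⟦ φ ⟧ s ≋ 0ₚ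
        scaled q≢r (c , e≡ , f≡) = hom-scaled s (relation p≢q p≢r) c
          {pure r 1} {edge p≢q} {pure q 1} {edge p≢r}
          (λ k → S.trans (s≈ k) (binomial-cong {i′ = edge p≢q} {j′ = edge p≢r} e≡ f≡ i≡ j≡ k))
          (λ k → S.refl) (vanishes p≢q p≢r q≢r)
        go : Dec (q ≡ r) → ⟦ φ ⟧ s ≋ 0ₚ
        go (yes q≡r) = same-edge (≡.trans i≡ (≡.trans (edge-cong p≢q p≢r (≡.cong (pair p) q≡r)) (≡.sym j≡)))
        go (no q≢r)  = scaled q≢r (common-vertex {e = e} {f} q≢r (eq-pairs p≢q p≢r i≡ j≡))

      disjoint : ∀ {p q r t} (p≢q : p ≢ q) (r≢t : r ≢ t) → r ≢ p → r ≢ q → t ≢ p → t ≢ q →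
                 i ≡ edge p≢q → j ≡ edge r≢t → ⟦ φ ⟧ s ≋ 0ₚ
      disjoint {p} {q} {r} {t} p≢q r≢t r≢p r≢q t≢p t≢q i≡ j≡ =
        scaled (disjoint-edges {e = e} {f} r≢t r≢p r≢q t≢p t≢q (eq-pairs p≢q r≢t i≡ j≡))
        where
        scaled : (∃ λ c → e ≡ c ⊕ pair r t × f ≡ c ⊕ pair p q) → ⟦ φ ⟧ s ≋ 0ₚ
        scaled (c , e≡ , f≡) = hom-scaled s (koszulRelation (basis j) (basis i)) c
          {genExponent j} {i} {genExponent i} {j}
          (λ k → S.trans (s≈ k) (binomial-cong {i = i} {i} {j = j} {j}
            (≡.trans e≡ (≡.cong (c ⊕_) (≡.sym (≡.trans (≡.cong genExponent j≡) (exponent-edge r≢t)))))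
            (≡.trans f≡ (≡.cong (c ⊕_) (≡.sym (≡.trans (≡.cong genExponent i≡) (exponent-edge p≢q)))))
            ≡.refl ≡.refl k))
          (koszul≈binomial i j) (hom-Kosz φ (basis j) (basis i))

      -- Two edges coincide, share one vertex, or are disjoint: the binomial is then zero, a
      -- multiple of a linear relation, or a multiple of a Koszul relation.
      hom-binomial : ⟦ φ ⟧ s ≋ 0ₚ
      hom-binomial = go (exponent-pair i) (exponent-pair j)
        where
        swap : ∀ {k p q} (p≢q : p ≢ q) → k ≡ edge p≢q → k ≡ edge (p≢q ∘ ≡.sym)
        swap {p = p} {q} p≢q k≡ = ≡.trans k≡ (edge-cong p≢q _ (pair-comm p q))

        cases : ∀ {p q r t} (p≢q : p ≢ q) (r≢t : r ≢ t) → i ≡ edge p≢q → j ≡ edge r≢t →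
                Dec (r ≡ p) → Dec (r ≡ q) → Dec (t ≡ p) → Dec (t ≡ q) → ⟦ φ ⟧ s ≋ 0ₚ
        cases p≢q r≢t i≡ j≡ (yes ≡.refl) _ _ _ = share-vertex p≢q r≢t i≡ j≡
        -- Here and below, edges are reversed so that the common vertex comes first.
        cases p≢q r≢t i≡ j≡ (no _) (yes ≡.refl) _ _ = share-vertex (p≢q ∘ ≡.sym) r≢t (swap p≢q i≡) j≡
        cases p≢q r≢t i≡ j≡ (no _) (no _) (yes ≡.refl) _ = share-vertex p≢q (r≢t ∘ ≡.sym) i≡ (swap r≢t j≡)
        cases p≢q r≢t i≡ j≡ (no _) (no _) (no _) (yes ≡.refl) =
          share-vertex (p≢q ∘ ≡.sym) (r≢t ∘ ≡.sym) (swap p≢q i≡) (swap r≢t j≡)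
        cases p≢q r≢t i≡ j≡ (no r≢p) (no r≢q) (no t≢p) (no t≢q) =
          disjoint p≢q r≢t r≢p r≢q t≢p t≢q i≡ j≡

        go : (∃₂ λ p q → Σ (p ≢ q) λ p≢q → i ≡ edge p≢q) →
             (∃₂ λ r t → Σ (r ≢ t) λ r≢t → j ≡ edge r≢t) → ⟦ φ ⟧ s ≋ 0ₚ
        go (p , q , p≢q , i≡) (r , t , r≢t , j≡) =
          cases p≢q r≢t i≡ j≡ (r Fin.≟ p) (r Fin.≟ q) (t Fin.≟ p) (t Fin.≟ q)

  -- A K-linear section of d : Sᵐ → I.  A syzygy s equals s - section (d s), which term by
  -- term is a combination of binomial syzygies.
  section : Poly → Fin numGens → Poly
  section p i = reindex (quotientAt i) p

  -- `section` acts on lists of terms, so independence of the representation has to be shown: the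
  -- coefficient of x^e in entry i is that of x^(g_i + e) when this monomial is assigned to i, and 0
  -- otherwise.
  section-cong : ∀ {p q} → p ≈ₚ q → ∀ i → section p i ≈ₚ section q i
  section-cong {p} {q} p≈q i = mk≈ λ e → go e (quotientAt i (genExponent i ⊕ e)) ≡.refl
    where
    unique : ∀ e x → quotientAt i x ≡ just e → x ≡ genExponent i ⊕ e
    unique e x = quotientAt-just i x
    go : ∀ e w → quotientAt i (genExponent i ⊕ e) ≡ w → coeff (section p i) e ≈ coeff (section q i) e
    go e (just e′) eq = trans (coeff-reindex (quotientAt i) eq′ (unique e) p)
      (trans (coeff-≈ p≈q _) (sym (coeff-reindex (quotientAt i) eq′ (unique e) q)))
      where
      eq′ : quotientAt i (genExponent i ⊕ e) ≡ just e
      eq′ = ≡.trans eq (≡.cong just (≡.sym (⊕-cancelˡ (genExponent i) (quotientAt-just i _ eq))))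
    go e nothing eq = trans (coeff-reindex-∉ (quotientAt i) miss p) (sym (coeff-reindex-∉ (quotientAt i) miss q))
      where
      miss : ∀ x → quotientAt i x ≢ just e
      miss x eq′ = contradiction (≡.trans (≡.sym eq)
        (≡.trans (≡.cong (quotientAt i) (≡.sym (unique e x eq′))) eq′)) λ ()

  section-term : ∀ {e i j f} c → quotientAt j (e ⊕ genExponent i) ≡ just f →
    (∀ k → k ≢ j → quotientAt k (e ⊕ genExponent i) ≡ nothing) →
    ∀ k → section ((c , e ⊕ genExponent i) ∷ []) k ≈ₚ (((c , f) ∷ []) *ₚ basis j k)
  section-term {e} {i} {j} {f} c at-j off k = go (j Fin.≟ k)
    where
    go : (j≟k : Dec (j ≡ k)) → section ((c , e ⊕ genExponent i) ∷ []) k ≈ₚ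
         (((c , f) ∷ []) *ₚ (if does j≟k then S.1# else S.0#))
    go (yes ≡.refl) rewrite at-j = term≈ (sym (*-identityʳ c))
      (≡.trans (≡.sym (⊕-identityˡ f)) (⊕-comm 0ₑ f)) S.refl
    go (no j≢k) rewrite off k (j≢k ∘ ≡.sym) = S.refl

  module _ (φ : Functional)
    (vanishes : ∀ {p q r} (p≢q : p ≢ q) (p≢r : p ≢ r) → q ≢ r → ⟦ φ ⟧ (relation p≢q p≢r) ≋ 0ₚ) where
    open Generation φ vanishes

    private
      -- Says that φ kills the syzygy f - section (d f). It is formulated for every f in Sᵐ, because
      -- the single terms of a syzygy are not syzygies and the induction runs over terms.
      record Reducible (f : Fin numGens → Poly) : Set (r ⊔ ℓr) where
        constructor reduced
        field
          syzygy : Syzygy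
          φ≋0    : ⟦ φ ⟧ syzygy ≋ 0ₚ
          eq     : ∀ i → (f i) S.≈ (proj₁ syzygy i +ₚ section (⟦ d ⟧ f) i)

      reducible-cong : ∀ {f g} → (∀ i → f i S.≈ g i) → Reducible f → Reducible g
      reducible-cong {f} {g} f≈g (reduced z φz≋0 eq) = reduced z φz≋0 λ i →
        S.trans (S.sym (f≈g i)) (S.trans (eq i)
        (S.+-congˡ {proj₁ z i} (section-cong (d.⟦⟧-cong {f} {g} f≈g) i)))

      reducible-0 : Reducible (λ _ → 0ₚ)
      reducible-0 = reduced Syz.0ᴹ (hom-0 φ) λ i → S.sym (section-cong d.0ᴹ-homo i)

      reducible-+ : ∀ {f g} → Reducible f → Reducible g → Reducible (f Sᵐ.+ᴹ g)
      reducible-+ {f} {g} (reduced z φz≋0 eq) (reduced z′ φz′≋0 eq′) = reduced (z Syz.+ᴹ z′)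
        (≋-trans (hom-+ φ z z′) (+-≋ φz≋0 φz′≋0))
        λ i → S.trans (S.+-cong (eq i) (eq′ i))
          (S.trans (interchange (proj₁ z i) _ (proj₁ z′ i) _)
          (S.+-congˡ {proj₁ z i +ₚ proj₁ z′ i} (S.trans
            (S.reflexive (≡.sym (reindex-++ (quotientAt i) (⟦ d ⟧ f) (⟦ d ⟧ g))))
            (section-cong (S.sym (d.+ᴹ-homo f g)) i))))
        where open import Algebra.Properties.CommutativeSemigroup S.+-commutativeSemigroup using (interchange)

      const-* : ∀ c e p → (const c *ₚ (monomial e *ₚ p)) S.≈ (((c , e) ∷ []) *ₚ p)
      const-* c e p = S.trans (S.sym (S.*-assoc (const c) (monomial e) p))
        (S.*-congʳ {p} {const c *ₚ monomial e} {(c , e) ∷ []}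
          (term≈ (*-identityʳ c) (⊕-identityˡ e) (S.refl {0ₚ})))

      -- If x^e times generator i is assigned to generator j with quotient x^f, the difference is c
      -- (x^e e_i - x^f e_j), a multiple of a binomial syzygy.
      reducible-term : ∀ c e i → Reducible (((c , e) ∷ []) Sᵐ.*ₗ basis i)
      reducible-term c e i = go (quotientAt-index u (i , ≡.subst (genExponent i ∣ₑ_) (⊕-comm _ e) (∣ₑ-⊕ _ e)))
        where
        u = e ⊕ genExponent i
        go : (∃₂ λ j f → quotientAt j u ≡ just f × (∀ k → k ≢ j → quotientAt k u ≡ nothing)) →
             Reducible (((c , e) ∷ []) Sᵐ.*ₗ basis i)
        go (j , f , at-j , off) = reduced (const c Syz.*ₗ b)
          (≋-trans (hom-* φ (const c) b) (*-≋0 (const c) (hom-binomial b {e} {f} {i} {j} (λ _ → S.refl) u≡)))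
          λ k → S.sym (S.trans (S.+-cong (scaled k) (S.trans (section-cong du≈ k) (section-term c at-j off k)))
            (S.trans (S.+-assoc (((c , e) ∷ []) *ₚ basis i k) (S.- (((c , f) ∷ []) *ₚ basis j k)) (((c , f) ∷ []) *ₚ basis j k))
            (S.trans (S.+-congˡ {((c , e) ∷ []) *ₚ basis i k} (S.-‿inverseˡ (((c , f) ∷ []) *ₚ basis j k)))
            (S.+-identityʳ (((c , e) ∷ []) *ₚ basis i k)))))
          where
          u≡ : u ≡ f ⊕ genExponent j
          u≡ = ≡.trans (quotientAt-just j u at-j) (⊕-comm _ f)
          b : Syzygy
          b = binomial e i f j , binomial-syzygy e i f j u≡
          du≈ : ⟦ d ⟧ (((c , e) ∷ []) Sᵐ.*ₗ basis i) S.≈ ((c , u) ∷ [])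
          du≈ = S.trans (d-basis ((c , e) ∷ []) i) (term≈ (*-identityʳ c) ≡.refl S.refl)
          scaled : ∀ k → (const c *ₚ binomial e i f j k) S.≈
                   ((((c , e) ∷ []) *ₚ basis i k) S.- (((c , f) ∷ []) *ₚ basis j k))
          scaled k = S.trans (S.distribˡ (const c) (monomial e *ₚ basis i k) (-ₚ (monomial f *ₚ basis j k)))
            (S.+-cong (const-* c e (basis i k))
              (S.trans (S.sym (-‿distribʳ-* (const c) (monomial f *ₚ basis j k)))
                       (S.-‿cong (const-* c f (basis j k)))))

      reducible-multiple : ∀ p i → Reducible (p Sᵐ.*ₗ basis i)
      reducible-multiple [] i = reducible-0
      reducible-multiple ((c , e) ∷ p) i = reducible-cong
        {(((c , e) ∷ []) Sᵐ.*ₗ basis i) Sᵐ.+ᴹ (p Sᵐ.*ₗ basis i)}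
        (λ k → S.sym (S.distribʳ (basis i k) ((c , e) ∷ []) p))
        (reducible-+ (reducible-term c e i) (reducible-multiple p i))

      reducible-sum : ∀ {k} (v : Fin k → Fin numGens → Poly) → (∀ i → Reducible (v i)) → Reducible (Sᵐ.sum v)
      reducible-sum {zero}  v rs = reducible-0
      reducible-sum {suc k} v rs = reducible-+ (rs zero) (reducible-sum (v ∘ suc) (rs ∘ suc))

      sum-at : ∀ {k} (v : Fin k → Fin numGens → Poly) j →
               Sᵐ.sum v j ≡ ModuleProperties.sum (⟨module⟩ {R = polynomialRing}) (λ i → v i j)
      sum-at {zero}  v j = ≡.refl
      sum-at {suc k} v j = ≡.cong (v zero j +ₚ_) (sum-at (v ∘ suc) j)

      expansion : ∀ (f : Fin numGens → Poly) j → Sᵐ.sum (λ i → f i Sᵐ.*ₗ basis i) j S.≈ f j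
      expansion f j = S.trans (S.reflexive (sum-at (λ i → f i Sᵐ.*ₗ basis i) j))
        (S.trans (mk≈ λ e → coeff-sum (λ i → f i *ₚ basis i j) j (λ i i≢j → off i i≢j e))
        (S.trans (S.*-congˡ {f j} {basis j j} {S.1#} (basis-diagonal j)) (S.*-identityʳ (f j))))
        where
        off : ∀ i → i ≢ j → ∀ e → coeff (f i *ₚ basis i j) e ≈ 0#
        off i i≢j e = trans (coeff-≈ (*ₚ-congˡ (f i) {basis i j} {0ₚ} (mk≈ λ e → coeff-unit i j i≢j)) e)
          (coeff-≈ (*ₚ-zeroʳ (f i)) e)

      reducible : ∀ (f : Fin numGens → Poly) → Reducible f
      reducible f = reducible-cong (expansion f) (reducible-sum (λ i → f i Sᵐ.*ₗ basis i) λ i → reducible-multiple (f i) i)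

    -- Since `d s` is zero, so is its section, and s is the killed syzygy itself.
    generated-by-relations : ∀ s → ⟦ φ ⟧ s ≋ 0ₚ
    generated-by-relations s = go (reducible (proj₁ s))
      where
      go : Reducible (proj₁ s) → ⟦ φ ⟧ s ≋ 0ₚ
      go (reduced z φz≋0 eq) = ≋-trans (hom-≈ φ s z λ i → S.trans (eq i)
        (S.trans (S.+-congˡ {proj₁ z i} (section-cong (proj₂ s) i)) (S.+-identityʳ (proj₁ z i)))) φz≋0

  -- Values on the generating relations

  binomial-trans : ∀ e i f j g k l →
    (binomial e i f j l +ₚ binomial f j g k l) S.≈ binomial e i g k l
  binomial-trans e i f j g k l = Sᵐ.diff-trans
    (monomial e Sᵐ.*ₗ basis i) (monomial g Sᵐ.*ₗ basis k) (monomial f Sᵐ.*ₗ basis j) l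

  module _ (φ : Functional) where

    -- Koszul relations force x_p y = 0, and x_l y to be a multiple of x_r for the
    -- remaining l, so only the axes of q and r contribute to y.
    module _ {p q r : Fin n} (p≢q : p ≢ q) (p≢r : p ≢ r) where
      private
        y : Poly
        y = ⟦ φ ⟧ (relation p≢q p≢r)

      -- x_p (x_r e_pq - x_q e_pr) is the Koszul relation of the generators x_p x_r and x_p x_q.
      X-*-value : (X p *ₚ y) ≋ 0ₚ
      X-*-value = ≋-trans (≋-sym (hom-* φ (X p) (relation p≢q p≢r)))
        (≋-trans (hom-≈ φ (X p Syz.*ₗ relation p≢q p≢r) κ λ k → S.trans
          (scale-binomial (pure p 1) (pure r 1) (edge p≢q) (pure q 1) (edge p≢r) k)
          (S.trans (binomial-cong {i = edge p≢q} {edge p≢q} {j = edge p≢r} {edge p≢r}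
            (≡.sym (exponent-edge p≢r)) (≡.sym (exponent-edge p≢q)) ≡.refl ≡.refl k)
          (S.sym (koszul≈binomial (edge p≢q) (edge p≢r) k))))
        (hom-Kosz φ (basis (edge p≢r)) (basis (edge p≢q))))
        where
        κ : Syzygy
        κ = koszulRelation (basis (edge p≢r)) (basis (edge p≢q))

      value-own-axis : y ∼[ p ] 0ₚ
      value-own-axis t = trans (sym (coeff-X-* p y t)) (on-axis X-*-value p (suc t))

      -- The constant term lies on every axis, in particular on that of p.
      value-constant : ∀ i → coeff y (pure i 0) ≈ 0#
      value-constant i = trans (reflexive (≡.cong (coeff y) (≡.trans (pure-0 i) (≡.sym (pure-0 p)))))
        (value-own-axis 0)

      module _ {l} (q≢l : q ≢ l) (r≢l : r ≢ l) where
        private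
          q≢p : q ≢ p
          q≢p = p≢q ∘ ≡.sym
          y′ : Poly
          y′ = ⟦ φ ⟧ (relation q≢p q≢l)
          κ : Syzygy
          κ = koszulRelation (basis (edge p≢r)) (basis (edge q≢l))

        -- x_l (x_r e_pq - x_q e_pr) and x_r (x_l e_pq - x_p e_ql) differ by x_p x_r e_ql - x_q x_l
        -- e_pr, a Koszul relation.
        X-*-value-swap : (X l *ₚ y) ≋ (X r *ₚ y′)
        X-*-value-swap = ≋-trans (≋-sym (hom-* φ (X l) (relation p≢q p≢r)))
          (≋-trans (hom-≈ φ (X l Syz.*ₗ relation p≢q p≢r) ((X r Syz.*ₗ relation q≢p q≢l) Syz.+ᴹ κ) λ k →
            S.trans (scale-binomial (pure l 1) (pure r 1) (edge p≢q) (pure q 1) (edge p≢r) k)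
            (S.trans (binomial-cong {i = edge p≢q} {edge q≢p} {j = edge p≢r} {edge p≢r}
              (⊕-comm (pure l 1) (pure r 1)) (≡.trans (pair-comm l q) (≡.sym (exponent-edge q≢l)))
              (edge-cong p≢q q≢p (pair-comm p q)) ≡.refl k)
            (S.trans (S.sym (binomial-trans (pair r l) (edge q≢p) (genExponent (edge p≢r)) (edge q≢l)
              (genExponent (edge q≢l)) (edge p≢r) k))
            (S.+-cong
              (S.trans (binomial-cong {i = edge q≢p} {edge q≢p} {j = edge q≢l} {edge q≢l} ≡.refl
                (≡.trans (exponent-edge p≢r) (pair-comm p r)) ≡.refl ≡.refl k)
              (S.sym (scale-binomial (pure r 1) (pure l 1) (edge q≢p) (pure p 1) (edge q≢l) k)))
              (S.sym (koszul≈binomial (edge q≢l) (edge p≢r) k))))))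
          (≋-trans (hom-+ φ (X r Syz.*ₗ relation q≢p q≢l) κ)
          (≋-trans (+-≋ (hom-* φ (X r) (relation q≢p q≢l)) (hom-Kosz φ (basis (edge p≢r)) (basis (edge q≢l))))
          (≈⇒≋ (S.+-identityʳ (X r *ₚ y′))))))

        value-far-axis : y ∼[ l ] 0ₚ
        value-far-axis t = trans (sym (coeff-X-* l y t))
          (trans (on-axis X-*-value-swap l (suc t)) (coeff-X-*-≢ y′ (suc t) r≢l))

    value-antisym : ∀ {p q r} (p≢q : p ≢ q) (p≢r : p ≢ r) →
      ⟦ φ ⟧ (relation p≢q p≢r) ≋ (-ₚ ⟦ φ ⟧ (relation p≢r p≢q))
    value-antisym {p} {q} {r} p≢q p≢r = ≋-trans
      (hom-≈ φ (relation p≢q p≢r) (Syz.-ᴹ relation p≢r p≢q) λ k →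
        S.sym (Sᵐ.diff-sym (X q Sᵐ.*ₗ basis (edge p≢r)) (X r Sᵐ.*ₗ basis (edge p≢q)) k))
      (hom-neg φ (relation p≢r p≢q))

    -- In (x_r e_pq - x_q e_pr) + (x_q e_pr - x_p e_qr) the middle terms cancel.
    value-cyclic : ∀ {p q r} (p≢q : p ≢ q) (p≢r : p ≢ r) (q≢r : q ≢ r) →
      (⟦ φ ⟧ (relation p≢q p≢r) +ₚ ⟦ φ ⟧ (relation (p≢r ∘ ≡.sym) (q≢r ∘ ≡.sym)))
      ≋ ⟦ φ ⟧ (relation (p≢q ∘ ≡.sym) q≢r)
    value-cyclic {p} {q} {r} p≢q p≢r q≢r = ≋-trans
      (≋-sym (hom-+ φ (relation p≢q p≢r) (relation r≢p r≢q)))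
      (hom-≈ φ (relation p≢q p≢r Syz.+ᴹ relation r≢p r≢q) (relation q≢p q≢r) λ k →
        S.trans (S.+-congʳ {binomial (pure q 1) (edge r≢p) (pure p 1) (edge r≢q) k}
          (binomial-cong {i = edge p≢q} {edge q≢p} {j = edge p≢r} {edge r≢p} ≡.refl ≡.refl
            (edge-cong p≢q q≢p (pair-comm p q)) (edge-cong p≢r r≢p (pair-comm p r)) k))
        (S.trans (binomial-trans (pure r 1) (edge q≢p) (pure q 1) (edge r≢p) (pure p 1) (edge r≢q) k)
        (binomial-cong {i = edge q≢p} {edge q≢p} {j = edge r≢q} {edge q≢r} ≡.refl ≡.refl
          ≡.refl (edge-cong r≢q q≢r (pair-comm r q)) k)))
      where
      r≢p : r ≢ p
      r≢p = p≢r ∘ ≡.sym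
      r≢q : r ≢ q
      r≢q = q≢r ∘ ≡.sym
      q≢p : q ≢ p
      q≢p = p≢q ∘ ≡.sym

    -- The second summand of `value-cyclic` has r as its common vertex, so it vanishes on the axis
    -- of r. Hence the x_r-part depends on {p, q} only as an unordered pair.
    value-sym : ∀ {p q r} (p≢q : p ≢ q) (p≢r : p ≢ r) (q≢r : q ≢ r) →
      ⟦ φ ⟧ (relation p≢q p≢r) ∼[ r ] ⟦ φ ⟧ (relation (p≢q ∘ ≡.sym) q≢r)
    value-sym p≢q p≢r q≢r t = trans (sym (+-identityʳ _))
      (trans (+-congˡ (sym (value-own-axis (p≢r ∘ ≡.sym) (q≢r ∘ ≡.sym) t)))
      (trans (sym (coeff-+ (⟦ φ ⟧ (relation p≢q p≢r)) _ _)) (on-axis (value-cyclic p≢q p≢r q≢r) _ t)))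

  -- Homomorphisms extending to Sᵐ

  minus-0 : ∀ {x y} → y ≈ 0# → x - y ≈ x
  minus-0 y≈0 = trans (+-congˡ (trans (-‿cong y≈0) ε⁻¹≈ε)) (+-identityʳ _)

  ≈-minus-0 : ∀ {x y z} → x ≈ y → z ≈ 0# → x ≈ y - z
  ≈-minus-0 x≈y z≈0 = trans x≈y (sym (minus-0 z≈0))

  module _ (χ : Hom Sᵐ S/I-asSModule) where
    private module χ = Hom χ

    hom-relation : ∀ {p q r} (p≢q : p ≢ q) (p≢r : p ≢ r) →
      ⟦ χ ⟧ (proj₁ (relation p≢q p≢r)) ≋
      ((X r *ₚ ⟦ χ ⟧ (basis (edge p≢q))) +ₚ (-ₚ (X q *ₚ ⟦ χ ⟧ (basis (edge p≢r)))))
    hom-relation {p} {q} {r} p≢q p≢r =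
      ≋-trans (ideal⇒≋ (χ.+ᴹ-homo (X r Sᵐ.*ₗ basis (edge p≢q)) (Sᵐ.-ᴹ (X q Sᵐ.*ₗ basis (edge p≢r)))))
      (+-≋ (ideal⇒≋ (χ.*ₗ-homo (X r) (basis (edge p≢q))))
      (≋-trans (ideal⇒≋ (χ.-ᴹ-homo (X q Sᵐ.*ₗ basis (edge p≢r))))
      (neg-≋ {⟦ χ ⟧ (X q Sᵐ.*ₗ basis (edge p≢r))} {X q *ₚ ⟦ χ ⟧ (basis (edge p≢r))} (ideal⇒≋ (χ.*ₗ-homo (X q) (basis (edge p≢r)))))))

    coeff-hom-relation : ∀ {p q r} (p≢q : p ≢ q) (p≢r : p ≢ r) i t →
      coeff (⟦ χ ⟧ (proj₁ (relation p≢q p≢r))) (pure i t) ≈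
      coeff (X r *ₚ ⟦ χ ⟧ (basis (edge p≢q))) (pure i t)
      - coeff (X q *ₚ ⟦ χ ⟧ (basis (edge p≢r))) (pure i t)
    coeff-hom-relation {p} {q} {r} p≢q p≢r i t = trans (on-axis (hom-relation p≢q p≢r) i t)
      (coeff-minus (X r *ₚ ⟦ χ ⟧ (basis (edge p≢q))) (X q *ₚ ⟦ χ ⟧ (basis (edge p≢r))) (pure i t))

  restrict : Hom Sᵐ S/I-asSModule → Functional
  restrict = Hom.⟦_⟧ {M = Hom-Sᵐ} {N = Hom-Syz/Kosz} restriction

  -- The difference of φ and the restriction of χ kills the relations, hence all syzygies.
  agree-on-relations : (φ : Functional) (χ : Hom Sᵐ S/I-asSModule) →
    (∀ {p q r} (p≢q : p ≢ q) (p≢r : p ≢ r) → q ≢ r →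
       ⟦ φ ⟧ (relation p≢q p≢r) ≋ ⟦ χ ⟧ (proj₁ (relation p≢q p≢r))) →
    ∀ s → ⟦ φ ⟧ s ≋ ⟦ χ ⟧ (proj₁ s)
  agree-on-relations φ χ agree s = -≋0⇒≋ (⟦ φ ⟧ s) (⟦ χ ⟧ (proj₁ s)) (generated-by-relations ψ
    (λ p≢q p≢r q≢r → ≋⇒-≋0 (⟦ φ ⟧ (relation p≢q p≢r)) (⟦ χ ⟧ (proj₁ (relation p≢q p≢r))) (agree p≢q p≢r q≢r)) s)
    where
    ψ : Functional
    ψ = φ H.+ᴹ (H.-ᴹ restrict χ)

  -- The image of a generator x_p x_q under an extension of φ has its xᵣ-part read off
  -- the value y of φ on xᵣ e_pq = x_q e_pr, as y / xᵣ.  Only the constant term is shared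
  -- by all r, so it is the only source of a condition.
  module _ (φ : Functional) (γ : Fin numGens → Carrier)
    (compatible : ∀ {p q r} (p≢q : p ≢ q) (p≢r : p ≢ r) (q≢r : q ≢ r) →
       coeff (⟦ φ ⟧ (relation p≢q p≢r)) (pure r 1) ≈ γ (edge p≢q)) where

    private
      -- On the axes of p and q the image is set to 0. Relations multiply it by some x_r with r
      -- outside {p, q}, which annihilates positive powers of x_p and x_q.
      lowered-value : ∀ {p q} (p≢q : p ≢ q) r → Dec (p ≡ r) → Dec (q ≡ r) → Poly
      lowered-value p≢q r (no p≢r) (no _) = lower r (⟦ φ ⟧ (relation p≢q p≢r))
      lowered-value p≢q r _        _      = 0ₚ

      coeff-lowered-value-∉ : ∀ {p q} (p≢q : p ≢ q) r dp dq {e} → (∀ t → e ≢ pure r (suc t)) →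
                              coeff (lowered-value p≢q r dp dq) e ≈ 0#
      coeff-lowered-value-∉ p≢q r (no p≢r) (no _)  ∉ = coeff-lower-∉ r (⟦ φ ⟧ (relation p≢q p≢r)) ∉
      coeff-lowered-value-∉ p≢q r (yes _)  _       ∉ = refl
      coeff-lowered-value-∉ p≢q r (no _)   (yes _) ∉ = refl

      coeff-lowered-value : ∀ {p q} (p≢q : p ≢ q) r (p≢r : p ≢ r) → q ≢ r → ∀ dp dq t →
        coeff (lowered-value p≢q r dp dq) (pure r (suc t)) ≈
        coeff (⟦ φ ⟧ (relation p≢q p≢r)) (pure r (suc (suc t)))
      coeff-lowered-value p≢q r p≢r q≢r (no _)    (no _)    t = coeff-lower r (⟦ φ ⟧ (relation p≢q p≢r)) t
      coeff-lowered-value p≢q r p≢r q≢r (yes p≡r) _         t = contradiction p≡r p≢r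
      coeff-lowered-value p≢q r p≢r q≢r (no _)    (yes q≡r) t = contradiction q≡r q≢r

      summand : ∀ {p q} → p ≢ q → Fin n → Poly
      summand {p} {q} p≢q r = lowered-value p≢q r (p Fin.≟ r) (q Fin.≟ r)

      tail : ∀ {p q} → p ≢ q → Poly
      tail p≢q = ModuleProperties.sum (⟨module⟩ {R = polynomialRing}) (summand p≢q)

      coeff-tail : ∀ {p q} (p≢q : p ≢ q) r (p≢r : p ≢ r) → q ≢ r → ∀ t →
        coeff (tail p≢q) (pure r (suc t)) ≈ coeff (⟦ φ ⟧ (relation p≢q p≢r)) (pure r (suc (suc t)))
      coeff-tail {p} {q} p≢q r p≢r q≢r t = trans
        (coeff-sum (summand p≢q) r λ i i≢r →
          coeff-lowered-value-∉ p≢q i (p Fin.≟ i) (q Fin.≟ i) λ s → pure-suc-≢ (i≢r ∘ ≡.sym))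
        (coeff-lowered-value p≢q r p≢r q≢r (p Fin.≟ r) (q Fin.≟ r) t)

      coeff-tail-0 : ∀ {p q} (p≢q : p ≢ q) r → coeff (tail p≢q) (pure r 0) ≈ 0#
      coeff-tail-0 {p} {q} p≢q r = trans (coeff-sum (summand p≢q) r λ i _ → zero-at i) (zero-at r)
        where
        zero-at : ∀ i → coeff (summand p≢q i) (pure r 0) ≈ 0#
        zero-at i = coeff-lowered-value-∉ p≢q i (p Fin.≟ i) (q Fin.≟ i) λ t eq →
          contradiction (pure-injective {i = i} (≡.trans (≡.trans (pure-0 i) (≡.sym (pure-0 r))) eq)) λ ()

      value : (i : Fin numGens) → (∃₂ λ p q → Σ (p ≢ q) λ p≢q → i ≡ edge p≢q) → Poly
      value i (p , q , p≢q , _) = const (γ i) +ₚ tail p≢q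

      coeff-value : ∀ {p q r} (p≢q : p ≢ q) (p≢r : p ≢ r) (q≢r : q ≢ r) t i → i ≡ edge p≢q → ∀ w →
        coeff (value i w) (pure r t) ≈ coeff (⟦ φ ⟧ (relation p≢q p≢r)) (pure r (suc t))
      coeff-value {r = r} p≢q p≢r q≢r zero i i≡ (p′ , q′ , p′≢q′ , _) =
        trans (coeff-+ (const (γ i)) (tail p′≢q′) (pure r 0))
        (trans (+-cong (coeff-term-≡ (γ i) 0ₑ (≡.sym (pure-0 r))) (coeff-tail-0 p′≢q′ r))
        (trans (+-identityʳ (γ i)) (trans (reflexive (≡.cong γ i≡)) (sym (compatible p≢q p≢r q≢r)))))
      coeff-value {p} {q} {r} p≢q p≢r q≢r (suc t) i i≡ (p′ , q′ , p′≢q′ , i≡′) =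
        trans (coeff-+ (const (γ i)) (tail p′≢q′) (pure r (suc t)))
        (trans (+-congʳ (coeff-∷-≢ (γ i) 0ₑ [] λ eq →
          contradiction (pure-injective {i = r} (≡.trans (pure-0 r) eq)) λ ()))
        (trans (+-identityˡ _) (go p′≢q′ (pair-∣ₑ-pair p′≢q′
          (≡.subst (pair p′ q′ ∣ₑ_) pairs≡ ∣ₑ-refl)))))
        where
        pairs≡ : pair p′ q′ ≡ pair p q
        pairs≡ = ≡.trans (≡.sym (exponent-edge p′≢q′)) (≡.trans (≡.cong genExponent (≡.trans (≡.sym i≡′) i≡))
          (exponent-edge p≢q))
        go : ∀ {p′ q′} (p′≢q′ : p′ ≢ q′) → (p′ ≡ p × q′ ≡ q) ⊎ (p′ ≡ q × q′ ≡ p) →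
             coeff (tail p′≢q′) (pure r (suc t)) ≈ coeff (⟦ φ ⟧ (relation p≢q p≢r)) (pure r (suc (suc t)))
        go p′≢q′ (inj₁ (≡.refl , ≡.refl)) = coeff-tail p′≢q′ r p≢r q≢r t
        -- The pair chosen for this generator may come in the opposite order, where `value-sym`
        -- gives the same coefficient.
        go p′≢q′ (inj₂ (≡.refl , ≡.refl)) = trans (coeff-tail p′≢q′ r q≢r p≢r t)
          (sym (value-sym φ p≢q p≢r q≢r (suc (suc t))))

      values : Fin numGens → Poly
      values i = value i (exponent-pair i)

    extension : Hom Sᵐ S/I-asSModule
    extension = linearMap S/I-asSModule values

    private
      extension-basis : ∀ {p q r} (p≢q : p ≢ q) (p≢r : p ≢ r) (q≢r : q ≢ r) t →
        coeff (⟦ extension ⟧ (basis (edge p≢q))) (pure r t) ≈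
        coeff (⟦ φ ⟧ (relation p≢q p≢r)) (pure r (suc t))
      extension-basis {r = r} p≢q p≢r q≢r t = trans
        (on-axis (ideal⇒≋ {⟦ extension ⟧ (basis (edge p≢q))} {values (edge p≢q)} (linearMap-unitVector S/I-asSModule values (edge p≢q))) r t)
        (coeff-value p≢q p≢r q≢r t (edge p≢q) ≡.refl (exponent-pair (edge p≢q)))

      -- Axis by axis: on that of r only x_r v contributes, on that of q only - x_q w, matched
      -- through antisymmetry. Constant terms and all other axes vanish on both sides.
      agree : ∀ {p q r} (p≢q : p ≢ q) (p≢r : p ≢ r) → q ≢ r →
              ⟦ φ ⟧ (relation p≢q p≢r) ≋ ⟦ extension ⟧ (proj₁ (relation p≢q p≢r))
      agree {p} {q} {r} p≢q p≢r q≢r = mk≋ λ i t →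
        trans (at i t (i Fin.≟ r) (i Fin.≟ q) (i Fin.≟ p)) (sym (coeff-hom-relation extension p≢q p≢r i t))
        where
        y = ⟦ φ ⟧ (relation p≢q p≢r)
        v = ⟦ extension ⟧ (basis (edge p≢q))
        w = ⟦ extension ⟧ (basis (edge p≢r))
        at : ∀ i t → Dec (i ≡ r) → Dec (i ≡ q) → Dec (i ≡ p) →
             coeff y (pure i t) ≈ coeff (X r *ₚ v) (pure i t) - coeff (X q *ₚ w) (pure i t)
        at i zero _ _ _ = ≈-minus-0 (trans (value-constant φ p≢q p≢r i) (sym (coeff-X-*-0 r i v)))
          (coeff-X-*-0 q i w)
        at i (suc t) (yes ≡.refl) _ _ = ≈-minus-0
          (trans (sym (extension-basis p≢q p≢r q≢r t)) (sym (coeff-X-* r v t)))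
          (coeff-X-*-≢ w (suc t) q≢r)
        at i (suc t) (no i≢r) (yes ≡.refl) _ = trans (on-axis (value-antisym φ p≢q p≢r) q (suc t))
          (trans (coeff-neg (⟦ φ ⟧ (relation p≢r p≢q)) (pure q (suc t)))
          (trans (-‿cong (trans (sym (extension-basis p≢r p≢q (q≢r ∘ ≡.sym) t)) (sym (coeff-X-* q w t))))
          (trans (sym (+-identityˡ _)) (+-congʳ (sym (coeff-X-*-≢ v (suc t) (q≢r ∘ ≡.sym)))))))
        at i (suc t) (no i≢r) (no i≢q) (yes ≡.refl) = ≈-minus-0
          (trans (value-own-axis φ p≢q p≢r (suc t)) (sym (coeff-X-*-≢ v (suc t) (i≢r ∘ ≡.sym))))
          (coeff-X-*-≢ w (suc t) (i≢q ∘ ≡.sym))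
        at i (suc t) (no i≢r) (no i≢q) (no i≢p) = ≈-minus-0
          (trans (value-far-axis φ p≢q p≢r (i≢q ∘ ≡.sym) (i≢r ∘ ≡.sym) (suc t))
            (sym (coeff-X-*-≢ v (suc t) (i≢r ∘ ≡.sym))))
          (coeff-X-*-≢ w (suc t) (i≢q ∘ ≡.sym))

    is-restriction : ∀ s → ⟦ φ ⟧ s ≋ ⟦ extension ⟧ (proj₁ s)
    is-restriction = agree-on-relations φ extension agree

  -- Homomorphisms not extending to Sᵐ

  -- The coefficients of d(f) g - d(g) f lie in I.
  Kosz⇒≋0 : ∀ {s : Syzygy} → Mem Kosz s → ∀ i → proj₁ s i ≋ 0ₚ
  Kosz⇒≋0 {s} s∈ i = span-least Syz _ vanishing (λ {s} → onKoszul {s}) {s} s∈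
    where
    vanishing : Submodule Syz ℓr
    vanishing = record
      { Mem = λ s → proj₁ s i ≋ 0ₚ
      ; resp = λ {s} {t} s≈t s≋0 → ≋-trans (≈⇒≋ (S.sym (s≈t i))) s≋0
      ; 0-mem = ≋-refl
      ; +-mem = λ s≋0 t≋0 → +-≋ s≋0 t≋0
      ; *-mem = λ a s≋0 → *-≋0 a s≋0 }
    *-ideal : ∀ f p → (⟦ d ⟧ f *ₚ p) ≋ 0ₚ
    *-ideal f p = ≋-trans (≈⇒≋ (*ₚ-comm (⟦ d ⟧ f) p)) (*-≋0 p (ideal⇒≋0 (d∈ideal f)))
    onKoszul : ∀ {s : Syzygy} → (∃₂ λ f g → Module._≈ᴹ_ Syz s (koszulRelation f g)) → proj₁ s i ≋ 0ₚ
    onKoszul (f , g , s≈) = ≋-trans (≈⇒≋ (s≈ i)) (+-≋ (*-ideal f (g i)) (neg-≋ (*-ideal g (f i))))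

  axis-off : ∀ {i l} p → l ≢ i → coeff p 0ₑ ≈ 0# → axis i p ∼[ l ] 0ₚ
  axis-off {i} {l} p l≢i p₀≈0 zero = trans (reflexive (≡.cong (coeff (axis i p)) (≡.trans (pure-0 l) (≡.sym (pure-0 i)))))
    (trans (coeff-axis i p 0) (trans (reflexive (≡.cong (coeff p) (pure-0 i))) p₀≈0))
  axis-off {i} p l≢i p₀≈0 (suc t) = coeff-axis-∉ i p λ s → pure-suc-≢ l≢i

  axis-≋ : ∀ i {p q} → p ≋ q → axis i p ≋ axis i q
  axis-≋ i {p} {q} p≋q = mk≋ λ l t → go l t (l Fin.≟ i)
    where
    go : ∀ l t → Dec (l ≡ i) → coeff (axis i p) (pure l t) ≈ coeff (axis i q) (pure l t)
    go l t (yes ≡.refl) = trans (coeff-axis l p t) (trans (on-axis p≋q l t) (sym (coeff-axis l q t)))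
    go l (suc t) (no l≢i) = trans (coeff-axis-∉ i p λ s → pure-suc-≢ l≢i) (sym (coeff-axis-∉ i q λ s → pure-suc-≢ l≢i))
    go l zero (no l≢i) = ≡.subst (λ e → coeff (axis i p) e ≈ coeff (axis i q) e)
      (≡.trans (pure-0 i) (≡.sym (pure-0 l))) (trans (coeff-axis i p 0) (trans (on-axis p≋q i 0) (sym (coeff-axis i q 0))))

  -- Constant terms have to be excluded: for p = 1 and a = x_l with l different from i, the left
  -- side is 0 and the right side x_l.
  axis-* : ∀ i a p → coeff p 0ₑ ≈ 0# → coeff (a *ₚ p) 0ₑ ≈ 0# → axis i (a *ₚ p) ≋ (a *ₚ axis i p)
  axis-* i a p p₀≈0 ap₀≈0 = mk≋ λ l t → go l t (l Fin.≟ i)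
    where
    go : ∀ l t → Dec (l ≡ i) → coeff (axis i (a *ₚ p)) (pure l t) ≈ coeff (a *ₚ axis i p) (pure l t)
    go l t (yes ≡.refl) = trans (coeff-axis l (a *ₚ p) t)
      (*ₚ-axis-congˡ a {p} {axis l p} (λ t → sym (coeff-axis l p t)) t)
    go l t (no l≢i) = trans (axis-off (a *ₚ p) l≢i ap₀≈0 t)
      (sym (trans (*ₚ-axis-congˡ a {axis i p} {0ₚ} (axis-off p l≢i p₀≈0) t) (coeff-≈ (*ₚ-zeroʳ a) _)))

  module _ (i : Fin n) {j k : Fin n} (j≢k : j ≢ k) where
    private
      e : Fin numGens
      e = edge j≢k

    -- The xᵢ-part of the coefficient of the generator x_j x_k; it is S-linear
    -- because that coefficient has no constant term.
    axisFunctional : Functional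
    axisFunctional = mkHom Syz/Kosz (⟨module⟩ {R = S/I}) (λ s → axis i (proj₁ s e))
      (λ {s} {t} s≈t → ≋⇒ideal (axis-≋ i (-≋0⇒≋ (proj₁ s e) (proj₁ t e) (Kosz⇒≋0 {s Syz.+ᴹ (Syz.-ᴹ t)} s≈t e))))
      (λ s t → ≋⇒ideal (≈⇒≋ (S.reflexive (reindex-++ (onAxis i) (proj₁ s e) (proj₁ t e)))))
      (λ a s → ≋⇒ideal (axis-* i a (proj₁ s e) (syzygy-constant j≢k s) (syzygy-constant j≢k (a Syz.*ₗ s))))

    coeff-relation : ∀ {r} (j≢r : j ≢ r) → k ≢ r →
      coeff (proj₁ (relation j≢k j≢r) e) (pure r 1) ≈ 1#
    coeff-relation {r} j≢r k≢r = trans (coeff-minus (X r *ₚ basis e e) (X k *ₚ basis (edge j≢r) e) (pure r 1))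
      (trans (+-cong (trans (coeff-X-* r (basis e e) 0)
                 (trans (coeff-≈ (basis-diagonal e) (pure r 0)) (coeff-term-≡ 1# 0ₑ (≡.sym (pure-0 r)))))
               (trans (-‿cong (coeff-X-*-≢ (basis (edge j≢r) e) 1 k≢r)) ε⁻¹≈ε))
      (+-identityʳ 1#))

    axisFunctional-≡ : ∀ {r} (j≢r : j ≢ r) → k ≢ r → r ≡ i →
      coeff (⟦ axisFunctional ⟧ (relation j≢k j≢r)) (pure r 1) ≈ 1#
    axisFunctional-≡ j≢r k≢r ≡.refl = trans (coeff-axis i (proj₁ (relation j≢k j≢r) e) 1) (coeff-relation j≢r k≢r)

    axisFunctional-≢ : ∀ {r} (j≢r : j ≢ r) → k ≢ r → r ≢ i →
      coeff (⟦ axisFunctional ⟧ (relation j≢k j≢r)) (pure r 1) ≈ 0#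
    axisFunctional-≢ j≢r k≢r r≢i = coeff-axis-∉ i (proj₁ (relation j≢k j≢r) e) λ t → pure-suc-≢ r≢i

  -- Graded components

  -- The constant term that an extension of φ would have to give to the image of x_j x_k, as seen
  -- from r.
  coordinate : Functional → ∀ {j k r} → j ≢ k → j ≢ r → Carrier
  coordinate φ {r = r} j≢k j≢r = coeff (⟦ φ ⟧ (relation j≢k j≢r)) (pure r 1)

  monomial-basis-homogeneous : ∀ e i k →
    Mem (gradingS (exponentDegree (e ⊕ genExponent i) -ᵈ exponentDegree (genExponent k))) (monomial e *ₚ basis i k)
  monomial-basis-homogeneous e i k x x≢ = go (i Fin.≟ k)
    where
    go : (i≟k : Dec (i ≡ k)) → coeff (monomial e *ₚ (if does i≟k then S.1# else S.0#)) x ≈ 0#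
    go (no _) = refl
    go (yes ≡.refl) = coeff-∷-≢ (1# * 1#) (e ⊕ 0ₑ) [] λ eq → x≢
      (≡.trans (≡.cong exponentDegree (≡.trans (≡.sym eq) (⊕-identityʳ e)))
               (≡.sym (exponentDegree-⊕-minus e (genExponent i))))

  relation-homogeneous : ∀ {p q r} (p≢q : p ≢ q) (p≢r : p ≢ r) →
    Mem (gradingSyz/Kosz (exponentDegree (pure r 1 ⊕ genExponent (edge p≢q)))) (relation p≢q p≢r)
  relation-homogeneous {p} {q} {r} p≢q p≢r = relation p≢q p≢r , components ,
    ≈⇒~ Syz Kosz {relation p≢q p≢r} {relation p≢q p≢r} (λ k → S.refl)
    where
    u = exponentDegree (pure r 1 ⊕ genExponent (edge p≢q))
    components : ∀ k → Mem (gradingS (u -ᵈ exponentDegree (genExponent k))) (proj₁ (relation p≢q p≢r) k)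
    components k x x≢ = trans (coeff-minus (X r *ₚ basis (edge p≢q) k) (X q *ₚ basis (edge p≢r) k) x)
      (trans (+-cong (monomial-basis-homogeneous (pure r 1) (edge p≢q) k x x≢)
        (trans (-‿cong (monomial-basis-homogeneous (pure q 1) (edge p≢r) k x
          (≡.subst (λ v → exponentDegree x ≢ exponentDegree v -ᵈ exponentDegree (genExponent k))
            (relation-exponent p≢q p≢r) x≢))) ε⁻¹≈ε))
      (+-identityˡ 0#))

  Homogeneous : Degree n → Functional → Set _
  Homogeneous c φ = ∀ u {s : Syzygy} → Mem (gradingSyz/Kosz u) s → Mem (gradingS/I (u +ᵈ c)) (⟦ φ ⟧ s)

  homogeneous-coordinate : ∀ {c} (φ : Functional) → Homogeneous c φ → ∀ {j k r} (j≢k : j ≢ k) (j≢r : j ≢ r) →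
    exponentDegree (pure r 1) ≢ exponentDegree (pure r 1 ⊕ genExponent (edge j≢k)) +ᵈ c → coordinate φ j≢k j≢r ≈ 0#
  homogeneous-coordinate {c} φ φ∈ {r = r} j≢k j≢r deg≢ =
    go (φ∈ (exponentDegree (pure r 1 ⊕ genExponent (edge j≢k))) {relation j≢k j≢r} (relation-homogeneous j≢k j≢r))
    where
    go : Mem (gradingS/I (exponentDegree (pure r 1 ⊕ genExponent (edge j≢k)) +ᵈ c)) (⟦ φ ⟧ (relation j≢k j≢r)) →
         coordinate φ j≢k j≢r ≈ 0#
    go (x , x∈ , x~) = trans (sym (on-axis (ideal⇒≋ {x} {⟦ φ ⟧ (relation j≢k j≢r)} x~) r 1)) (x∈ (pure r 1) deg≢)

  -- A value of a homomorphism of degree a - b on the relation can contain x_r only if shifting the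
  -- degree of x_r x_j x_k by a - b gives that of x_r.
  nonzero-coordinate-degree : ∀ {j k} (j≢k : j ≢ k) (r : Fin n) (a b : Exponent n) →
    exponentDegree (pure r 1) ≡ exponentDegree (pure r 1 ⊕ genExponent (edge j≢k)) +ᵈ (exponentDegree a -ᵈ exponentDegree b) →
    pair j k ⊕ a ≡ b
  nonzero-coordinate-degree j≢k r a b eq = ≡.trans (≡.cong (_⊕ a) (≡.sym (exponent-edge j≢k)))
    (shift-degree (pure r 1) (genExponent (edge j≢k)) a b eq)

  axisFunctional-homogeneous : ∀ i {j k} (j≢k : j ≢ k) →
    Homogeneous (exponentDegree 0ₑ -ᵈ exponentDegree (pair j k)) (axisFunctional i j≢k)
  axisFunctional-homogeneous i {j} {k} j≢k u {s} (s′ , s′∈ , s′~s) =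
    axis i (proj₁ s′ e) , homogeneous ,
    ≋⇒ideal (hom-≈ᴷ (axisFunctional i j≢k) s′ s s′~s)
    where
    e = edge j≢k
    c = exponentDegree 0ₑ -ᵈ exponentDegree (pair j k)
    degree : u -ᵈ exponentDegree (genExponent e) ≡ u +ᵈ c
    degree = ≡.trans (≡.cong (λ v → u -ᵈ exponentDegree v) (exponent-edge j≢k)) (-ᵈ≡+ᵈ0- u (exponentDegree (pair j k)))
    homogeneous : Mem (gradingS (u +ᵈ c)) (axis i (proj₁ s′ e))
    homogeneous x x≢ = go (x ≟ₑ pure i (lookup x i))
      where
      go : Dec (x ≡ pure i (lookup x i)) → coeff (axis i (proj₁ s′ e)) x ≈ 0#
      go (yes x≡) = ≡.subst (λ v → coeff (axis i (proj₁ s′ e)) v ≈ 0#) (≡.sym x≡)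
        (trans (coeff-axis i (proj₁ s′ e) _) (≡.subst (λ v → coeff (proj₁ s′ e) v ≈ 0#) x≡
          (s′∈ e x λ eq → x≢ (≡.trans eq degree))))
      go (no x≢pure) = coeff-axis-∉ i (proj₁ s′ e) λ t eq →
        x≢pure (≡.trans eq (≡.cong (pure i) (≡.sym (≡.trans (≡.cong (λ v → lookup v i) eq) (lookup-pure i t)))))

  zero-functional : Functional
  zero-functional = Module.0ᴹ Hom-Syz/Kosz

  infix 4 _≈ᵀ_
  _≈ᵀ_ : Functional → Functional → Set _
  φ ≈ᵀ ψ = ∃ λ (χ : Hom Sᵐ S/I-asSModule) → ∀ s → ⟦ χ ⟧ (proj₁ s) ≋ (⟦ φ ⟧ s +ₚ (-ₚ ⟦ ψ ⟧ s))

  private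
    onSyzygy : Hom Sᵐ S/I-asSModule → Syzygy → Poly
    onSyzygy χ s = ⟦ χ ⟧ (proj₁ s)

  ≈ᵀ⇒≈ : (φ ψ : Functional) → φ ≈ᵀ ψ → φ T².≈ᴹ ψ
  ≈ᵀ⇒≈ φ ψ (χ , eq) = χ , λ s → ≋⇒ideal (eq s)

  ≈⇒≈ᵀ : (φ ψ : Functional) → φ T².≈ᴹ ψ → φ ≈ᵀ ψ
  ≈⇒≈ᵀ φ ψ φ≈ψ = proj₁ φ≈ψ , λ s →
    ideal⇒≋ {onSyzygy (proj₁ φ≈ψ) s} {⟦ φ ⟧ s +ₚ (-ₚ ⟦ ψ ⟧ s)} (proj₂ φ≈ψ s)

  -- Once the constant terms seen from all r agree, φ extends to Sᵐ and its class in the cokernel is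
  -- 0.
  restriction⇒≈0 : ∀ (φ : Functional) (γ : Fin numGens → Carrier) →
    (∀ {p q r} (p≢q : p ≢ q) (p≢r : p ≢ r) → q ≢ r → coordinate φ p≢q p≢r ≈ γ (edge p≢q)) →
    φ T².≈ᴹ zero-functional
  restriction⇒≈0 φ γ compatible = ≈ᵀ⇒≈ φ zero-functional (extension φ γ compatible , λ s →
    ≋-trans (≋-sym (is-restriction φ γ compatible s)) (≈⇒≋ (S.sym (S.+-identityʳ (⟦ φ ⟧ s)))))

  -- On x_r e_jk - x_k e_jr, the coefficient of x_r in χ is the constant term of χ e_jk. It is the
  -- same for all r, so differences of coordinates depend only on the class in T².
  coordinate-≈ᵀ : (φ ψ : Functional) (φ≈ψ : φ ≈ᵀ ψ) → ∀ {j k r} (j≢k : j ≢ k) (j≢r : j ≢ r) → k ≢ r →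
    coordinate φ j≢k j≢r - coordinate ψ j≢k j≢r ≈ coeff (⟦ proj₁ φ≈ψ ⟧ (basis (edge j≢k))) 0ₑ
  coordinate-≈ᵀ φ ψ (χ , eq) {j} {k} {r} j≢k j≢r k≢r = trans
    (sym (coeff-minus (⟦ φ ⟧ (relation j≢k j≢r)) (⟦ ψ ⟧ (relation j≢k j≢r)) (pure r 1)))
    (trans (sym (on-axis (eq (relation j≢k j≢r)) r 1))
    (trans (coeff-hom-relation χ j≢k j≢r r 1)
    (trans (+-cong (coeff-X-* r v 0) (trans (-‿cong (coeff-X-*-≢ w 1 k≢r)) ε⁻¹≈ε))
    (trans (+-identityʳ _) (reflexive (≡.cong (coeff v) (pure-0 r)))))))
    where
    v = ⟦ χ ⟧ (basis (edge j≢k))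
    w = ⟦ χ ⟧ (basis (edge j≢r))

  exchange : ∀ {a b c d} → a - b ≈ c - d → a - c ≈ b - d
  exchange {a} {b} {c} {d} eq = trans (sym (K.diff-trans a c b))
    (trans (+-congʳ eq) (trans (+-comm (c - d) (b - c)) (K.diff-trans b d c)))

  -- The component of degree - e_j - e_k

  module _ {j k : Fin n} (j≢k : j ≢ k) where

    degree : Degree n
    degree = exponentDegree 0ₑ -ᵈ exponentDegree (pair j k)

    private
      module C = Module (component degree)

    element : (φ : Functional) → Homogeneous degree φ → C.Carrierᴹ
    element φ φ∈ = φ , φ , φ∈ , T².≈ᴹ-refl {φ}

    functional : C.Carrierᴹ → Functional
    functional (φ , _) = φ

    coordinate-off : (φ : Functional) → Homogeneous degree φ → ∀ {p q r} (p≢q : p ≢ q) (p≢r : p ≢ r) →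
                     pair p q ≢ pair j k → coordinate φ p≢q p≢r ≈ 0#
    coordinate-off φ φ∈ {p} {q} {r} p≢q p≢r pq≢jk = homogeneous-coordinate φ φ∈ p≢q p≢r λ eq →
      pq≢jk (≡.trans (≡.sym (⊕-identityʳ (pair p q))) (nonzero-coordinate-degree p≢q r 0ₑ (pair j k) eq))

    module _ {r r₀ : Fin n} (j≢r : j ≢ r) (j≢r₀ : j ≢ r₀) where

      -- A linear coordinate on K^(n-2) / K(1, ..., 1), with r₀ as the reference vertex.
      gap : Functional → Carrier
      gap φ = coordinate φ j≢k j≢r - coordinate φ j≢k j≢r₀

      gap-≈ : k ≢ r → k ≢ r₀ → (φ ψ : Functional) → φ T².≈ᴹ ψ → gap φ ≈ gap ψ
      gap-≈ k≢r k≢r₀ φ ψ φ≈ψ = exchange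
        (trans (coordinate-≈ᵀ φ ψ (≈⇒≈ᵀ φ ψ φ≈ψ) j≢k j≢r k≢r)
               (sym (coordinate-≈ᵀ φ ψ (≈⇒≈ᵀ φ ψ φ≈ψ) j≢k j≢r₀ k≢r₀)))

      gap-+ : (φ ψ : Functional) → gap (Module._+ᴹ_ Hom-Syz/Kosz φ ψ) ≈ gap φ + gap ψ
      gap-+ φ ψ = trans (+-cong (coeff-+ (⟦ φ ⟧ (relation j≢k j≢r)) (⟦ ψ ⟧ (relation j≢k j≢r)) (pure r 1))
          (-‿cong (coeff-+ (⟦ φ ⟧ (relation j≢k j≢r₀)) (⟦ ψ ⟧ (relation j≢k j≢r₀)) (pure r₀ 1))))
        (sym (K.diff-+ (coordinate φ j≢k j≢r) (coordinate φ j≢k j≢r₀) (coordinate ψ j≢k j≢r) (coordinate ψ j≢k j≢r₀)))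

      gap-* : ∀ c (φ : Functional) → gap (Module._*ₗ_ Hom-Syz/Kosz (const c) φ) ≈ c * gap φ
      gap-* c φ = trans (+-cong (coeff-const-* c (⟦ φ ⟧ (relation j≢k j≢r)) (pure r 1))
          (-‿cong (coeff-const-* c (⟦ φ ⟧ (relation j≢k j≢r₀)) (pure r₀ 1))))
        (sym (K.diff-*ₗ c (coordinate φ j≢k j≢r) (coordinate φ j≢k j≢r₀)))

      gapHom : k ≢ r → k ≢ r₀ → Hom (component degree) (⟨module⟩ {R = K})
      gapHom k≢r k≢r₀ = mkHom (component degree) (⟨module⟩ {R = K}) (λ x → gap (functional x))
        (λ { {φ , _} {ψ , _} φ≈ψ → gap-≈ k≢r k≢r₀ φ ψ φ≈ψ })
        (λ { (φ , _) (ψ , _) → gap-+ φ ψ })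
        (λ { c (φ , _) → gap-* c φ })

    equal-coordinates⇒≈0 : (φ : Functional) → Homogeneous degree φ → (κ : Carrier) →
      (∀ {r} (j≢r : j ≢ r) → k ≢ r → coordinate φ j≢k j≢r ≈ κ) → φ T².≈ᴹ zero-functional
    equal-coordinates⇒≈0 φ φ∈ κ all-κ = restriction⇒≈0 φ γ λ p≢q p≢r q≢r →
      go p≢q p≢r q≢r (edge p≢q Fin.≟ edge j≢k)
      where
      γ : Fin numGens → Carrier
      -- In this degree the coordinates at all other pairs vanish, so their constant term is 0.
      γ i = if does (i Fin.≟ edge j≢k) then κ else 0#
      same : ∀ {p q r} (p≢q : p ≢ q) (p≢r : p ≢ r) → q ≢ r → (p ≡ j × q ≡ k) ⊎ (p ≡ k × q ≡ j) →
             coordinate φ p≢q p≢r ≈ κ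
      same p≢q p≢r q≢r (inj₁ (≡.refl , ≡.refl)) = all-κ p≢r q≢r
      same p≢q p≢r q≢r (inj₂ (≡.refl , ≡.refl)) = trans (value-sym φ p≢q p≢r q≢r 1) (all-κ q≢r p≢r)
      go : ∀ {p q r} (p≢q : p ≢ q) (p≢r : p ≢ r) (q≢r : q ≢ r) (e≟ : Dec (edge p≢q ≡ edge j≢k)) →
           coordinate φ p≢q p≢r ≈ (if does e≟ then κ else 0#)
      go p≢q p≢r q≢r (no e≢)  = coordinate-off φ φ∈ p≢q p≢r (e≢ ∘ edge-cong p≢q j≢k)
      go {p} {q} p≢q p≢r q≢r (yes e≡) = same p≢q p≢r q≢r (pair-∣ₑ-pair p≢q
        (≡.subst (pair p q ∣ₑ_) (≡.trans (≡.sym (exponent-edge p≢q))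
          (≡.trans (≡.cong genExponent e≡) (exponent-edge j≢k))) ∣ₑ-refl))

    module _ {m : ℕ} (w : Fin (suc m) → Fin n) (w-injective : ∀ {x y} → w x ≡ w y → x ≡ y)
      (j≢w : ∀ x → j ≢ w x) (k≢w : ∀ x → k ≢ w x) (w-surjective : ∀ {i} → j ≢ i → k ≢ i → ∃ λ x → w x ≡ i) where

      private
        vector : Fin m → C.Carrierᴹ
        vector t = element (axisFunctional (w (suc t)) j≢k) (axisFunctional-homogeneous (w (suc t)) j≢k)

        δ : Fin m → Hom (component degree) (⟨module⟩ {R = K})
        δ t = gapHom (j≢w (suc t)) (j≢w zero) (k≢w (suc t)) (k≢w zero)

        off : ∀ s t → s ≢ suc t → coordinate (axisFunctional (w (suc t)) j≢k) j≢k (j≢w s) ≈ 0#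
        off s t s≢ = axisFunctional-≢ (w (suc t)) j≢k (j≢w s) (k≢w s) (s≢ ∘ w-injective)

        separating : ∀ z → (∀ t → ⟦ δ t ⟧ z ≈ 0#) → z C.≈ᴹ C.0ᴹ
        -- The representative φ need not be homogeneous; ψ is a homogeneous one of the same class,
        -- and gaps carry over from φ to ψ.
        separating (φ , ψ , ψ∈ , ψ≈φ) δz≈0 = T².≈ᴹ-trans {φ} {ψ} {zero-functional} (T².≈ᴹ-sym {ψ} {φ} ψ≈φ)
          (equal-coordinates⇒≈0 ψ ψ∈ (coordinate ψ j≢k (j≢w zero)) λ j≢r k≢r → at j≢r (w-surjective j≢r k≢r))
          where
          at-w : ∀ x → coordinate ψ j≢k (j≢w x) ≈ coordinate ψ j≢k (j≢w zero)
          at-w zero    = refl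
          at-w (suc t) = x∙y⁻¹≈ε⇒x≈y _ _ (trans
            (gap-≈ (j≢w (suc t)) (j≢w zero) (k≢w (suc t)) (k≢w zero) ψ φ ψ≈φ) (δz≈0 t))
          at : ∀ {r} (j≢r : j ≢ r) → (∃ λ x → w x ≡ r) → coordinate ψ j≢k j≢r ≈ coordinate ψ j≢k (j≢w zero)
          at j≢r (x , ≡.refl) = at-w x

      -- Of the m + 1 = n - 2 vertices outside the pair, `w zero` is the reference. The axis
      -- functionals of the other m are dual to the gaps.
      component-dimension : HasDimension (component degree) m
      component-dimension = vector , DualBasis.dual-basis (component degree) vector δ
        (λ t → trans (minus-0 (off zero t λ ()))
          (axisFunctional-≡ (w (suc t)) j≢k (j≢w (suc t)) (k≢w (suc t)) ≡.refl))
        (λ s t t≢s → trans (minus-0 (off zero t λ ())) (off (suc s) t (t≢s ∘ ≡.sym ∘ Fin.suc-injective)))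
        separating

  -- The remaining degrees and the case n ≤ 3

  zero-dimensional : (c : Degree n) → ((φ : Functional) → Homogeneous c φ → φ T².≈ᴹ zero-functional) →
                     HasDimension (component c) 0
  zero-dimensional c vanish = (λ ()) , DualBasis.dual-basis (component c) (λ ()) (λ ()) (λ ()) (λ ())
    λ where (φ , ψ , ψ∈ , ψ≈φ) _ → T².≈ᴹ-trans {φ} {ψ} {zero-functional} (T².≈ᴹ-sym {ψ} {φ} ψ≈φ) (vanish ψ ψ∈)

  -- A coordinate could survive only if x_p x_q x^a = x^b. Disjoint supports then give a = 0 and two
  -- elements in the support of b, the excluded case. So 0 serves as every constant term.
  dimension-otherwise : ∀ a b → Empty (support a ∩ support b) → ¬ (a ≡ 0ₑ × ∣ support b ∣ ≡ 2) →
    HasDimension (component (exponentDegree a -ᵈ exponentDegree b)) 0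
  dimension-otherwise a b empty ¬pair = zero-dimensional (exponentDegree a -ᵈ exponentDegree b) λ φ φ∈ →
    restriction⇒≈0 φ (λ _ → 0#) λ {p} {q} {r} p≢q p≢r q≢r → homogeneous-coordinate φ φ∈ p≢q p≢r λ eq →
      excluded p≢q (nonzero-coordinate-degree p≢q r a b eq)
    where
    excluded : ∀ {p q} → p ≢ q → pair p q ⊕ a ≢ b
    excluded {p} {q} p≢q eq = ¬pair (a≡0 , ≡.trans (≡.cong (∣_∣ ∘ support) b≡) (∣support-pair∣ p≢q))
      where
      a≡0 : a ≡ 0ₑ
      a≡0 = disjoint-supports a b (pair p q) empty eq
      b≡ : b ≡ pair p q
      b≡ = ≡.trans (≡.sym eq) (≡.trans (≡.cong (pair p q ⊕_) a≡0) (⊕-identityʳ (pair p q)))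

  -- The coordinate at the only vertex outside a pair serves as the constant term, so every
  -- functional extends.
  n≤3⇒zero : n ≤ 3 → IsZero T²Δ
  n≤3⇒zero n≤3 φ = restriction⇒≈0 φ γ compatible
    where
    Third : Fin n → Fin n → Set
    Third p q = ∃ λ r → p ≢ r × q ≢ r

    third? : ∀ p q → Dec (Third p q)
    third? p q = Fin.any? λ r → ¬? (p Fin.≟ r) ×-dec ¬? (q Fin.≟ r)

    at-third : ∀ {p q} → p ≢ q → Dec (Third p q) → Carrier
    at-third p≢q (yes (r , p≢r , _)) = coordinate φ p≢q p≢r
    -- With no vertex outside the pair, no relation constrains the constant term.
    at-third p≢q (no _) = 0#

    coordinate-third : ∀ {p q r} (p≢q : p ≢ q) (p≢r : p ≢ r) (q≢r : q ≢ r) (t : Dec (Third p q)) →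
                       coordinate φ p≢q p≢r ≈ at-third p≢q t
    coordinate-third p≢q p≢r q≢r (no ¬third) = contradiction (_ , p≢r , q≢r) ¬third
    coordinate-third p≢q p≢r q≢r (yes (s , p≢s , q≢s)) = same (third-unique n≤3 p≢q p≢r q≢r p≢s q≢s) p≢r p≢s
      where
      same : ∀ {r s} → r ≡ s → (p≢r : _ ≢ r) (p≢s : _ ≢ s) → coordinate φ p≢q p≢r ≈ coordinate φ p≢q p≢s
      same ≡.refl p≢r p≢s = refl

    γ′ : ∀ {i} → (∃₂ λ p q → Σ (p ≢ q) λ p≢q → i ≡ edge p≢q) → Carrier
    γ′ (p , q , p≢q , _) = at-third p≢q (third? p q)

    γ : Fin numGens → Carrier
    γ i = γ′ (exponent-pair i)

    compatible : ∀ {p q r} (p≢q : p ≢ q) (p≢r : p ≢ r) → q ≢ r → coordinate φ p≢q p≢r ≈ γ (edge p≢q)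
    compatible {p} {q} p≢q p≢r q≢r = go (exponent-pair (edge p≢q))
      where
      cases : ∀ {p′ q′} (p′≢q′ : p′ ≢ q′) → (p′ ≡ p × q′ ≡ q) ⊎ (p′ ≡ q × q′ ≡ p) →
              coordinate φ p≢q p≢r ≈ at-third p′≢q′ (third? p′ q′)
      cases p′≢q′ (inj₁ (≡.refl , ≡.refl)) = coordinate-third p′≢q′ p≢r q≢r (third? p q)
      cases p′≢q′ (inj₂ (≡.refl , ≡.refl)) = trans (value-sym φ p≢q p≢r q≢r 1)
        (coordinate-third p′≢q′ q≢r p≢r (third? q p))
      go : (w : ∃₂ λ p′ q′ → Σ (p′ ≢ q′) λ p′≢q′ → edge p≢q ≡ edge p′≢q′) → coordinate φ p≢q p≢r ≈ γ′ w
      go (p′ , q′ , p′≢q′ , e≡) = cases p′≢q′ (pair-∣ₑ-pair p′≢q′ (≡.subst (pair p′ q′ ∣ₑ_)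
        (≡.trans (≡.sym (exponent-edge p′≢q′)) (≡.trans (≡.cong genExponent (≡.sym e≡)) (exponent-edge p≢q))) ∣ₑ-refl))

  component-zero : IsZero T²Δ → ∀ c → IsZero (component c)
  component-zero zero-T² c (φ , _) = zero-T² φ

-- Dimensions for all n and the vanishing criterion

module _ {r ℓr} (K : CommutativeRing r ℓr) where
  open CommutativeRing K hiding (zero)

  -- For n = 2 no reference vertex exists outside the pair. The coordinates are then trivially
  -- equal, and truncated subtraction gives the required 0.
  dimension-pair : ∀ {n} (Δ : SimplicialComplex n) → IsZeroDimensional Δ → NoLoops Δ →
    ∀ {j k} → j ≢ k →
    HasDimension (StanleyReisner.T²-component K Δ (exponentDegree 0ₑ -ᵈ exponentDegree (pair j k))) (n ∸ 3)
  dimension-pair {suc zero} Δ zd nl {zero} {zero} j≢k = contradiction ≡.refl j≢k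
  dimension-pair {suc (suc zero)} Δ zd nl j≢k = zero-dimensional (degree j≢k) λ φ φ∈ →
    equal-coordinates⇒≈0 j≢k φ φ∈ 0# λ j≢r k≢r → contradiction (proj₁ (others-surjective j≢k j≢r k≢r)) λ ()
    where open PointComplex K Δ zd nl
  dimension-pair {suc (suc (suc m))} Δ zd nl j≢k = component-dimension j≢k (others j≢k)
    (others-injective j≢k) (j≢others j≢k) (k≢others j≢k) (others-surjective j≢k)
    where open PointComplex K Δ zd nl

  positive-dimension⇒nonzero : ∀ {m ℓm} (M : Module K m ℓm) {k} → ¬ (1# ≈ 0#) → HasDimension M (suc k) → ¬ IsZero M
  positive-dimension⇒nonzero M 1≉0 (v , basis) zero-M =
    1≉0 (IsBasis.independent basis (λ _ → 1#) (zero-M _) zero)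

  -- For n ≥ 4 the component of the first two vertices has dimension n - 3 ≥ 1.
  zero⇒n≤3 : ¬ (1# ≈ 0#) → ∀ {n} (Δ : SimplicialComplex n) → IsZeroDimensional Δ → NoLoops Δ →
             IsZero (StanleyReisner.T² K Δ) → n ≤ 3
  zero⇒n≤3 1≉0 {0} Δ zd nl zero-T² = z≤n
  zero⇒n≤3 1≉0 {1} Δ zd nl zero-T² = s≤s z≤n
  zero⇒n≤3 1≉0 {2} Δ zd nl zero-T² = s≤s (s≤s z≤n)
  zero⇒n≤3 1≉0 {3} Δ zd nl zero-T² = s≤s (s≤s (s≤s z≤n))
  zero⇒n≤3 1≉0 {suc (suc (suc (suc m)))} Δ zd nl zero-T² = contradiction
    (PointComplex.component-zero K Δ zd nl zero-T² (exponentDegree 0ₑ -ᵈ exponentDegree (pair zero (suc zero))))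
    (positive-dimension⇒nonzero (StanleyReisner.T²-component K Δ _) 1≉0
      (dimension-pair Δ zd nl {zero} {suc zero} λ ()))

-- 1 - 0 is invertible, so 1 is apart from 0, and apartness is irreflexive.
1≉0 : ∀ {c ℓ₁ ℓ₂} (K : HeytingField c ℓ₁ ℓ₂) → ¬ (HeytingField._≈_ K (HeytingField.1# K) (HeytingField.0# K))
1≉0 K 1≈0 = #-irrefl 1≈0 (invertible⇒# (1# , trans (*-identityˡ _) 1-0≈1 , trans (*-identityʳ _) 1-0≈1))
  where
  open HeytingField K
  open import Algebra.Properties.AbelianGroup (CommutativeRing.+-abelianGroup (fieldRing K)) using (ε⁻¹≈ε)
  1-0≈1 : 1# - 0# ≈ 1#
  1-0≈1 = trans (+-congˡ ε⁻¹≈ε) (+-identityʳ 1#)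

lemma3p1 : ∀ {c ℓ₁ ℓ₂} (K : HeytingField c ℓ₁ ℓ₂) (n : ℕ) (Δ : SimplicialComplex n) →
    IsZeroDimensional Δ → NoLoops Δ →
    ((a b : Exponent n) → All (_≤ 1) b → Empty (support a ∩ support b) →
    (a ≡ 0ₑ × ∣ support b ∣ ≡ 2 → HasDimension (T²-component K Δ (exponentDegree a -ᵈ exponentDegree b)) (n ∸ 3))
    × (¬ (a ≡ 0ₑ × ∣ support b ∣ ≡ 2) → HasDimension (T²-component K Δ (exponentDegree a -ᵈ exponentDegree b)) 0))
    × (IsZero (T² K Δ) ⇔ n ≤ 3)
lemma3p1 K n Δ zd nl =
  (λ a b b≤1 empty → special a b b≤1 , PointComplex.dimension-otherwise (fieldRing K) Δ zd nl a b empty) ,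
  mk⇔ (zero⇒n≤3 (fieldRing K) (1≉0 K) Δ zd nl) (PointComplex.n≤3⇒zero (fieldRing K) Δ zd nl)
  where
  special : (a b : Exponent n) → All (_≤ 1) b → a ≡ 0ₑ × ∣ support b ∣ ≡ 2 →
            HasDimension (T²-component K Δ (exponentDegree a -ᵈ exponentDegree b)) (n ∸ 3)
  special a b b≤1 (a≡0 , ∣b∣≡2) = go (∣support∣≡2 b≤1 ∣b∣≡2) a≡0
    where
    go : (∃₂ λ p q → p ≢ q × b ≡ pair p q) → a ≡ 0ₑ →
         HasDimension (T²-component K Δ (exponentDegree a -ᵈ exponentDegree b)) (n ∸ 3)
    go (_ , _ , p≢q , ≡.refl) ≡.refl = dimension-pair (fieldRing K) Δ zd nl p≢q
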